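{- For each CSP template $T$, there is a signed graph $(H,\Pi)$ such that the decision problems $\textsc{ec-Hom}(H,\Pi)$ and $\textsc{Csp}(T)$ are polynomially equivalent. Moreover, $(H,\Pi)$ can be chosen so that $H$ is bipartite and $(H,\Pi)$ admits an ec-homomorphism to an alternating path.
   Context: A vocabulary is a finite set of pairs $(R_i,a_i)$ of relation names and arities. A relational structure $S$ over it consists of a finite domain $V(S)$ together with a relation $R_i\subseteq V(S)^{a_i}$ for each relation name. A homomorphism $S\to T$ between structures over the same vocabulary is a map $V(S)\to V(T)$ sending each tuple of each relation $R_i$ of $S$ to a tuple of $R_i$ in $T$. A CSP template is a fixed relational structure $T$; $\textsc{Csp}(T)$ is the decision problem: given a relational structure $S$ over the same vocabulary as $T$, does $S\to T$ hold? A signed graph $(G,\Sigma)$ is a finite undirected graph $G$ (loops allowed) in which every edge has a sign $+$ or $-$; $\Sigma\subseteq E(G)$ is the set of negative edges. Multiple edges of the same sign are not allowed, but two vertices may be joined by both a positive and a negative edge. An ec-homomorphism of $(G,\Sigma)$ to $(H,\Pi)$ is a map $\varphi:V(G)\to V(H)$ such that for every edge $e$ between $x$ and $y$ in $(G,\Sigma)$ there is an edge of the same sign between $\varphi(x)$ and $\varphi(y)$ in $(H,\Pi)$. For a fixed signed graph $(H,\Pi)$, $\textsc{ec-Hom}(H,\Pi)$ is the decision problem: given a signed graph $(G,\Sigma)$, is there an ec-homomorphism of $(G,\Sigma)$ to $(H,\Pi)$? An alternating path is a signed path whose consecutive edges alternate between negative and positive. Two decision problems are polynomially equivalent if each is polynomial-time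 (Turing) reducible to the other. -}

module Defs where

open import Data.Bool.Base using (Bool; true; false; T; _∧_; _∨_)
open import Data.Bool.Properties using (∨-comm)
open import Data.Fin.Base using (Fin; zero; toℕ)
open import Data.Nat.Base using (ℕ; zero; suc; _+_; _*_; _^_; _≤_; _≡ᵇ_)
open import Data.Product.Base using (Σ; ∃; ∃₂; _×_; _,_)
open import Data.Sign.Base using (Sign; opposite)
open import Data.Sign.Properties using (_≟_)
open import Data.Vec.Base using (Vec; []; _∷_; map; lookup; replicate; _[_]≔_)
import Data.Vec.Functional as Vector
open import Function.Base using (_∘_)
open import Function.Bundles using (_⇔_)
open import Relation.Binary.PropositionalEquality using (_≡_; _≢_)
open import Relation.Nullary using (¬_)
open import Relation.Nullary.Decidable using (⌊_⌋)

------------------------------------------------------------------------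
-- Relational structures

record Vocabulary : Set where
  field
    #relations : ℕ
    arity      : Fin #relations → ℕ

open Vocabulary public

-- Finite sets are taken to be Fin n, and subsets of finite sets to be
-- Bool-valued functions.

record Structure (τ : Vocabulary) : Set where
  field
    ∣V∣ : ℕ
    rel : (i : Fin (#relations τ)) → Vec (Fin ∣V∣) (arity τ i) → Bool

  V : Set
  V = Fin ∣V∣

Homomorphism : ∀ {τ} → Structure τ → Structure τ → Set
Homomorphism {τ} A B = Σ (A.V → B.V) λ f →
  ∀ i (t : Vec A.V (arity τ i)) → T (A.rel i t) → T (B.rel i (map f t))
  where
  module A = Structure A
  module B = Structure B

------------------------------------------------------------------------
-- Signed graphs

-- Two vertices carry at most one edge of each sign, but possibly both;
-- edge s x x is a loop.

record SignedGraph : Set where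
  field
    ∣V∣      : ℕ
    edge     : Sign → Fin ∣V∣ → Fin ∣V∣ → Bool
    edge-sym : ∀ s x y → edge s x y ≡ edge s y x

  V : Set
  V = Fin ∣V∣

EcHomomorphism : SignedGraph → SignedGraph → Set
EcHomomorphism G H = Σ (G.V → H.V) λ φ →
  ∀ s x y → T (G.edge s x y) → T (H.edge s (φ x) (φ y))
  where
  module G = SignedGraph G
  module H = SignedGraph H

Bipartite : SignedGraph → Set
Bipartite G = Σ (V → Bool) λ side →
  ∀ s x y → T (edge s x y) → side x ≢ side y
  where open SignedGraph G

-- The sign of the edge {i , i + 1} of the path whose first edge has
-- sign s.

signAt : Sign → ℕ → Sign
signAt s zero    = s
signAt s (suc i) = opposite (signAt s i)

-- The path 0 , 1 , … , m with m edges.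

alternatingPath : Sign → ℕ → SignedGraph
alternatingPath s m = record
  { ∣V∣      = suc m
  ; edge     = λ s′ x y → step s′ (toℕ x) (toℕ y) ∨ step s′ (toℕ y) (toℕ x)
  ; edge-sym = λ s′ x y → ∨-comm (step s′ (toℕ x) (toℕ y)) _
  }
  where
  step : Sign → ℕ → ℕ → Bool
  step s′ i j = (j ≡ᵇ suc i) ∧ ⌊ s′ ≟ signAt s i ⌋

------------------------------------------------------------------------
-- Decision problems

-- Data manipulated by programs: binary trees, as in Jones's WHILE
-- language (Computability and Complexity, 1997).  Trees correspond to
-- words of proportional length by listing their nodes in preorder.

infixr 5 _∙_

data Tree : Set where
  nil : Tree
  _∙_ : Tree → Tree → Tree

size : Tree → ℕ
size nil     = 1
size (l ∙ r) = suc (size l + size r)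

record DecisionProblem : Set₁ where
  field
    Instance : Set
    encode   : Instance → Tree
    Yes      : Instance → Set

  -- The set of trees encoding a yes-instance.
  Language : Tree → Set
  Language d = ∃ λ I → encode I ≡ d × Yes I

encodeBool : Bool → Tree
encodeBool false = nil
encodeBool true  = nil ∙ nil

encodeList : ∀ {n} → (Fin n → Tree) → Tree
encodeList = Vector.foldr _∙_ nil

encodeUnary : ℕ → Tree
encodeUnary n = encodeList {n} λ _ → nil

-- The a-dimensional truth table of an a-ary relation on Fin n.  It has
-- n ^ a entries; arities are fixed with the vocabulary, so this is
-- polynomially related to listing the tuples, the size of the domain
-- being part of the input.

encodeTable : ∀ {n} a → (Vec (Fin n) a → Bool) → Tree
encodeTable zero    R = encodeBool (R [])
encodeTable (suc a) R = encodeList λ x → encodeTable a (R ∘ (x ∷_))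

CSP : ∀ {τ} → Structure τ → DecisionProblem
CSP {τ} A = record
  { Instance = Structure τ
  ; encode   = λ S → let open Structure S in
      encodeUnary ∣V∣ ∙ encodeList λ i → encodeTable (arity τ i) (rel i)
  ; Yes      = λ S → Homomorphism S A
  }

EcHom : SignedGraph → DecisionProblem
EcHom H = record
  { Instance = SignedGraph
  ; encode   = λ G → let open SignedGraph G in
      encodeUnary ∣V∣ ∙ encodeMatrix (edge Sign.+) ∙ encodeMatrix (edge Sign.-)
  ; Yes      = λ G → EcHomomorphism G H
  }
  where
  encodeMatrix : ∀ {n} → (Fin n → Fin n → Bool) → Tree
  encodeMatrix E = encodeList λ x → encodeList λ y → encodeBool (E x y)

------------------------------------------------------------------------
-- Oracle programs

-- WHILE programs over k tree-valued variables, with an oracle command.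

data Expr (k : ℕ) : Set where
  var   : Fin k → Expr k
  nil   : Expr k
  cons  : Expr k → Expr k → Expr k
  hd tl : Expr k → Expr k

infix  6 _:=_ _:=ask_
infixr 4 _⨾_

data Command (k : ℕ) : Set where
  skip         : Command k
  _:=_         : Fin k → Expr k → Command k
  _:=ask_      : Fin k → Expr k → Command k
  _⨾_          : Command k → Command k → Command k
  if_then_else : Expr k → Command k → Command k → Command k
  while_loop   : Expr k → Command k → Command k

Store : ℕ → Set
Store = Vec Tree

left right : Tree → Tree
left nil      = nil
left (l ∙ _)  = l
right nil     = nil
right (_ ∙ r) = r

⟦_⟧ : ∀ {k} → Expr k → Store k → Tree
⟦ var x ⟧     σ = lookup σ x
⟦ nil ⟧       σ = nil
⟦ cons e e′ ⟧ σ = ⟦ e ⟧ σ ∙ ⟦ e′ ⟧ σ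
⟦ hd e ⟧      σ = left (⟦ e ⟧ σ)
⟦ tl e ⟧      σ = right (⟦ e ⟧ σ)

-- c ⊢ σ ⇓[ t ] σ′ : with the oracle L, command c started in store σ
-- halts in store σ′ after time t.  As a test, nil is false and every
-- other tree is true.
--
-- Assignments and queries are charged the size of the tree they write
-- or submit.  Under a unit-cost measure, repeating x := cons x x would
-- build a query of exponential size in linear time; here the total size
-- of the store is bounded linearly in the input size plus the time
-- used, so a Turing machine simulates a program with polynomial
-- overhead, and conversely.

module Semantics (L : Tree → Set) {k : ℕ} where

  infix 3 _⊢_⇓[_]_

  data _⊢_⇓[_]_ : Command k → Store k → ℕ → Store k → Set where

    skip : ∀ {σ} → skip ⊢ σ ⇓[ 1 ] σ

    assign : ∀ {x e σ} →
      x := e ⊢ σ ⇓[ size (⟦ e ⟧ σ) ] (σ [ x ]≔ ⟦ e ⟧ σ)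

    ask-yes : ∀ {x e σ} → L (⟦ e ⟧ σ) →
      x :=ask e ⊢ σ ⇓[ suc (size (⟦ e ⟧ σ)) ] (σ [ x ]≔ encodeBool true)

    ask-no : ∀ {x e σ} → ¬ L (⟦ e ⟧ σ) →
      x :=ask e ⊢ σ ⇓[ suc (size (⟦ e ⟧ σ)) ] (σ [ x ]≔ encodeBool false)

    seq : ∀ {c c′ σ σ′ σ″ t t′} →
      c ⊢ σ ⇓[ t ] σ′ → c′ ⊢ σ′ ⇓[ t′ ] σ″ →
      c ⨾ c′ ⊢ σ ⇓[ t + t′ ] σ″

    if-true : ∀ {e c c′ σ σ′ t} → ⟦ e ⟧ σ ≢ nil →
      c ⊢ σ ⇓[ t ] σ′ →
      if e then c else c′ ⊢ σ ⇓[ suc t ] σ′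

    if-false : ∀ {e c c′ σ σ′ t} → ⟦ e ⟧ σ ≡ nil →
      c′ ⊢ σ ⇓[ t ] σ′ →
      if e then c else c′ ⊢ σ ⇓[ suc t ] σ′

    while-true : ∀ {e c σ σ′ σ″ t t′} → ⟦ e ⟧ σ ≢ nil →
      c ⊢ σ ⇓[ t ] σ′ → while e loop c ⊢ σ′ ⇓[ t′ ] σ″ →
      while e loop c ⊢ σ ⇓[ suc (t + t′) ] σ″

    while-false : ∀ {e c σ} → ⟦ e ⟧ σ ≡ nil →
      while e loop c ⊢ σ ⇓[ 1 ] σ

------------------------------------------------------------------------
-- Polynomial-time Turing reducibility

-- Variable 0 holds the input at the start, all others being nil, and
-- the answer at the end.

initial : ∀ {k} → Tree → Store (suc k)
initial d = d ∷ replicate _ nil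

Accepting : ∀ {k} → Store (suc k) → Set
Accepting σ = lookup σ zero ≢ nil

-- One program and one polynomial serve all instances.  Sizes are
-- positive, so every polynomial bound is dominated by one of the form
-- a * size ^ b.

infix 4 _≤ᵖ_ _≡ᵖ_

_≤ᵖ_ : DecisionProblem → DecisionProblem → Set
P ≤ᵖ Q =
  Σ ℕ λ k → Σ (Command (suc k)) λ program → ∃₂ λ a b →
  (I : P.Instance) → ∃₂ λ t σ →
    (program ⊢ initial (P.encode I) ⇓[ t ] σ) ×
    (t ≤ a * size (P.encode I) ^ b) ×
    (P.Yes I ⇔ Accepting σ)
  where
  module P = DecisionProblem P
  module Q = DecisionProblem Q
  open Semantics Q.Language

_≡ᵖ_ : DecisionProblem → DecisionProblem → Set
P ≡ᵖ Q = (P ≤ᵖ Q) × (Q ≤ᵖ P)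

{-# OPTIONS --safe #-}
module Submission where

-- Both reductions use one construction S ↦ signedGraph S, and H is its
-- value at A.  Its vertices are tuples x over S placed on the levels of
-- an alternating path; an edge between consecutive levels requires some
-- coordinates to agree, and most pairs of levels also have a constraint,
-- either x₁ = x₂₊ⱼ or Rᵢ (x₂ , x₃ , …), imposed only on edges whose
-- lower end may have neighbours below and whose upper end may have
-- neighbours above.  Zigzags avoid such edges, so a map of signed graphs
-- copies tuples from level to level and meets every constraint that
-- holds.  As the path has an even number of edges, its end edges have
-- different signs, levels are preserved, and S → A iff
-- signedGraph S → signedGraph A (up to 0-ary relations).
--
-- Conversely, a signed graph G maps to signedGraph A iff for every
-- vertex v there is a level l such that placing v at l determines the
-- levels of its whole component consistently, and the constraints
-- arising in that component, an instance of CSP A, are satisfiable.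
-- Equality constraints are absorbed by saturating the relations under
-- reachability.

open import Defs
import Data.Bool.Base as Bool
open import Data.Bool.Base using (Bool; true; false; T; not; _∧_; _∨_)
open import Data.Bool.ListAction using (any; all)
open import Data.Bool.Properties using (T?; T-∧; T-∨; ∨-comm; ∨-identityʳ)
open import Data.Empty using (⊥-elim)
open import Data.Fin.Base using (Fin; zero; suc; toℕ; inject≤; fromℕ<)
import Data.Fin.Properties as Fin
open import Data.List.Base as List using (List; []; _∷_; _++_; _ʳ++_; length)
open import Data.List.Membership.Propositional using (_∈_)
open import Data.List.Membership.Propositional.Properties using (∈-concatMap⁺; ∈-map⁺; ∈-allFin)
open import Data.List.Properties using (reverse-involutive; length-replicate; length-tabulate; map-tabulate)
open import Data.List.Relation.Unary.Any as Any using (here; there)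
import Data.List.Relation.Unary.Any.Properties as Any
open import Data.Nat.Base using (ℕ; zero; suc; _+_; _*_; _^_; _⊔_; _≤_; _<_; _≡ᵇ_; z≤n; s≤s; NonZero; >-nonZero)
open import Data.Nat.Properties
open import Data.Nat.Tactic.RingSolver using (solve-∀)
open import Data.Product.Base using (Σ; ∃; ∃₂; _×_; _,_; proj₁; proj₂)
open import Data.Sign.Base as Sign using (Sign; opposite)
import Data.Sign.Properties as Sign
open import Data.Sum.Base using (_⊎_; inj₁; inj₂; [_,_])
open import Data.Unit.Base using (⊤; tt)
open import Data.Vec.Base as Vec using (Vec; []; _∷_)
open import Data.Vec.Properties using (map-cong; lookup∘tabulate; tabulate∘lookup; tabulate-cong; tabulate-∘; lookup-map)
open import Function.Base using (_∘_; id; const)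
open import Function.Bundles using (_⇔_; mk⇔; Equivalence)
open import Relation.Binary.PropositionalEquality hiding ([_])
open import Relation.Nullary using (¬_; Dec; yes; no)
open import Relation.Nullary.Decidable using (⌊_⌋; toWitness; fromWitness; map′; _→-dec_)

open Equivalence using (to; from)

-- Polynomial bounds

-- The obstacle is that a map of signed graphs moves whole tuples and need not act coordinate by
-- coordinate. Three devices make it do so. Level 0 forgets the slots, so, with ★ fixed, the base
-- coordinate of an image depends on the base coordinate alone and defines a map `g` of domains.
-- Level `m` forgets the base, so the slots of an image do not change when the base does. Diagonal
-- label `j` equates base and slot `j`: once the base is replaced by entry `j`, the equation holds
-- in the source, hence in the target, and slot `j` of the image is `g` of that entry. The relation
-- labels then say that `g` preserves the relations. The Booleans exist because tuples that violate
-- a constraint must also be connected from bottom to top; otherwise nothing would tie together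
-- their images on different levels. The number of edges is even because a path with an odd number
-- of alternating edges has a sign-preserving reversal, which would turn the levels upside down.

infixl 6 _⊕_
infixl 7 _⊗_
infixr 8 _⊚_

-- A syntax instead of arbitrary functions: every such bound is monotone, and composition, which
-- running one program after another requires, is a constructor.
data Poly : Set where
  var         : Poly
  con         : ℕ → Poly
  _⊕_ _⊗_ _⊚_ : Poly → Poly → Poly

eval : Poly → ℕ → ℕ
eval var     n = n
eval (con c) n = c
eval (p ⊕ q) n = eval p n + eval q n
eval (p ⊗ q) n = eval p n * eval q n
eval (p ⊚ q) n = eval p (eval q n)

eval-mono : ∀ p {m n} → m ≤ n → eval p m ≤ eval p n
eval-mono var     m≤n = m≤n
eval-mono (con c) m≤n = ≤-refl
eval-mono (p ⊕ q) m≤n = +-mono-≤ (eval-mono p m≤n) (eval-mono q m≤n)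
eval-mono (p ⊗ q) m≤n = *-mono-≤ (eval-mono p m≤n) (eval-mono q m≤n)
eval-mono (p ⊚ q) m≤n = eval-mono p (eval-mono q m≤n)

^-distrib-* : ∀ m n k → (m * n) ^ k ≡ m ^ k * n ^ k
^-distrib-* m n zero    = refl
^-distrib-* m n (suc k) =
  trans (cong (m * n *_) (^-distrib-* m n k)) (lemma m n (m ^ k) (n ^ k))
  where
  lemma : ∀ a b c d → a * b * (c * d) ≡ a * c * (b * d)
  lemma = solve-∀

eval-≤-monomial : ∀ p → ∃₂ λ a b → ∀ n → .{{NonZero n}} → eval p n ≤ a * n ^ b
eval-≤-monomial var     = 1 , 1 , λ n → ≤-reflexive (sym (trans (*-identityˡ _) (*-identityʳ n)))
eval-≤-monomial (con c) = c , 0 , λ n → ≤-reflexive (sym (*-identityʳ c))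
eval-≤-monomial (p ⊕ q) with eval-≤-monomial p | eval-≤-monomial q
... | a , b , p≤ | a′ , b′ , q≤ = a + a′ , b + b′ , λ n → begin
  eval p n + eval q n                ≤⟨ +-mono-≤ (p≤ n) (q≤ n) ⟩
  a * n ^ b + a′ * n ^ b′            ≤⟨ +-mono-≤ (*-monoʳ-≤ a (^-monoʳ-≤ n (m≤m+n b b′)))
                                                 (*-monoʳ-≤ a′ (^-monoʳ-≤ n (m≤n+m b′ b))) ⟩
  a * n ^ (b + b′) + a′ * n ^ (b + b′) ≡⟨ *-distribʳ-+ (n ^ (b + b′)) a a′ ⟨
  (a + a′) * n ^ (b + b′)            ∎
  where open ≤-Reasoning
eval-≤-monomial (p ⊗ q) with eval-≤-monomial p | eval-≤-monomial q
... | a , b , p≤ | a′ , b′ , q≤ = a * a′ , b + b′ , λ n → begin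
  eval p n * eval q n                ≤⟨ *-mono-≤ (p≤ n) (q≤ n) ⟩
  a * n ^ b * (a′ * n ^ b′)          ≡⟨ lemma a (n ^ b) a′ (n ^ b′) ⟩
  a * a′ * (n ^ b * n ^ b′)          ≡⟨ cong (a * a′ *_) (^-distribˡ-+-* n b b′) ⟨
  a * a′ * n ^ (b + b′)              ∎
  where
  open ≤-Reasoning
  lemma : ∀ a b c d → a * b * (c * d) ≡ a * c * (b * d)
  lemma = solve-∀
eval-≤-monomial (p ⊚ q) with eval-≤-monomial p | eval-≤-monomial q
-- `suc a′` in place of `a′` keeps the inner value positive, as the bound for `p` requires.
... | a , b , p≤ | a′ , b′ , q≤ = a * suc a′ ^ b , b′ * b , λ n → begin
  eval p (eval q n)                  ≤⟨ eval-mono p (≤-trans (q≤ n) (*-monoˡ-≤ (n ^ b′) (n≤1+n a′))) ⟩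
  eval p (suc a′ * n ^ b′)           ≤⟨ p≤ _ {{m*n≢0 (suc a′) (n ^ b′) {{_}} {{m^n≢0 n b′}}}} ⟩
  a * (suc a′ * n ^ b′) ^ b          ≡⟨ cong (a *_) (^-distrib-* (suc a′) (n ^ b′) b) ⟩
  a * (suc a′ ^ b * (n ^ b′) ^ b)    ≡⟨ cong (λ x → a * (suc a′ ^ b * x)) (^-*-assoc n b′ b) ⟩
  a * (suc a′ ^ b * n ^ (b′ * b))    ≡⟨ *-assoc a _ _ ⟨
  a * suc a′ ^ b * n ^ (b′ * b)      ∎
  where open ≤-Reasoning

-- Trees and lists

size>0 : ∀ d → 1 ≤ size d
size>0 nil     = s≤s z≤n
size>0 (l ∙ r) = s≤s z≤n

size-left : ∀ d → size (left d) ≤ size d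
size-left nil     = ≤-refl
size-left (l ∙ r) = m≤n⇒m≤1+n (m≤m+n (size l) (size r))

size-right : ∀ d → size (right d) ≤ size d
size-right nil     = ≤-refl
size-right (l ∙ r) = m≤n⇒m≤1+n (m≤n+m (size r) (size l))

isNil : Tree → Bool
isNil nil     = true
isNil (_ ∙ _) = false

codeList : {A : Set} → (A → Tree) → List A → Tree
codeList c []       = nil
codeList c (x ∷ xs) = c x ∙ codeList c xs

length≤size : {A : Set} (c : A → Tree) (xs : List A) → length xs ≤ size (codeList c xs)
length≤size c []       = z≤n
length≤size c (x ∷ xs) = s≤s (≤-trans (length≤size c xs) (m≤n+m _ (size (c x))))

unary : ℕ → Tree
unary zero    = nil
unary (suc n) = nil ∙ unary n

encodeUnary≡unary : ∀ n → encodeUnary n ≡ unary n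
encodeUnary≡unary zero    = refl
encodeUnary≡unary (suc n) = cong (nil ∙_) (encodeUnary≡unary n)

encodeList-cong : ∀ {n} {f g : Fin n → Tree} → (∀ i → f i ≡ g i) → encodeList f ≡ encodeList g
encodeList-cong {zero}  f≗g = refl
encodeList-cong {suc n} f≗g = cong₂ _∙_ (f≗g zero) (encodeList-cong (f≗g ∘ suc))

encodeList-lookup : {A : Set} (c : A → Tree) (xs : List A) →
  encodeList (c ∘ List.lookup xs) ≡ codeList c xs
encodeList-lookup c []       = refl
encodeList-lookup c (x ∷ xs) = cong (c x ∙_) (encodeList-lookup c xs)

encodeUnary-length : {A : Set} (xs : List A) → encodeUnary (length xs) ≡ codeList (const nil) xs
encodeUnary-length []       = refl
encodeUnary-length (x ∷ xs) = cong (nil ∙_) (encodeUnary-length xs)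

codeList-map : {A B : Set} (c : B → Tree) (f : A → B) (xs : List A) →
  codeList c (List.map f xs) ≡ codeList (c ∘ f) xs
codeList-map c f []       = refl
codeList-map c f (x ∷ xs) = cong (c (f x) ∙_) (codeList-map c f xs)

codeList-cong : {A : Set} {c c′ : A → Tree} → (∀ x → c x ≡ c′ x) → ∀ xs → codeList c xs ≡ codeList c′ xs
codeList-cong c≗c′ []       = refl
codeList-cong c≗c′ (x ∷ xs) = cong₂ _∙_ (c≗c′ x) (codeList-cong c≗c′ xs)

dropTree : ℕ → Tree → Tree
dropTree zero    d = d
dropTree (suc k) d = dropTree k (right d)

right-dropTree : ∀ k d → right (dropTree k d) ≡ dropTree k (right d)
right-dropTree zero    d = refl
right-dropTree (suc k) d = right-dropTree k (right d)

dropTree-nil : ∀ k → dropTree k nil ≡ nil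
dropTree-nil zero    = refl
dropTree-nil (suc k) = dropTree-nil k

size-dropTree : ∀ k d → size (dropTree k d) ≤ size d
size-dropTree zero    d = ≤-refl
size-dropTree (suc k) d = ≤-trans (size-dropTree k (right d)) (size-right d)

left-dropTree : ∀ {n} (f : Fin n → Tree) i → left (dropTree (toℕ i) (encodeList f)) ≡ f i
left-dropTree f zero    = refl
left-dropTree f (suc i) = left-dropTree (f ∘ suc) i

-- Dropping acts as truncated subtraction, because `right nil` is `nil`. Each test is an inequality
-- of unary numbers, and the two together give equality.
isNil-dropTree : ∀ m n → isNil (dropTree m (unary n)) ∧ isNil (dropTree n (unary m)) ≡ (m ≡ᵇ n)
isNil-dropTree zero    zero    = refl
isNil-dropTree zero    (suc n) = refl
isNil-dropTree (suc m) zero    rewrite dropTree-nil m = refl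
isNil-dropTree (suc m) (suc n) = isNil-dropTree m n

allF anyF : ∀ {k} → (Fin k → Bool) → Bool
allF {zero}  p = true
allF {suc k} p = p zero ∧ allF (p ∘ suc)
anyF {zero}  p = false
anyF {suc k} p = p zero ∨ anyF (p ∘ suc)

infix 5 _==_

_==_ : ∀ {m n} → Fin m → Fin n → Bool
i == j = toℕ i ≡ᵇ toℕ j

filterB : {A : Set} → (A → Bool) → List A → List A
filterB p []       = []
filterB p (x ∷ xs) = Bool.if p x then x ∷ filterB p xs else filterB p xs

allVec : ∀ n d → List (Vec (Fin n) d)
allVec n zero    = [] ∷ []
allVec n (suc d) = List.concatMap (λ i → List.map (i ∷_) (allVec n d)) (List.allFin n)

-- Typed encodings

record Ctx : Set₁ where
  field
    Carrier : Set
    enc     : Carrier → Tree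

open Ctx public

-- A family over the context, since the range of a `fin` depends on the instance at hand. Codes may
-- forget information: a `Fin` is stored without its bound.
record Ty (Γ : Ctx) : Set₁ where
  field
    El   : Carrier Γ → Set
    code : ∀ γ → El γ → Tree

open Ty public

infixl 5 _▷_
infixl 8 _⇑_

_▷_ : (Γ : Ctx) → Ty Γ → Ctx
Carrier (Γ ▷ A) = Σ (Carrier Γ) (El A)
enc     (Γ ▷ A) γ = code A (proj₁ γ) (proj₂ γ) ∙ enc Γ (proj₁ γ)

_⇑_ : ∀ {Γ} → Ty Γ → (B : Ty Γ) → Ty (Γ ▷ B)
El   (A ⇑ B) γ = El A (proj₁ γ)
code (A ⇑ B) γ = code A (proj₁ γ)

module _ {Γ : Ctx} where

  infixr 7 _⊠_

  tree bool nat : Ty Γ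
  El tree γ = Tree
  code tree γ d = d
  El bool γ = Bool
  code bool γ b = encodeBool b
  El nat γ = ℕ
  code nat γ n = unary n

  fin : (Carrier Γ → ℕ) → Ty Γ
  El   (fin n) γ   = Fin (n γ)
  code (fin n) γ i = unary (toℕ i)

  list : Ty Γ → Ty Γ
  El   (list A) γ = List (El A γ)
  code (list A) γ = codeList (code A γ)

  _⊠_ : Ty Γ → Ty Γ → Ty Γ
  El   (A ⊠ B) γ = El A γ × El B γ
  code (A ⊠ B) γ p = code A γ (proj₁ p) ∙ code B γ (proj₂ p)

  vec : Ty Γ → ℕ → Ty Γ
  El   (vec A k) γ = Vec (El A γ) k
  code (vec A k) γ v = Vec.foldr (λ _ → Tree) (λ a d → code A γ a ∙ d) nil v

  table : (Carrier Γ → ℕ) → ℕ → Ty Γ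
  El   (table n a) γ   = Vec (Fin (n γ)) a → Bool
  code (table n a) γ R = encodeTable a R

  -- Elements of B, of which only the image under f is stored.
  via : ∀ {B : Carrier Γ → Set} (A : Ty Γ) → (∀ γ → B γ → El A γ) → Ty Γ
  El   (via {B} A f) = B
  code (via A f) γ b = code A γ (f γ b)

-- A polynomial bounds the output of `f` in terms of its argument. Evaluated at `Q`, a bound on the
-- whole list, it gives one `b` that serves all entries.
size-map : {A B : Set} (c : A → Tree) (c′ : B → Tree) (f : A → B) (Q b : ℕ) →
  (∀ x → size (c x) ≤ Q → size (c′ (f x)) ≤ b) →
  ∀ xs → size (codeList c xs) ≤ Q → size (codeList c′ (List.map f xs)) ≤ size (codeList c xs) * suc b
size-map c c′ f Q b f≤ []       _ = s≤s z≤n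
size-map c c′ f Q b f≤ (x ∷ xs) ≤Q = s≤s (+-mono-≤
  (f≤ x (≤-trans (m≤n⇒m≤1+n (m≤m+n _ _)) ≤Q))
  (≤-trans (size-map c c′ f Q b f≤ xs (≤-trans (m≤n⇒m≤1+n (m≤n+m _ (size (c x)))) ≤Q))
    (*-monoˡ-≤ (suc b) (m≤n+m (size (codeList c xs)) (size (c x))))))

size-++ : {A : Set} (c : A → Tree) (xs ys : List A) →
  size (codeList c (xs ++ ys)) ≤ size (codeList c xs) + size (codeList c ys)
size-++ c []       ys = n≤1+n _
size-++ c (x ∷ xs) ys = s≤s (≤-trans (+-monoʳ-≤ (size (c x)) (size-++ c xs ys))
                               (≤-reflexive (sym (+-assoc (size (c x)) _ _))))

size-concatMap : {A B : Set} (c : A → Tree) (c′ : B → Tree) (f : A → List B) (Q b : ℕ) →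
  (∀ x → size (c x) ≤ Q → size (codeList c′ (f x)) ≤ b) →
  ∀ xs → size (codeList c xs) ≤ Q → size (codeList c′ (List.concatMap f xs)) ≤ size (codeList c xs) * suc b
size-concatMap c c′ f Q b f≤ []       _ = s≤s z≤n
size-concatMap c c′ f Q b f≤ (x ∷ xs) ≤Q = ≤-trans (size-++ c′ (f x) _) (m≤n⇒m≤1+n (+-mono-≤
  (f≤ x (≤-trans (m≤n⇒m≤1+n (m≤m+n _ _)) ≤Q))
  (≤-trans (size-concatMap c c′ f Q b f≤ xs (≤-trans (m≤n⇒m≤1+n (m≤n+m _ (size (c x)))) ≤Q))
    (*-monoˡ-≤ (suc b) (m≤n+m (size (codeList c xs)) (size (c x)))))))

size-filterB : {A : Set} (c : A → Tree) (p : A → Bool) (xs : List A) →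
  size (codeList c (filterB p xs)) ≤ size (codeList c xs)
size-filterB c p []       = ≤-refl
size-filterB c p (x ∷ xs) with p x
... | true  = s≤s (+-monoʳ-≤ (size (c x)) (size-filterB c p xs))
... | false = m≤n⇒m≤1+n (≤-trans (size-filterB c p xs) (m≤n+m _ (size (c x))))

size-encodeBool : ∀ b → size (encodeBool b) ≤ 3
size-encodeBool true  = ≤-refl
size-encodeBool false = s≤s z≤n

-- Each round filters `D` instead of extending the previous list, so from round 1 on every iterate
-- is a sublist of `D`. This bounds both its size and the number of rounds until it is stable.
iter : {A : Set} → List A → (A → A → Bool) → A → ℕ → List A
iter D B a zero    = a ∷ []
iter D B a (suc k) = filterB (λ y → any (λ x → B x y) (iter D B a k)) D

reach : {A : Set} → List A → (A → A → Bool) → A → A → Bool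
reach D B a z = any (λ x → B x z) (iter D B a (length D))

size-unary : ∀ n → size (unary n) ≡ 1 + (n + n)
size-unary zero    = refl
size-unary (suc n) = cong suc (trans (cong suc (size-unary n)) (sym (cong suc (+-suc n n))))

size-codeList : ∀ {A : Set} (c : A → Tree) b → (∀ x → size (c x) ≤ b) → ∀ xs →
  size (codeList c xs) ≤ suc (length xs * suc b)
size-codeList c b c≤ []       = ≤-refl
size-codeList c b c≤ (x ∷ xs) = s≤s (≤-trans (+-mono-≤ (c≤ x) (size-codeList c b c≤ xs))
  (≤-reflexive (+-suc b _)))

-- Agrees by computation with the code used by `EcHom`. The matrices are written as tables of arity
-- 2 so that `applyᵗ` reads their entries.
graph : ∀ {Γ} → Ty Γ
El   graph γ   = SignedGraph
code graph γ G = let open SignedGraph G in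
  encodeUnary ∣V∣ ∙ encodeTable 2 (λ v → edge Sign.+ (Vec.lookup v zero) (Vec.lookup v (suc zero)))
                  ∙ encodeTable 2 (λ v → edge Sign.- (Vec.lookup v zero) (Vec.lookup v (suc zero)))

structure : ∀ {Γ} → Vocabulary → Ty Γ
El   (structure τ) γ   = Structure τ
code (structure τ) γ S = let open Structure S in
  encodeUnary ∣V∣ ∙ encodeList λ i → encodeTable (arity τ i) (rel i)

graphOn : {A : Set} → List A → (E : Sign → A → A → Bool) → (∀ s x y → E s x y ≡ E s y x) → SignedGraph
graphOn D E E-sym = record
  { ∣V∣      = length D
  ; edge     = λ s x y → E s (List.lookup D x) (List.lookup D y)
  ; edge-sym = λ s x y → E-sym s (List.lookup D x) (List.lookup D y)
  }

structureOn : ∀ {τ} {A : Set} → List A → (∀ i → Vec A (arity τ i) → Bool) → Structure τ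
structureOn D P = record { ∣V∣ = length D ; rel = λ i u → P i (Vec.map (List.lookup D) u) }

-- The value `false` at positive arity makes an implication from it vacuous, so that only 0-ary
-- relations are compared.
nullary : ∀ {n} a → (Vec (Fin n) a → Bool) → Bool
nullary zero    R = R []
nullary (suc a) R = false

-- Decidability, and injectivity of the encodings

∙-injective : ∀ {a b c d} → a ∙ b ≡ c ∙ d → a ≡ c × b ≡ d
∙-injective refl = refl , refl

encodeBool-injective : ∀ {b c} → encodeBool b ≡ encodeBool c → b ≡ c
encodeBool-injective {false} {false} _ = refl
encodeBool-injective {true}  {true}  _ = refl

encodeList-injective : ∀ {n} {f g : Fin n → Tree} → encodeList f ≡ encodeList g → ∀ i → f i ≡ g i
encodeList-injective eq zero    = proj₁ (∙-injective eq)
encodeList-injective eq (suc i) = encodeList-injective (proj₂ (∙-injective eq)) i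

encodeTable-injective : ∀ {n} a {R R′ : Vec (Fin n) a → Bool} → encodeTable a R ≡ encodeTable a R′ → ∀ v → R v ≡ R′ v
encodeTable-injective zero    eq []      = encodeBool-injective eq
encodeTable-injective (suc a) eq (x ∷ v) = encodeTable-injective a (encodeList-injective eq x) v

encodeUnary-injective : ∀ {m n} → encodeUnary m ≡ encodeUnary n → m ≡ n
encodeUnary-injective {zero}  {zero}  _  = refl
encodeUnary-injective {suc m} {suc n} eq = cong suc (encodeUnary-injective (proj₂ (∙-injective eq)))

existsVec? : ∀ k {m} {P : Vec (Fin m) k → Set} → (∀ v → Dec (P v)) → Dec (∃ P)
existsVec? zero    P? = map′ ([] ,_) (λ { ([] , p) → p }) (P? [])
existsVec? (suc k) P? = map′ (λ (i , v , p) → i ∷ v , p) (λ { (i ∷ v , p) → i , v , p })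
  (Fin.any? λ i → existsVec? k (P? ∘ (i ∷_)))

forallVec? : ∀ k {m} {P : Vec (Fin m) k → Set} → (∀ v → Dec (P v)) → Dec (∀ v → P v)
forallVec? zero    P? = map′ (λ { p [] → p }) (λ p → p []) (P? [])
forallVec? (suc k) P? = map′ (λ { p (i ∷ v) → p i v }) (λ p i v → p (i ∷ v))
  (Fin.all? λ i → forallVec? k (P? ∘ (i ∷_)))

-- The search runs through vectors. A function agrees with the lookup of its own table only
-- pointwise, hence the closure condition on `P`.
existsMap? : ∀ {k m} {P : (Fin k → Fin m) → Set} → (∀ {f g} → (∀ i → f i ≡ g i) → P f → P g) →
  (∀ f → Dec (P f)) → Dec (∃ P)
existsMap? {k} resp P? = map′ (λ (v , p) → Vec.lookup v , p)
  (λ (f , p) → Vec.tabulate f , resp (sym ∘ lookup∘tabulate f) p) (existsVec? k (P? ∘ Vec.lookup))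

homomorphism? : ∀ {τ} (S A : Structure τ) → Dec (Homomorphism S A)
homomorphism? {τ} S A = existsMap?
  (λ f≗g h i t St → subst (T ∘ Structure.rel A i) (map-cong f≗g t) (h i t St))
  (λ f → Fin.all? λ i → forallVec? (arity τ i) λ t → T? _ →-dec T? _)

bothSigns? : {P : Sign → Set} → (∀ s → Dec (P s)) → Dec (∀ s → P s)
bothSigns? P? with P? Sign.+ | P? Sign.-
... | yes p | yes q = yes λ { Sign.+ → p ; Sign.- → q }
... | no ¬p | _     = no λ p → ¬p (p Sign.+)
... | yes _ | no ¬q = no λ p → ¬q (p Sign.-)

ecHomomorphism? : ∀ G H → Dec (EcHomomorphism G H)
ecHomomorphism? G H = existsMap?
  (λ f≗g h s x y e → subst₂ (λ u v → T (SignedGraph.edge H s u v)) (f≗g x) (f≗g y) (h s x y e))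
  (λ f → bothSigns? λ s → Fin.all? λ x → Fin.all? λ y → T? _ →-dec T? _)

-- Equal codes give equal domains but relations that agree only pointwise, so the answer is
-- transported and not the instance.
CSP-injective : ∀ {τ} (A S S′ : Structure τ) → let open DecisionProblem (CSP A) in
  encode S ≡ encode S′ → Yes S → Yes S′
CSP-injective {τ} A S S′ eq h = transport _ _ (encodeUnary-injective (proj₁ (∙-injective eq)))
  (encodeList-injective (proj₂ (∙-injective eq))) h
  where
  module A = Structure A
  transport : ∀ {n n′} (R : ∀ i → Vec (Fin n) (arity τ i) → Bool) (R′ : ∀ i → Vec (Fin n′) (arity τ i) → Bool) →
    n ≡ n′ → (∀ i → encodeTable (arity τ i) (R i) ≡ encodeTable (arity τ i) (R′ i)) →
    Homomorphism (record { ∣V∣ = n ; rel = R }) A → Homomorphism (record { ∣V∣ = n′ ; rel = R′ }) A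
  transport R R′ refl R≡R′ (f , hom) = f , λ i t R′t →
    hom i t (subst T (sym (encodeTable-injective (arity τ i) (R≡R′ i) t)) R′t)

EcHom-injective : ∀ H G G′ → let open DecisionProblem (EcHom H) in
  encode G ≡ encode G′ → Yes G → Yes G′
EcHom-injective H G G′ eq = transport (edge G) (edge G′) (encodeUnary-injective (proj₁ (∙-injective eq)))
  λ { Sign.+ → proj₁ (∙-injective (proj₂ (∙-injective eq)))
    ; Sign.- → proj₂ (∙-injective (proj₂ (∙-injective eq))) }
  where
  open SignedGraph using (edge)
  matrix : ∀ {n} → (Sign → Fin n → Fin n → Bool) → Sign → Tree
  matrix E s = encodeList λ x → encodeList λ y → encodeBool (E s x y)
  transport : ∀ {n n′} (E : Sign → Fin n → Fin n → Bool) (E′ : Sign → Fin n′ → Fin n′ → Bool) →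
    n ≡ n′ → (∀ s → matrix E s ≡ matrix E′ s) →
    (Σ (Fin n → _) λ φ → ∀ s x y → T (E s x y) → T (edge H s (φ x) (φ y))) →
    (Σ (Fin n′ → _) λ φ → ∀ s x y → T (E′ s x y) → T (edge H s (φ x) (φ y)))
  transport E E′ refl E≡E′ (φ , hom) = φ , λ s x y E′xy → hom s x y (subst T (sym
    (encodeBool-injective (encodeList-injective (encodeList-injective (E≡E′ s) x) y))) E′xy)

-- The oracle speaks about trees: a tree is in the language if some instance with that code is a
-- yes-instance. Deciding this for the code of `I` therefore requires that the answer depend on the
-- code only.
language? : ∀ P → (∀ I → Dec (DecisionProblem.Yes P I)) →
  (∀ I J → DecisionProblem.encode P I ≡ DecisionProblem.encode P J → DecisionProblem.Yes P I → DecisionProblem.Yes P J) →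
  ∀ I → Dec (DecisionProblem.Language P (DecisionProblem.encode P I))
language? P yes? inj I = map′ (λ y → I , refl , y) (λ (J , eq , y) → inj J I eq y) (yes? I)

-- Boolean reflection

T-implies : ∀ {x y} → T (not x ∨ y) ⇔ (T x → T y)
T-implies {true}  = mk⇔ (λ y _ → y) (λ f → f tt)
T-implies {false} = mk⇔ (λ _ ()) (λ _ → tt)

T-allF : ∀ {k} {p : Fin k → Bool} → T (allF p) ⇔ (∀ i → T (p i))
T-allF {zero}      = mk⇔ (λ _ ()) (λ _ → tt)
T-allF {suc k} {p} = mk⇔
  (λ { h zero → proj₁ (to T-∧ h) ; h (suc i) → to T-allF (proj₂ (to T-∧ h)) i })
  (λ h → from T-∧ (h zero , from (T-allF {p = p ∘ suc}) (h ∘ suc)))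

T-anyF : ∀ {k} {p : Fin k → Bool} → T (anyF p) ⇔ ∃ (T ∘ p)
T-anyF {zero}      = mk⇔ (λ ()) (λ ())
T-anyF {suc k} {p} = mk⇔
  (λ h → [ zero ,_ , (λ h → let i , q = to T-anyF h in suc i , q) ] (to (T-∨ {p zero}) h))
  λ { (zero , q) → from (T-∨ {p zero}) (inj₁ q)
    ; (suc i , q) → from (T-∨ {p zero}) (inj₂ (from (T-anyF {p = p ∘ suc}) (i , q))) }

T-== : ∀ {n} {i j : Fin n} → T (i == j) ⇔ i ≡ j
T-== {i = i} {j} = mk⇔ (Fin.toℕ-injective ∘ ≡ᵇ⇒≡ (toℕ i) (toℕ j)) (≡⇒≡ᵇ (toℕ i) (toℕ j) ∘ cong toℕ)

T-does : {P : Set} (P? : Dec P) → T (Dec.does P?) ⇔ P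
T-does (yes p) = mk⇔ (λ _ → p) (λ _ → tt)
T-does (no ¬p) = mk⇔ (λ ()) ¬p

lookup-ext : ∀ {A : Set} {n} {x y : Vec A n} → (∀ i → Vec.lookup x i ≡ Vec.lookup y i) → x ≡ y
lookup-ext {x = x} {y} eq = trans (sym (tabulate∘lookup x)) (trans (tabulate-cong eq) (tabulate∘lookup y))

-- Graphs on lists

Complete : {A : Set} → List A → Set
Complete D = ∀ a → a ∈ D

lookup-index : ∀ {A : Set} {D : List A} {a} (a∈D : a ∈ D) → List.lookup D (Any.index a∈D) ≡ a
lookup-index a∈D = sym (Any.lookup-index a∈D)

pairs : {A B : Set} → List A → List B → List (A × B)
pairs xs ys = List.concatMap (λ x → List.map (x ,_) ys) xs

pairs-complete : {A B : Set} {xs : List A} {ys : List B} → Complete xs → Complete ys → Complete (pairs xs ys)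
pairs-complete {xs = xs} ∈xs ∈ys (a , b) =
  ∈-concatMap⁺ _ {xs = xs} (Any.map (λ { refl → ∈-map⁺ _ (∈ys b) }) (∈xs a))

allVec-complete : ∀ {n} d → Complete (allVec n d)
allVec-complete zero    []      = here refl
allVec-complete {n} (suc d) (i ∷ v) =
  ∈-concatMap⁺ _ {xs = List.allFin n} (Any.map (λ { refl → ∈-map⁺ _ (allVec-complete d v) }) (∈-allFin i))

booleans : List Bool
booleans = true ∷ false ∷ []

booleans-complete : Complete booleans
booleans-complete true  = here refl
booleans-complete false = there (here refl)

EcHom-graphOn : {A B : Set} {D : List A} {D′ : List B}
  {E : Sign → A → A → Bool} {E-sym : ∀ s x y → E s x y ≡ E s y x}
  {E′ : Sign → B → B → Bool} {E′-sym : ∀ s x y → E′ s x y ≡ E′ s y x} → Complete D → Complete D′ →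
  EcHomomorphism (graphOn D E E-sym) (graphOn D′ E′ E′-sym) ⇔
  Σ (A → B) λ Φ → ∀ s x y → T (E s x y) → T (E′ s (Φ x) (Φ y))
EcHom-graphOn {D = D} {D′} {E} {E′ = E′} ∈D ∈D′ = mk⇔
  (λ (φ , hom) → (λ a → List.lookup D′ (φ (Any.index (∈D a)))) , λ s x y e →
    hom s _ _ (subst₂ (λ u v → T (E s u v)) (sym (lookup-index (∈D x))) (sym (lookup-index (∈D y))) e))
  (λ (Φ , hom) → (λ i → Any.index (∈D′ (Φ (List.lookup D i)))) , λ s i j e →
    subst₂ (λ u v → T (E′ s u v)) (sym (lookup-index (∈D′ _))) (sym (lookup-index (∈D′ _))) (hom s _ _ e))

-- Alternating paths

signAt-+ : ∀ a b → signAt Sign.+ (a + b) ≡ signAt Sign.+ a Sign.* signAt Sign.+ b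
signAt-+ zero    b = refl
signAt-+ (suc a) b = trans (cong opposite (signAt-+ a b)) (opposite-* (signAt Sign.+ a) (signAt Sign.+ b))
  where
  opposite-* : ∀ s t → opposite (s Sign.* t) ≡ opposite s Sign.* t
  opposite-* Sign.+ t = refl
  opposite-* Sign.- t = Sign.opposite-involutive t

signAt-double : ∀ n → signAt Sign.+ (n + n) ≡ Sign.+
signAt-double n = trans (signAt-+ n n) (Sign.s*s≡+ (signAt Sign.+ n))

signAt-suc : ∀ n → signAt Sign.+ (suc n) ≢ signAt Sign.+ n
signAt-suc n eq = Sign.s≢opposite[s] _ (sym eq)

step : Sign → ℕ → ℕ → Bool
step s i j = (j ≡ᵇ suc i) ∧ ⌊ s Sign.≟ signAt Sign.+ i ⌋

T-step : ∀ {s i j} → T (step s i j) ⇔ (j ≡ suc i × s ≡ signAt Sign.+ i)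
T-step {s} {i} {j} = mk⇔
  (λ h → let p , q = to T-∧ h in ≡ᵇ⇒≡ j (suc i) p , toWitness q)
  (λ (p , q) → from T-∧ (≡⇒≡ᵇ j (suc i) p , fromWitness q))

PathAdj : Sign → ℕ → ℕ → Set
PathAdj s i j = (j ≡ suc i × s ≡ signAt Sign.+ i) ⊎ (i ≡ suc j × s ≡ signAt Sign.+ j)

PathAdj-sym : ∀ {s i j} → PathAdj s i j → PathAdj s j i
PathAdj-sym = [ inj₂ , inj₁ ]

-- The two edges at an inner vertex of the path have different signs, so a vertex and a sign
-- determine the neighbour. All propagation of levels rests on this.
PathAdj-unique : ∀ {s i j k} → PathAdj s i j → PathAdj s i k → j ≡ k
PathAdj-unique (inj₁ (refl , _))    (inj₁ (refl , _)) = refl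
PathAdj-unique {k = k} (inj₁ (refl , refl)) (inj₂ (refl , eq)) = ⊥-elim (signAt-suc k eq)
PathAdj-unique {j = j} (inj₂ (refl , refl)) (inj₁ (refl , eq)) = ⊥-elim (signAt-suc j (sym eq))
PathAdj-unique (inj₂ (refl , _))    (inj₂ (refl , _)) = refl

-- A walk along a path of even length whose signs alternate starting
-- with the sign of the first edge can only traverse the path: walking
-- backwards, it would start with the sign of the last edge.
walk-rigid : ∀ m → signAt Sign.+ m ≡ Sign.+ → (a : (l : ℕ) → .(l ≤ m) → ℕ) →
  (∀ l .(p : l ≤ m) → a l p ≤ m) →
  (∀ l .(p : suc l ≤ m) → PathAdj (signAt Sign.+ l) (a l (<⇒≤ p)) (a (suc l) p)) →
  a 0 z≤n ≡ 0
walk-rigid m even a a≤m steps = start (signAt Sign.+ a₀) refl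
  where
  a₀ : ℕ
  a₀ = a 0 z≤n
  -- If `signAt` is positive at `a₀`, then at `a₀ + l` it is the sign of step `l`, so this step
  -- follows the upward edge.
  rising : signAt Sign.+ a₀ ≡ Sign.+ → ∀ l .(p : l ≤ m) → a l p ≡ a₀ + l
  rising pos zero    p = sym (+-identityʳ a₀)
  rising pos (suc l) p with steps l p
  ... | inj₁ (up , _)  = trans up (trans (cong suc (rising pos l (<⇒≤ p))) (sym (+-suc a₀ l)))
  ... | inj₂ (down , s≡) = ⊥-elim (signAt-suc (a (suc l) p) (trans (cong (signAt Sign.+) (sym down))
      (trans (cong (signAt Sign.+) (rising pos l (<⇒≤ p))) (trans (signAt-+ a₀ l)
        (trans (cong (Sign._* signAt Sign.+ l) pos) s≡)))))
  falling : signAt Sign.+ a₀ ≡ Sign.- → ∀ l .(p : l ≤ m) → a₀ ≡ a l p + l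
  falling neg zero    p = sym (+-identityʳ a₀)
  falling neg (suc l) p with steps l p
  ... | inj₂ (down , _) = trans (falling neg l (<⇒≤ p)) (trans (cong (_+ l) down) (sym (+-suc _ l)))
  ... | inj₁ (_ , s≡) with trans (sym neg) (trans (cong (signAt Sign.+) (falling neg l (<⇒≤ p)))
      (trans (signAt-+ (a l (<⇒≤ p)) l) (trans (cong (Sign._* signAt Sign.+ l) (sym s≡)) (Sign.s*s≡+ (signAt Sign.+ l)))))
  ...   | ()
  start : ∀ s → signAt Sign.+ a₀ ≡ s → a₀ ≡ 0
  start Sign.+ pos = m+n≤o⇒m≡0 (subst (_≤ m) (rising pos m ≤-refl) (a≤m m ≤-refl))
    where
    m+n≤o⇒m≡0 : ∀ {a n} → a + n ≤ n → a ≡ 0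
    m+n≤o⇒m≡0 {zero}      _ = refl
    m+n≤o⇒m≡0 {suc a} {n} p = ⊥-elim (<-irrefl refl (≤-trans (s≤s (m≤n+m n a)) p))
  -- A walk that descends for `m` steps begins at `m`, where `signAt` is positive because `m` is
  -- even.
  start Sign.- neg with trans (sym neg) (trans (cong (signAt Sign.+) a₀≡m) even)
    where
    a₀≡m : a₀ ≡ m
    a₀≡m = ≤-antisym (a≤m 0 z≤n) (subst (m ≤_) (sym (falling neg m ≤-refl)) (m≤n+m m _))
  ... | ()

maxF : ∀ {k} → (Fin k → ℕ) → ℕ
maxF {zero}  f = 0
maxF {suc k} f = f zero ⊔ maxF (f ∘ suc)

≤maxF : ∀ {k} (f : Fin k → ℕ) i → f i ≤ maxF f
≤maxF f zero    = m≤m⊔n _ _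
≤maxF f (suc i) = ≤-trans (≤maxF (f ∘ suc) i) (m≤n⊔m (f zero) _)

prepend : {A : Set} (n : ℕ) → (Fin n → A) → (ℕ → A) → ℕ → A
prepend zero    f g u       = g u
prepend (suc n) f g zero    = f zero
prepend (suc n) f g (suc u) = prepend n (f ∘ suc) g u

prepend-toℕ : ∀ {A : Set} {n} (f : Fin n → A) g i → prepend n f g (toℕ i) ≡ f i
prepend-toℕ f g zero    = refl
prepend-toℕ f g (suc i) = prepend-toℕ (f ∘ suc) g i

prepend-+ : ∀ {A : Set} n (f : Fin n → A) g u → prepend n f g (n + u) ≡ g u
prepend-+ zero    f g u = refl
prepend-+ (suc n) f g u = prepend-+ n (f ∘ suc) g u

prepend-elim : ∀ {A : Set} (P : A → Set) n (f : Fin n → A) g b → (∀ i → P (f i)) → (∀ u → u < b → P (g u)) →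
  ∀ u → u < n + b → P (prepend n f g u)
prepend-elim P zero    f g b Pf Pg u       u<   = Pg u u<
prepend-elim P (suc n) f g b Pf Pg zero    u<   = Pf zero
prepend-elim P (suc n) f g b Pf Pg (suc u) (s≤s u<) = prepend-elim P n (f ∘ suc) g b (Pf ∘ suc) Pg u u<

pad : ∀ {A : Set} {a r} → A → a ≤ r → Vec A a → Vec A r
pad z z≤n     []      = Vec.replicate _ z
pad z (s≤s p) (x ∷ v) = x ∷ pad z p v

lookup-pad : ∀ {A : Set} {a r} (z : A) (p : a ≤ r) v j → Vec.lookup (pad z p v) (inject≤ j p) ≡ Vec.lookup v j
lookup-pad z (s≤s p) (x ∷ v) zero    = refl
lookup-pad z (s≤s p) (x ∷ v) (suc j) = lookup-pad z p v j

-- The signed graph of a structure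

module Construction (τ : Vocabulary) where

  -- The path has one bottom edge, `r` diagonal, `k` relation and `half` idle edges and one top
  -- edge, that is 2 + 2(r + k) in all. A tuple consists of ★, the base and `r` slots.
  k r half m d : ℕ
  k    = #relations τ
  r    = maxF (arity τ)
  half = r + k
  m    = suc (suc (r + (k + half)))
  d    = suc (suc r)

  arity≤r : ∀ i → arity τ i ≤ r
  arity≤r = ≤maxF (arity τ)

  m-even : signAt Sign.+ m ≡ Sign.+
  m-even = trans (Sign.opposite-involutive _) (trans (cong (signAt Sign.+) (sym (+-assoc r k half))) (signAt-double half))

  -- label l says what an edge between levels l and suc l keeps and tests.
  -- The idle labels only serve to make m even.
  data Label : Set where
    bottom top idle : Label
    diagonal        : Fin r → Label
    relation        : Fin k → Label

  label : ℕ → Label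
  label zero    = bottom
  label (suc u) = prepend r diagonal (prepend k relation (prepend half (const idle) (const top))) u

  -- ★ is kept along every edge, so that the coordinates ★ of a placed
  -- signed graph record which placements are connected.
  pattern ★      = zero
  pattern base   = suc zero
  pattern slot j = suc (suc j)

  -- The bottom edge separates the base from the slots and the top edge the slots from the base; see
  -- `G-base` and `G-slot`.
  keeps : Label → Fin d → Bool
  keeps bottom (slot _) = false
  keeps top    base     = false
  keeps _      _        = true

  label-diagonal : ∀ j → label (suc (toℕ j)) ≡ diagonal j
  label-diagonal = prepend-toℕ diagonal _

  label-relation : ∀ i → label (suc (r + toℕ i)) ≡ relation i
  label-relation i = trans (prepend-+ r diagonal _ (toℕ i)) (prepend-toℕ relation _ i)

  label-top : label (suc (r + (k + half))) ≡ top
  label-top = trans (prepend-+ r diagonal _ (k + half)) (trans (prepend-+ k relation _ half)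
    (trans (cong (prepend half (const idle) (const top)) (sym (+-identityʳ half))) (prepend-+ half (const idle) _ 0)))

  keeps-inner : ∀ u → u < r + (k + half) → ∀ c → T (keeps (label (suc u)) c)
  keeps-inner = prepend-elim P r diagonal _ (k + half) (λ _ _ → tt)
    (prepend-elim P k relation _ half (λ _ _ → tt)
      (λ u u< → prepend-elim P half (const idle) (const top) 0 (λ _ _ → tt) (λ _ ()) u
        (subst (u <_) (sym (+-identityʳ half)) u<)))
    where
    P : Label → Set
    P ℓ = ∀ c → T (keeps ℓ c)

  -- The two Booleans say whether the vertex may have neighbours on the
  -- level below and on the level above.
  Vertex : ℕ → Set
  Vertex n = Fin (suc m) × Bool × Bool × Vec (Fin n) d

  height : ∀ {n} → Vertex n → Fin (suc m)
  height = proj₁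

  level : ∀ {n} → Vertex n → ℕ
  level = toℕ ∘ height

  down up : ∀ {n} → Vertex n → Bool
  down = proj₁ ∘ proj₂
  up   = proj₁ ∘ proj₂ ∘ proj₂

  tuple : ∀ {n} → Vertex n → Vec (Fin n) d
  tuple = proj₂ ∘ proj₂ ∘ proj₂

  opaque
    vertices : ∀ n → List (Vertex n)
    vertices n = pairs (List.allFin (suc m)) (pairs booleans (pairs booleans (allVec n d)))

    vertices-complete : ∀ n → Complete (vertices n)
    vertices-complete n = pairs-complete ∈-allFin (pairs-complete booleans-complete
      (pairs-complete booleans-complete (allVec-complete d)))

  agree : ∀ {n} → Label → Vec (Fin n) d → Vec (Fin n) d → Bool
  agree ℓ x y = allF λ c → not (keeps ℓ c) ∨ (Vec.lookup x c == Vec.lookup y c)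

  prefix : ∀ {n} i → Vec (Fin n) d → Vec (Fin n) (arity τ i)
  prefix i x = Vec.tabulate λ j → Vec.lookup x (slot (inject≤ j (arity≤r i)))

  constraint : (S : Structure τ) → Label → Vec (Structure.V S) d → Bool
  constraint S (diagonal j) x = Vec.lookup x base == Vec.lookup x (slot j)
  constraint S (relation i) x = Structure.rel S i (prefix i x)
  constraint S _            x = true

  -- The levels are arguments of their own, so that a program can fix them by case distinction and
  -- treat everything computed from labels as constant.
  linkAt : (S : Structure τ) → Sign → Fin (suc m) → Fin (suc m) → (z z′ : Vertex (Structure.∣V∣ S)) → Bool
  linkAt S s l l′ z z′ =
    step s (toℕ l) (toℕ l′) ∧ (up z ∧ down z′) ∧ agree (label (toℕ l)) (tuple z) (tuple z′) ∧
    (not (down z ∧ up z′) ∨ constraint S (label (toℕ l)) (tuple z))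

  link adjacent : (S : Structure τ) → Sign → (z z′ : Vertex (Structure.∣V∣ S)) → Bool
  link S s z z′ = linkAt S s (height z) (height z′) z z′
  adjacent S s z z′ = link S s z z′ ∨ link S s z′ z

  adjacent-sym : ∀ S s z z′ → adjacent S s z z′ ≡ adjacent S s z′ z
  adjacent-sym S s z z′ = ∨-comm (link S s z z′) (link S s z′ z)

  signedGraph : Structure τ → SignedGraph
  signedGraph S = graphOn (vertices (Structure.∣V∣ S)) (adjacent S) (adjacent-sym S)

  record Link (S : Structure τ) (s : Sign) (z z′ : Vertex (Structure.∣V∣ S)) : Set where
    constructor mkLink
    field
      climbs : level z′ ≡ suc (level z)
      signed : s ≡ signAt Sign.+ (level z)
      upper  : T (up z)
      lower  : T (down z′)
      agrees : ∀ c → T (keeps (label (level z)) c) → Vec.lookup (tuple z) c ≡ Vec.lookup (tuple z′) c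
      holds  : T (down z) → T (up z′) → T (constraint S (label (level z)) (tuple z))

  open Link

  T-link : ∀ S s z z′ → T (link S s z z′) ⇔ Link S s z z′
  T-link S s z z′ = mk⇔
    (λ h → let st , h′ = to T-∧ h
               ud , h″ = to (T-∧ {up z ∧ down z′}) h′
               u , dn  = to T-∧ ud
               ag , ho = to (T-∧ {agree (label (level z)) (tuple z) (tuple z′)}) h″
               cl , sg = to (T-step {s} {level z}) st
           in mkLink cl sg u dn (λ c kp → to T-== (to T-implies (to (T-allF {p = λ c → not (keeps (label (level z)) c) ∨ (Vec.lookup (tuple z) c == Vec.lookup (tuple z′) c)}) ag c) kp))
                (λ dz uz′ → to T-implies ho (from T-∧ (dz , uz′))))
    (λ l → from T-∧ (from (T-step {s} {level z}) (climbs l , signed l) , from T-∧ (from T-∧ (upper l , lower l) ,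
      from T-∧ (from T-allF (λ c → from T-implies (from T-== ∘ agrees l c)) ,
        from T-implies (λ h → let dz , uz′ = to T-∧ h in holds l dz uz′)))))

  Adjacent : (S : Structure τ) → Sign → (z z′ : Vertex (Structure.∣V∣ S)) → Set
  Adjacent S s z z′ = Link S s z z′ ⊎ Link S s z′ z

  T-adjacent : ∀ S s z z′ → T (adjacent S s z z′) ⇔ Adjacent S s z z′
  T-adjacent S s z z′ = mk⇔
    (λ h → [ inj₁ ∘ to (T-link S s z z′) , inj₂ ∘ to (T-link S s z′ z) ] (to (T-∨ {link S s z z′}) h))
    (λ h → from (T-∨ {link S s z z′}) ([ inj₁ ∘ from (T-link S s z z′) , inj₂ ∘ from (T-link S s z′ z) ] h))

  Adjacent⇒PathAdj : ∀ {S s z z′} → Adjacent S s z z′ → PathAdj s (level z) (level z′)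
  Adjacent⇒PathAdj = [ (λ l → inj₁ (climbs l , signed l)) , (λ l → inj₂ (climbs l , signed l)) ]

  signedGraph→path : ∀ S → EcHomomorphism (signedGraph S) (alternatingPath Sign.+ m)
  signedGraph→path S = (λ x → height (List.lookup D x)) , λ s x y e →
    from (T-∨ {step s (level (List.lookup D x)) (level (List.lookup D y))})
      ([ (λ l → inj₁ (from (T-step {s}) (climbs l , signed l)))
       , (λ l → inj₂ (from (T-step {s}) (climbs l , signed l))) ] (to (T-adjacent S s (List.lookup D x) (List.lookup D y)) e))
    where
    D : List (Vertex (Structure.∣V∣ S))
    D = vertices (Structure.∣V∣ S)

  signedGraph-bipartite : ∀ S → Bipartite (signedGraph S)
  signedGraph-bipartite S = (λ x → side (level (List.lookup D x))) , λ s x y e eq →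
    [ (λ l → flips (level (List.lookup D x)) (trans (cong side (sym (climbs l))) (sym eq)))
    , (λ l → flips (level (List.lookup D y)) (trans (cong side (sym (climbs l))) eq)) ] (to (T-adjacent S s (List.lookup D x) (List.lookup D y)) e)
    where
    D : List (Vertex (Structure.∣V∣ S))
    D = vertices (Structure.∣V∣ S)
    side : ℕ → Bool
    side zero    = true
    side (suc n) = not (side n)
    flips : ∀ n → not (side n) ≢ side n
    flips n with side n
    ... | true  = λ ()
    ... | false = λ ()

  constraint-map : ∀ {S A} ((f , _) : Homomorphism S A) ℓ x → T (constraint S ℓ x) → T (constraint A ℓ (Vec.map f x))
  constraint-map (f , hom) bottom       x _ = tt
  constraint-map (f , hom) top          x _ = tt
  constraint-map (f , hom) idle         x _ = tt
  constraint-map (f , hom) (diagonal j) x h = from T-==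
    (trans (lookup-map base f x) (trans (cong f (to T-== h)) (sym (lookup-map (slot j) f x))))
  constraint-map {A = A} (f , hom) (relation i) x h = subst (T ∘ Structure.rel A i)
    (trans (sym (tabulate-∘ f _)) (tabulate-cong (λ j → sym (lookup-map (slot (inject≤ j (arity≤r i))) f x)))) (hom i _ h)

  EcHom-signedGraph : ∀ S A → EcHomomorphism (signedGraph S) (signedGraph A) ⇔
    Σ (Vertex (Structure.∣V∣ S) → Vertex (Structure.∣V∣ A)) λ Φ → ∀ {s z z′} → Adjacent S s z z′ → Adjacent A s (Φ z) (Φ z′)
  EcHom-signedGraph S A = mk⇔
    (λ φ → let Φ , hom = to equiv φ in Φ , λ {s} {z} {z′} a →
      to (T-adjacent A s (Φ z) (Φ z′)) (hom s z z′ (from (T-adjacent S s z z′) a)))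
    (λ (Φ , hom) → from equiv (Φ , λ s z z′ e →
      from (T-adjacent A s (Φ z) (Φ z′)) (hom (to (T-adjacent S s z z′) e))))
    where
    equiv : EcHomomorphism (signedGraph S) (signedGraph A) ⇔
      Σ (Vertex (Structure.∣V∣ S) → Vertex (Structure.∣V∣ A)) λ Φ → ∀ s z z′ → T (adjacent S s z z′) → T (adjacent A s (Φ z) (Φ z′))
    equiv = EcHom-graphOn {E = adjacent S} {adjacent-sym S} {adjacent A} {adjacent-sym A}
      (vertices-complete (Structure.∣V∣ S)) (vertices-complete (Structure.∣V∣ A))

  signedGraph-map : ∀ {S A} → Homomorphism S A → EcHomomorphism (signedGraph S) (signedGraph A)
  signedGraph-map {S} {A} f = from (EcHom-signedGraph S A) (Φ , [ inj₁ ∘ maps , inj₂ ∘ maps ])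
    where
    Φ : Vertex (Structure.∣V∣ S) → Vertex (Structure.∣V∣ A)
    Φ (l , dn , u , x) = l , dn , u , Vec.map (proj₁ f) x
    maps : ∀ {s z z′} → Link S s z z′ → Link A s (Φ z) (Φ z′)
    maps {z = z} {z′} l = mkLink (climbs l) (signed l) (upper l) (lower l)
      (λ c kp → trans (lookup-map c (proj₁ f) (tuple z))
        (trans (cong (proj₁ f) (agrees l c kp)) (sym (lookup-map c (proj₁ f) (tuple z′)))))
      (λ dz uz′ → constraint-map f (label (level z)) (tuple z) (holds l dz uz′))

  tie : Label → Fin d → Fin d → Bool
  tie (diagonal j) base     (slot j′) = j == j′
  tie (diagonal j) (slot j′) base     = j == j′
  tie _            _        _         = false

  -- Says when an edge of sign `s` between vertices placed on `l` and `l′` identifies their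
  -- coordinates `c`. For ★ this is just adjacency of the levels.
  joins : Sign → Fin (suc m) → Fin (suc m) → Fin d → Bool
  joins s l l′ c = (step s (toℕ l) (toℕ l′) ∧ keeps (label (toℕ l)) c) ∨ (step s (toℕ l′) (toℕ l) ∧ keeps (label (toℕ l′)) c)

  Joins : Sign → Fin (suc m) → Fin (suc m) → Fin d → Set
  Joins s l l′ c = (PathStep l l′ × T (keeps (label (toℕ l)) c)) ⊎ (PathStep l′ l × T (keeps (label (toℕ l′)) c))
    where
    PathStep : Fin (suc m) → Fin (suc m) → Set
    PathStep l l′ = toℕ l′ ≡ suc (toℕ l) × s ≡ signAt Sign.+ (toℕ l)

  T-joins : ∀ {s l l′ c} → T (joins s l l′ c) ⇔ Joins s l l′ c
  T-joins {s} {l} {l′} {c} = mk⇔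
    (λ h → [ (λ h → let st , kp = to T-∧ h in inj₁ (to (T-step {s} {toℕ l}) st , kp))
           , (λ h → let st , kp = to T-∧ h in inj₂ (to (T-step {s} {toℕ l′}) st , kp)) ]
           (to (T-∨ {step s (toℕ l) (toℕ l′) ∧ keeps (label (toℕ l)) c}) h))
    (λ h → from (T-∨ {step s (toℕ l) (toℕ l′) ∧ keeps (label (toℕ l)) c})
      ([ (λ (st , kp) → inj₁ (from T-∧ (from (T-step {s} {toℕ l}) st , kp)))
       , (λ (st , kp) → inj₂ (from T-∧ (from (T-step {s} {toℕ l′}) st , kp))) ] h))

  tie-sym : ∀ ℓ {c c′} → T (tie ℓ c c′) → T (tie ℓ c′ c)
  tie-sym (diagonal j) {base}   {slot _} t = t
  tie-sym (diagonal j) {slot _} {base}   t = t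

  isRelation : Label → Fin k → Bool
  isRelation (relation i′) i = i == i′
  isRelation _             i = false

  T-isRelation : ∀ {ℓ i} → T (isRelation ℓ i) ⇔ ℓ ≡ relation i
  T-isRelation {relation i′} {i} = mk⇔ (λ h → cong relation (sym (to (T-== {i = i}) h))) (λ { refl → from (T-== {i = i}) refl })
  T-isRelation {bottom}     = mk⇔ (λ ()) (λ ())
  T-isRelation {top}        = mk⇔ (λ ()) (λ ())
  T-isRelation {idle}       = mk⇔ (λ ()) (λ ())
  T-isRelation {diagonal _} = mk⇔ (λ ()) (λ ())

  keeps-★ : ∀ ℓ → T (keeps ℓ ★)
  keeps-★ bottom       = tt
  keeps-★ top          = tt
  keeps-★ idle         = tt
  keeps-★ (diagonal _) = tt
  keeps-★ (relation _) = tt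

  tie-sound : ∀ (A : Structure τ) ℓ {c c′} x → T (tie ℓ c c′) → T (constraint A ℓ x) → Vec.lookup x c ≡ Vec.lookup x c′
  tie-sound A (diagonal j) {base}   {slot j′} x t h with refl ← to (T-== {i = j} {j′}) t = to T-== h
  tie-sound A (diagonal j) {slot j′} {base}   x t h with refl ← to (T-== {i = j} {j′}) t = sym (to T-== h)

  -- Recovering a homomorphism from a map of signed graphs

  module Reflect {S A : Structure τ} (o : Structure.V S)
    (Φ : Vertex (Structure.∣V∣ S) → Vertex (Structure.∣V∣ A))
    (Φ-adj : ∀ {s z z′} → Adjacent S s z z′ → Adjacent A s (Φ z) (Φ z′)) where

    V : Set
    V = Structure.V S

    at : (l : ℕ) → .(l ≤ m) → Bool → Bool → Vec V d → Vertex (Structure.∣V∣ S)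
    at l l≤m dn u x = fromℕ< (s≤s l≤m) , dn , u , x

    level-at : ∀ l .(p : l ≤ m) {dn u x} → level (at l p dn u x) ≡ l
    level-at l p = Fin.toℕ-fromℕ< (s≤s p)

    AgreeAt : ∀ {n} → ℕ → Vec (Fin n) d → Vec (Fin n) d → Set
    AgreeAt l x y = ∀ c → T (keeps (label l) c) → Vec.lookup x c ≡ Vec.lookup y c

    at-link : ∀ {l} .(p : suc l ≤ m) {dn u x x′} → AgreeAt l x x′ →
      (T dn → T u → T (constraint S (label l) x)) →
      Link S (signAt Sign.+ l) (at l (<⇒≤ p) dn true x) (at (suc l) p true u x′)
    at-link {l} p {dn} {u} {x} ag ho = mkLink
      (trans (level-at (suc l) p {true} {u} {x}) (cong suc (sym l≡)))
      (cong (signAt Sign.+) (sym l≡)) tt tt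
      (λ c kp → ag c (subst (λ n → T (keeps (label n) c)) l≡ kp))
      (λ dz uz → subst (λ n → T (constraint S (label n) x)) (sym l≡) (ho dz uz))
      where
      l≡ = level-at l (<⇒≤ p) {dn} {true} {x}

    -- With both Booleans true, the straight edges between core vertices are exactly those that
    -- carry constraints; zigzags connect them in any case.
    core : (l : ℕ) → .(l ≤ m) → Vec V d → Vertex (Structure.∣V∣ S)
    core l p = at l p true true

    -- A detour between consecutive levels on which no constraint is
    -- imposed, as no edge joins two vertices with both Booleans true.
    module Zigzag {l} .(p : suc l ≤ m) {x x′ : Vec V d} (ag : AgreeAt l x x′) where
      first : Link S (signAt Sign.+ l) (core l (<⇒≤ p) x) (at (suc l) p true false x)
      first = at-link p (λ _ _ → refl) (λ _ ())
      second : Link S (signAt Sign.+ l) (at l (<⇒≤ p) false true x) (at (suc l) p true false x)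
      second = at-link p (λ _ _ → refl) (λ ())
      third : Link S (signAt Sign.+ l) (at l (<⇒≤ p) false true x) (core (suc l) p x′)
      third = at-link p ag (λ ())

    walk : ∀ {s z z′} → Link S s z z′ → PathAdj s (level (Φ z)) (level (Φ z′))
    walk l = Adjacent⇒PathAdj (Φ-adj (inj₁ l))

    -- The first two edges of a zigzag have the same sign and a common upper end, so the images of
    -- their lower ends share a level. The third edge then makes the levels of the images of the
    -- cores a walk with one step per sign, and `walk-rigid` applies.
    starts : ∀ x → level (Φ (core 0 z≤n x)) ≡ 0
    starts x = walk-rigid m m-even (λ l p → level (Φ (core l p x))) (λ l p → Fin.toℕ≤pred[n] (height (Φ (core l p x)))) zigzag
      where
      zigzag : ∀ l .(p : suc l ≤ m) → PathAdj (signAt Sign.+ l) (level (Φ (core l (<⇒≤ p) x))) (level (Φ (core (suc l) p x)))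
      zigzag l p = subst (λ i → PathAdj (signAt Sign.+ l) i (level (Φ (core (suc l) p x))))
        (PathAdj-unique (PathAdj-sym (walk second)) (PathAdj-sym (walk first))) (walk third)
        where open Zigzag p {x} {x} (λ _ _ → refl)

    preserves-up : ∀ {s z z′} → Link S s z z′ → level (Φ z) ≡ level z → level (Φ z′) ≡ level z′
    preserves-up {s} {z} {z′} l eq = PathAdj-unique (walk l) (subst (λ i → PathAdj s i (level z′)) (sym eq) (inj₁ (climbs l , signed l)))

    preserves-down : ∀ {s z z′} → Link S s z z′ → level (Φ z′) ≡ level z′ → level (Φ z) ≡ level z
    preserves-down {s} {z} {z′} l eq = PathAdj-unique (PathAdj-sym (walk l))
      (subst (λ i → PathAdj s i (level z)) (sym eq) (inj₂ (climbs l , signed l)))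

    image : ∀ {s z z′} → Link S s z z′ → level (Φ z) ≡ level z → Link A s (Φ z) (Φ z′)
    image l eq with Φ-adj (inj₁ l)
    ... | inj₁ l′ = l′
    ... | inj₂ l′ = ⊥-elim (m≢1+n+m _ {1} (trans (sym eq) (trans (climbs l′)
                      (cong suc (trans (preserves-up l eq) (climbs l))))))

    preserves : ∀ l .(p : l ≤ m) x → level (Φ (core l p x)) ≡ l
    preserves zero    p x = starts x
    preserves (suc l) p x = trans
      (preserves-up third (preserves-down second (preserves-up first
        (trans (preserves l (<⇒≤ p) x) (sym (level-at l (<⇒≤ p) {true} {true} {x}))))))
      (level-at (suc l) p {true} {true} {x})
      where open Zigzag p {x} {x} (λ _ _ → refl)

    F : (l : ℕ) → .(l ≤ m) → Vec V d → Vec (Structure.V A) d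
    F l p x = tuple (Φ (core l p x))

    module Image {l} .(p : suc l ≤ m) {x x′ : Vec V d} (ag : AgreeAt l x x′) where
      open Zigzag p {x} {x′} ag

      core-level : level (Φ (core l (<⇒≤ p) x)) ≡ level (core l (<⇒≤ p) x)
      core-level = trans (preserves l (<⇒≤ p) x) (sym (level-at l (<⇒≤ p) {true} {true} {x}))

      turn-level : level (Φ (at l (<⇒≤ p) false true x)) ≡ level (at l (<⇒≤ p) false true x)
      turn-level = preserves-down second (preserves-up first core-level)

      first′ = image first core-level
      second′ = image second turn-level
      third′ = image third turn-level

      -- All three edges of the zigzag have their images between levels `l` and `suc l`, and each of
      -- these images keeps coordinate `c`.
      F-agrees : AgreeAt l (F l (<⇒≤ p) x) (F (suc l) p x′)
      F-agrees c kp = trans (agrees first′ c (there-label {true} core-level kp))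
        (trans (sym (agrees second′ c (there-label {false} turn-level kp))) (agrees third′ c (there-label {false} turn-level kp)))
        where
        there-label : ∀ {u n} → n ≡ level (at l (<⇒≤ p) u true x) → T (keeps (label l) c) → T (keeps (label n) c)
        there-label {u} eq = subst (λ n → T (keeps (label n) c)) (trans (sym (level-at l (<⇒≤ p) {u} {true} {x})) (sym eq))

    inner : ℕ
    inner = r + (k + half)

    -- The choice of level 1 is immaterial: by `F-inner` the image tuple is the same on all levels
    -- strictly between 0 and `m`.
    G : Vec V d → Vec (Structure.V A) d
    G = F 1 (s≤s z≤n)

    F-inner : ∀ u .(p : suc u ≤ m) → u ≤ inner → ∀ x c → Vec.lookup (F (suc u) p x) c ≡ Vec.lookup (G x) c
    F-inner zero    p u≤ x c = refl
    F-inner (suc u) p u< x c = trans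
      (sym (Image.F-agrees {suc u} p {x} {x} (λ _ _ → refl) c (keeps-inner u u< c)))
      (F-inner u (<⇒≤ p) (<⇒≤ u<) x c)

    -- On level 1 both tuples end a zigzag that starts from `x` on level 0, and the image of `x`
    -- there fixes the base coordinate of both.
    G-base : ∀ {x x′} → AgreeAt 0 x x′ → Vec.lookup (G x) base ≡ Vec.lookup (G x′) base
    G-base {x} {x′} ag = trans (sym (Image.F-agrees (s≤s z≤n) {x} {x} (λ _ _ → refl) base tt))
                               (Image.F-agrees (s≤s z≤n) {x} {x′} ag base tt)

    -- The mirror image of `G-base`: on the level below the top both tuples start a zigzag to `x′`
    -- on level `m`.
    G-slot : ∀ {x x′} → AgreeAt (suc inner) x x′ → ∀ j → Vec.lookup (G x) (slot j) ≡ Vec.lookup (G x′) (slot j)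
    G-slot {x} {x′} ag j = trans (sym (F-inner inner (n≤1+n _) ≤-refl x (slot j)))
      (trans (Image.F-agrees ≤-refl {x} {x′} ag (slot j) kept)
      (trans (sym (Image.F-agrees ≤-refl {x′} {x′} (λ _ _ → refl) (slot j) kept))
        (F-inner inner (n≤1+n _) ≤-refl x′ (slot j))))
      where
      kept : T (keeps (label (suc inner)) (slot j))
      kept = subst (λ ℓ → T (keeps ℓ (slot j))) (sym label-top) tt

    -- As the constraint holds in `S`, the straight edge between the two cores exists. Its image
    -- must satisfy the constraint in `A` because it cannot be exempt: a zigzag from the level below
    -- makes `down` true at its lower end, and a zigzag to the level above makes `up` true at its
    -- upper end.
    G-constraint : ∀ u → u < inner → ∀ x → T (constraint S (label (suc u)) x) → T (constraint A (label (suc u)) (G x))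
    G-constraint u u< x h = subst (T ∘ constraint A (label (suc u)))
      (lookup-ext (F-inner u u≤m (<⇒≤ u<) x))
      (subst (λ n → T (constraint A (label n) (F (suc u) u≤m x))) (preserves (suc u) u≤m x)
        (holds (image (at-link {suc u} u<m {true} {true} {x} {x} (λ _ _ → refl) (λ _ _ → h)) (Image.core-level u<m {x} {x} (λ _ _ → refl)))
          (lower (Image.third′ {u} u≤m {x} {x} (λ _ _ → refl)))
          (upper (Image.first′ {suc (suc u)} u<<m {x} {x} (λ _ _ → refl)))))
      where
      u≤m : suc u ≤ m
      u≤m = ≤-trans u< (≤-trans (n≤1+n _) (n≤1+n _))
      u<m : suc (suc u) ≤ m
      u<m = s≤s (≤-trans u< (n≤1+n _))
      u<<m : suc (suc (suc u)) ≤ m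
      u<<m = s≤s (s≤s u<)

    g : V → Structure.V A
    g y = Vec.lookup (G (o ∷ y ∷ Vec.replicate r o)) base

    -- Replace the base by entry `j`, which leaves the slots of the image alone. Now diagonal `j`
    -- holds in `S`, so in the image slot `j` equals the base, which `G-base` identifies as `g` of
    -- the entry.
    G-tuple : ∀ y t j → Vec.lookup (G (o ∷ y ∷ t)) (slot j) ≡ g (Vec.lookup t j)
    G-tuple y t j = trans (G-slot {o ∷ y ∷ t} {o ∷ Vec.lookup t j ∷ t} above j) (trans
      (sym (to T-== (subst (λ ℓ → T (constraint A ℓ (G (o ∷ Vec.lookup t j ∷ t)))) (label-diagonal j)
        (G-constraint (toℕ j) (≤-trans (Fin.toℕ<n j) (m≤m+n r _)) (o ∷ Vec.lookup t j ∷ t)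
          (subst (λ ℓ → T (constraint S ℓ (o ∷ Vec.lookup t j ∷ t))) (sym (label-diagonal j)) (from (T-== {i = Vec.lookup t j}) refl))))))
      (G-base {o ∷ Vec.lookup t j ∷ t} {o ∷ Vec.lookup t j ∷ Vec.replicate r o} below))
      where
      above : AgreeAt (suc inner) (o ∷ y ∷ t) (o ∷ Vec.lookup t j ∷ t)
      above ★        _  = refl
      above base     kp = ⊥-elim (subst (λ ℓ → T (keeps ℓ base)) label-top kp)
      above (slot _) _  = refl
      below : AgreeAt 0 (o ∷ Vec.lookup t j ∷ t) (o ∷ Vec.lookup t j ∷ Vec.replicate r o)
      below ★    _ = refl
      below base _ = refl

    reflected : Homomorphism S A
    reflected = g , λ i t St → subst (T ∘ Structure.rel A i) (prefix-G i t)
      (subst (λ ℓ → T (constraint A ℓ (G (padded i t)))) (label-relation i)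
        (G-constraint (r + toℕ i) (+-monoʳ-< r (≤-trans (Fin.toℕ<n i) (m≤m+n k half))) (padded i t)
          (subst (λ ℓ → T (constraint S ℓ (padded i t))) (sym (label-relation i))
            (subst (T ∘ Structure.rel S i) (sym (prefix-padded i t)) St))))
      where
      padded : ∀ i → Vec V (arity τ i) → Vec V d
      padded i t = o ∷ o ∷ pad o (arity≤r i) t
      prefix-padded : ∀ i t → prefix i (padded i t) ≡ t
      prefix-padded i t = trans (tabulate-cong (lookup-pad o (arity≤r i) t)) (tabulate∘lookup t)
      prefix-G : ∀ i t → prefix i (G (padded i t)) ≡ Vec.map g t
      prefix-G i t = trans (tabulate-cong (λ j → trans (G-tuple o (pad o (arity≤r i) t) _) (cong g (lookup-pad o (arity≤r i) t j))))
        (trans (tabulate-∘ g (Vec.lookup t)) (cong (Vec.map g) (tabulate∘lookup t)))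

  signedGraph-reflect : ∀ {S A} → Structure.V S → EcHomomorphism (signedGraph S) (signedGraph A) → Homomorphism S A
  signedGraph-reflect {S} {A} o φ = let Φ , adj = to (EcHom-signedGraph S A) φ in Reflect.reflected {S} {A} o Φ adj

  NullaryCompatible : Structure τ → Structure τ → Set
  NullaryCompatible S A = ∀ i → T (nullary (arity τ i) (Structure.rel S i)) → T (nullary (arity τ i) (Structure.rel A i))

  -- If `S` is empty, its signed graph has no vertices and carries no information on 0-ary
  -- relations, hence the separate condition. Otherwise any element of `S` can fill ★ and the spare
  -- coordinates in `Reflect`.
  homomorphism⇔ : ∀ S A → Homomorphism S A ⇔ (NullaryCompatible S A × EcHomomorphism (signedGraph S) (signedGraph A))
  homomorphism⇔ S A = mk⇔
    (λ h → (λ i → necessary (arity τ i) (proj₂ h i)) , signedGraph-map h)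
    (λ (nc , φ) → go (Structure.∣V∣ S) refl nc φ)
    where
    necessary : ∀ a {n n′} {f : Fin n → Fin n′} {R : Vec (Fin n) a → Bool} {R′ : Vec (Fin n′) a → Bool} →
      (∀ t → T (R t) → T (R′ (Vec.map f t))) → T (nullary a R) → T (nullary a R′)
    necessary zero hom = hom []
    empty : ∀ a {n n′} {R : Vec (Fin n) a → Bool} {R′ : Vec (Fin n′) a → Bool} (¬o : ¬ Fin n) →
      (T (nullary a R) → T (nullary a R′)) → ∀ t → T (R t) → T (R′ (Vec.map (λ o → ⊥-elim (¬o o)) t))
    empty zero    ¬o hom []      = hom
    empty (suc a) ¬o hom (x ∷ t) = ⊥-elim (¬o x)
    go : ∀ n → Structure.∣V∣ S ≡ n → NullaryCompatible S A → EcHomomorphism (signedGraph S) (signedGraph A) → Homomorphism S A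
    go zero    eq nc φ = (λ o → ⊥-elim (¬o o)) , λ i → empty (arity τ i) ¬o (nc i)
      where
      ¬o : ¬ Structure.V S
      ¬o o with subst Fin eq o
      ... | ()
    go (suc n) eq nc φ = signedGraph-reflect (subst Fin (sym eq) zero) φ

anyF-== : ∀ {k} (c : Fin k) (p : Fin k → Bool) → anyF (λ i → (c == i) ∧ p i) ≡ p c
anyF-== zero    p = trans (cong (p zero ∨_) (none (p ∘ suc))) (∨-identityʳ (p zero))
  where
  none : ∀ {k} (q : Fin k → Bool) → anyF (λ i → false ∧ q i) ≡ false
  none {zero}  q = refl
  none {suc k} q = none (q ∘ suc)
anyF-== (suc c) p = anyF-== c (p ∘ suc)

-- Reachability

T-any : ∀ {A : Set} {p : A → Bool} {xs} → T (any p xs) ⇔ ∃ λ x → x ∈ xs × T (p x)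
T-any {p = p} {xs} = mk⇔ (sound xs) (λ (x , x∈ , px) → complete x∈ px)
  where
  sound : ∀ xs → T (any p xs) → ∃ λ x → x ∈ xs × T (p x)
  sound (x ∷ xs) h = [ (λ px → x , here refl , px) , (λ h → let y , y∈ , py = sound xs h in y , there y∈ , py) ]
    (to (T-∨ {p x}) h)
  complete : ∀ {x xs} → x ∈ xs → T (p x) → T (any p xs)
  complete {x}          (here refl) px = from (T-∨ {p x}) (inj₁ px)
  complete {xs = y ∷ _} (there x∈)  px = from (T-∨ {p y}) (inj₂ (complete x∈ px))

T-all : ∀ {A : Set} {p : A → Bool} {xs} → T (all p xs) ⇔ (∀ x → x ∈ xs → T (p x))
T-all {p = p} {xs} = mk⇔ (sound xs) (complete xs)
  where
  sound : ∀ xs → T (all p xs) → ∀ x → x ∈ xs → T (p x)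
  sound (y ∷ xs) h x (here refl) = proj₁ (to T-∧ h)
  sound (y ∷ xs) h x (there x∈)  = sound xs (proj₂ (to (T-∧ {p y}) h)) x x∈
  complete : ∀ xs → (∀ x → x ∈ xs → T (p x)) → T (all p xs)
  complete []       h = tt
  complete (x ∷ xs) h = from T-∧ (h x (here refl) , complete xs (λ y y∈ → h y (there y∈)))

∈-filterB : ∀ {A : Set} {p : A → Bool} {xs x} → x ∈ filterB p xs ⇔ (x ∈ xs × T (p x))
∈-filterB {p = p} {xs} = mk⇔ (sound xs) (λ (x∈ , px) → complete xs x∈ px)
  where
  sound : ∀ xs {x} → x ∈ filterB p xs → x ∈ xs × T (p x)
  sound (y ∷ xs) x∈ with p y in eq
  sound (y ∷ xs) (here refl) | true  = here refl , subst T (sym eq) tt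
  sound (y ∷ xs) (there x∈)  | true  = let x∈′ , px = sound xs x∈ in there x∈′ , px
  sound (y ∷ xs) x∈          | false = let x∈′ , px = sound xs x∈ in there x∈′ , px
  complete : ∀ xs {x} → x ∈ xs → T (p x) → x ∈ filterB p xs
  complete (y ∷ xs) (here refl) px with p y
  ... | true = here refl
  complete (y ∷ xs) (there x∈)  px with p y
  ... | true  = there (complete xs x∈ px)
  ... | false = complete xs x∈ px

length-filterB : ∀ {A : Set} (p : A → Bool) xs → length (filterB p xs) ≤ length xs
length-filterB p []       = z≤n
length-filterB p (x ∷ xs) with p x
... | true  = s≤s (length-filterB p xs)
... | false = m≤n⇒m≤1+n (length-filterB p xs)

-- Supplies the dichotomy for counting rounds: a larger filter of the same list is strictly longer
-- unless it adds no member.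
filterB-grows : ∀ {A : Set} (p q : A → Bool) xs → (∀ x → T (p x) → T (q x)) →
  length (filterB p xs) < length (filterB q xs) ⊎ (∀ x → x ∈ xs → T (q x) → T (p x))
filterB-grows p q []       p⇒q = inj₂ λ _ ()
filterB-grows p q (x ∷ xs) p⇒q with filterB-grows p q xs p⇒q | p x in px | q x in qx
... | ih      | true  | false = ⊥-elim (subst T qx (p⇒q x (subst T (sym px) tt)))
... | inj₁ lt | true  | true  = inj₁ (s≤s lt)
... | inj₁ lt | false | true  = inj₁ (m<n⇒m<1+n lt)
... | inj₁ lt | false | false = inj₁ lt
... | inj₂ ⊇  | true  | true  = inj₂ λ { _ (here refl) _ → subst T (sym px) tt ; y (there y∈) → ⊇ y y∈ }
... | inj₂ ⊇  | false | false = inj₂ λ { _ (here refl) q → ⊥-elim (subst T qx q) ; y (there y∈) → ⊇ y y∈ }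
... | inj₂ ⊇  | false | true  = inj₁ (s≤s (monotone xs))
  where
  monotone : ∀ ys → length (filterB p ys) ≤ length (filterB q ys)
  monotone []       = z≤n
  monotone (y ∷ ys) with p y in py | q y in qy
  ... | true  | true  = s≤s (monotone ys)
  ... | true  | false = ⊥-elim (subst T qy (p⇒q y (subst T (sym py) tt)))
  ... | false | true  = m≤n⇒m≤1+n (monotone ys)
  ... | false | false = monotone ys

module Reachability {A : Set} {D : List A} {B : A → A → Bool} (∈D : Complete D) (B-refl : ∀ a → T (B a a)) where

  private
    module _ (a : A) where

      R : ℕ → List A
      R = iter D B a

      ∈-R : ∀ k {y} → y ∈ R (suc k) ⇔ ∃ λ x → x ∈ R k × T (B x y)
      ∈-R k {y} = mk⇔ (to T-any ∘ proj₂ ∘ to (∈-filterB {xs = D})) (λ h → from ∈-filterB (∈D y , from T-any h))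

      R-mono : ∀ k {y} → y ∈ R k → y ∈ R (suc k)
      R-mono k {y} y∈ = from (∈-R k) (y , y∈ , B-refl y)

      Stable : ℕ → Set
      Stable k = ∀ {y} → y ∈ R (suc k) → y ∈ R k

      Stable-suc : ∀ k → Stable k → Stable (suc k)
      Stable-suc k st y∈ = let x , x∈ , b = to (∈-R (suc k)) y∈ in from (∈-R k) (x , st x∈ , b)

      -- Every round that is not stable adds a member, while iterates are no longer than `D`.
      -- Counting starts with round 1, as the singleton of round 0 is not obtained by filtering `D`.
      large-or-stable : ∀ k → suc k ≤ length (R (suc k)) ⊎ Stable (suc k)
      large-or-stable zero = inj₁ (nonempty (R-mono 0 (here refl)))
        where
        nonempty : ∀ {x : A} {xs} → x ∈ xs → 1 ≤ length xs
        nonempty (here _)  = s≤s z≤n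
        nonempty (there _) = s≤s z≤n
      large-or-stable (suc k) with large-or-stable k
      ... | inj₂ st = inj₂ (Stable-suc (suc k) st)
      ... | inj₁ k≤ with filterB-grows (λ y → any (λ x → B x y) (R k)) (λ y → any (λ x → B x y) (R (suc k))) D
                           (λ y h → let x , x∈ , b = to (T-any {xs = R k}) h in from T-any (x , R-mono k x∈ , b))
      ...   | inj₁ lt = inj₁ (≤-trans (s≤s k≤) lt)
      ...   | inj₂ ⊇  = inj₂ (Stable-suc (suc k) (λ {y} y∈ →
                from ∈-filterB (∈D y , ⊇ y (∈D y) (proj₂ (to (∈-filterB {xs = D}) y∈)))))

      stable : Stable (suc (length D))
      stable with large-or-stable (length D)
      ... | inj₁ N< = ⊥-elim (<-irrefl refl (≤-trans N< (length-filterB _ D)))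
      ... | inj₂ st = st

      -- The closing `any` of `reach` amounts to one more round, so membership is tested at the
      -- round for which `stable` is proved.
      reach⇔∈ : ∀ {z} → T (reach D B a z) ⇔ z ∈ R (suc (length D))
      reach⇔∈ = mk⇔ (from (∈-R (length D)) ∘ to T-any) (from T-any ∘ to (∈-R (length D)))

  Reach : A → A → Set
  Reach a z = T (reach D B a z)

  Reach-refl : ∀ a → Reach a a
  Reach-refl a = from (reach⇔∈ a) (start (suc (length D)))
    where
    start : ∀ k → a ∈ R a k
    start zero    = here refl
    start (suc k) = R-mono a k (start k)

  Reach-step : ∀ {a y z} → Reach a y → T (B y z) → Reach a z
  Reach-step {a} a⇝y b = from (reach⇔∈ a) (stable a (from (∈-R a (suc (length D))) (_ , to (reach⇔∈ a) a⇝y , b)))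

  Reach-elim : ∀ {a} (P : A → Set) → P a → (∀ {y z} → P y → T (B y z) → P z) → ∀ {z} → Reach a z → P z
  Reach-elim {a} P Pa Pstep a⇝z = go (suc (length D)) (to (reach⇔∈ a) a⇝z)
    where
    go : ∀ k {z} → z ∈ R a k → P z
    go zero    (here refl) = Pa
    go (suc k) z∈ = let x , x∈ , b = to (∈-R a k) z∈ in Pstep (go k x∈) b

  Reach-trans : ∀ {a y z} → Reach a y → Reach y z → Reach a z
  Reach-trans {a} a⇝y = Reach-elim (Reach a) a⇝y Reach-step

  module _ (B-sym : ∀ {y z} → T (B y z) → T (B z y)) where

    Reach-sym : ∀ {a z} → Reach a z → Reach z a
    Reach-sym {a} = Reach-elim (λ z → Reach z a) (Reach-refl a)
      (λ y⇝a b → Reach-trans (Reach-step (Reach-refl _) (B-sym b)) y⇝a)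

-- The least index satisfying p, provided that p i holds; otherwise junk.
first : ∀ {k} → Fin k → (Fin k → Bool) → Fin k
first zero    p = zero
first (suc i) p = Bool.if p zero then zero else suc (first i (p ∘ suc))

first-satisfies : ∀ {k} (i : Fin k) (p : Fin k → Bool) → T (p i) → T (p (first i p))
first-satisfies zero    p pi = pi
first-satisfies (suc i) p pi with p zero in eq
... | true  = subst T (sym eq) tt
... | false = first-satisfies i (p ∘ suc) pi

-- The least solution depends on the predicate alone; `i` and `j` only bound the search. So `first`
-- picks canonical representatives of components and of equivalence classes.
first-cong : ∀ {k} (i j : Fin k) (p q : Fin k → Bool) → (∀ x → T (p x) ⇔ T (q x)) → T (p i) → T (q j) → first i p ≡ first j q
first-cong zero    zero    p q p⇔q pi qj = refl
first-cong zero    (suc j) p q p⇔q pi qj with q zero | to (p⇔q zero) pi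
... | true | _ = refl
first-cong (suc i) zero    p q p⇔q pi qj with p zero | from (p⇔q zero) qj
... | true | _ = refl
first-cong (suc i) (suc j) p q p⇔q pi qj with p zero | q zero | p⇔q zero
... | true  | true  | _  = refl
... | true  | false | eq = ⊥-elim (to eq tt)
... | false | true  | eq = ⊥-elim (from eq tt)
... | false | false | _  = cong suc (first-cong i j (p ∘ suc) (q ∘ suc) (p⇔q ∘ suc) pi qj)

-- Signed graphs as instances of CSP

EcHom-toGraphOn : ∀ {B : Set} {G : SignedGraph} {D : List B} {E : Sign → B → B → Bool} {E-sym : ∀ s x y → E s x y ≡ E s y x} →
  Complete D →
  EcHomomorphism G (graphOn D E E-sym) ⇔
  Σ (SignedGraph.V G → B) λ Φ → ∀ s x y → T (SignedGraph.edge G s x y) → T (E s (Φ x) (Φ y))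
EcHom-toGraphOn {D = D} {E} ∈D = mk⇔
  (λ (φ , hom) → (λ a → List.lookup D (φ a)) , hom)
  (λ (Φ , hom) → (λ i → Any.index (∈D (Φ i))) , λ s i j e →
    subst₂ (λ u v → T (E s u v)) (sym (lookup-index (∈D _))) (sym (lookup-index (∈D _))) (hom s _ _ e))

T-anyFin : ∀ {n} {p : Fin n → Bool} → T (any p (List.allFin n)) ⇔ ∃ (T ∘ p)
T-anyFin {n} = mk⇔ (λ h → let i , _ , q = to (T-any {xs = List.allFin n}) h in i , q)
                   (λ (i , q) → from (T-any {xs = List.allFin n}) (i , ∈-allFin i , q))

T-allFin : ∀ {n} {p : Fin n → Bool} → T (all p (List.allFin n)) ⇔ (∀ i → T (p i))
T-allFin {n} = mk⇔ (λ h i → to (T-all {xs = List.allFin n}) h i (∈-allFin i))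
                   (λ h → from (T-all {xs = List.allFin n}) (λ i _ → h i))

module Interpretation {τ : Vocabulary} (G : SignedGraph) where
  open Construction τ
  open SignedGraph G

  -- (w , l , c) stands for coordinate c of the tuple of w when w is placed
  -- on level l.
  Node : Set
  Node = V × Fin (suc m) × Fin d

  opaque
    nodes : List Node
    nodes = pairs (List.allFin ∣V∣) (pairs (List.allFin (suc m)) (List.allFin d))

    nodes-complete : Complete nodes
    nodes-complete = pairs-complete ∈-allFin (pairs-complete ∈-allFin ∈-allFin)

  -- On a path, the sign of an edge at a vertex of level l tells whether it
  -- leads up or down.  full l w says that some edge from w up to level
  -- suc l must carry the constraint of label l.
  hasUp hasDown full : ℕ → V → Bool
  hasUp   l w = any (λ w′ → edge (signAt Sign.+ l) w w′) (List.allFin ∣V∣)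
  hasDown l w = any (λ w′ → edge (opposite (signAt Sign.+ l)) w w′) (List.allFin ∣V∣)
  full    l w = hasDown l w ∧ any (λ w′ → edge (signAt Sign.+ l) w w′ ∧ hasUp (suc l) w′) (List.allFin ∣V∣)

  linkedAt : (l l′ : Fin (suc m)) (c c′ : Fin d) → V → V → Bool
  linkedAt l l′ c c′ w w′ =
    ((l == l′) ∧ (w == w′) ∧ ((c == c′) ∨ (tie (label (toℕ l)) c c′ ∧ full (toℕ l) w))) ∨
    ((c == c′) ∧ ((joins Sign.+ l l′ c ∧ edge Sign.+ w w′) ∨ (joins Sign.- l l′ c ∧ edge Sign.- w w′)))

  linked : Node → Node → Bool
  linked (w , l , c) (w′ , l′ , c′) = linkedAt l l′ c c′ w w′

  -- The equalities between values of nodes that any map with these placements must respect, namely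
  -- those forced by diagonal constraints and by coordinates kept along edges.
  data Linked : Node → Node → Set where
    stay  : ∀ {w l c} → Linked (w , l , c) (w , l , c)
    tied  : ∀ {w l c c′} → T (tie (label (toℕ l)) c c′) → T (full (toℕ l) w) → Linked (w , l , c) (w , l , c′)
    moves : ∀ {w w′ l l′ c} s → Joins s l l′ c → T (edge s w w′) → Linked (w , l , c) (w′ , l′ , c)

  T-linked : ∀ z z′ → T (linked z z′) ⇔ Linked z z′
  T-linked (w , l , c) (w′ , l′ , c′) = mk⇔ sound complete
    where
    local moving : Bool
    local = (l == l′) ∧ (w == w′) ∧ ((c == c′) ∨ (tie (label (toℕ l)) c c′ ∧ full (toℕ l) w))
    moving = (c == c′) ∧ ((joins Sign.+ l l′ c ∧ edge Sign.+ w w′) ∨ (joins Sign.- l l′ c ∧ edge Sign.- w w′))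
    here-linked : l ≡ l′ → w ≡ w′ → T (c == c′) ⊎ T (tie (label (toℕ l)) c c′ ∧ full (toℕ l) w) →
      Linked (w , l , c) (w′ , l′ , c′)
    here-linked refl refl (inj₁ c≡) with refl ← to (T-== {i = c}) c≡ = stay
    here-linked refl refl (inj₂ h) = let t , f = to T-∧ h in tied t f
    moving-linked : ∀ s → c ≡ c′ → T (joins s l l′ c ∧ edge s w w′) → Linked (w , l , c) (w′ , l′ , c′)
    moving-linked s refl h = let j , e = to T-∧ h in moves s (to (T-joins {s} {l} {l′} {c}) j) e
    sound : T (local ∨ moving) → Linked (w , l , c) (w′ , l′ , c′)
    sound h = [ (λ h → let l≡ , h₁ = to (T-∧ {l == l′}) h
                           w≡ , h₂ = to (T-∧ {w == w′}) h₁
                       in here-linked (to T-== l≡) (to T-== w≡) (to (T-∨ {c == c′}) h₂))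
              , (λ h → let c≡ , h₁ = to (T-∧ {c == c′}) h in
                  [ moving-linked Sign.+ (to T-== c≡) , moving-linked Sign.- (to T-== c≡) ]
                    (to (T-∨ {joins Sign.+ l l′ c ∧ edge Sign.+ w w′}) h₁)) ]
              (to (T-∨ {local}) h)
    complete : Linked (w , l , c) (w′ , l′ , c′) → T (local ∨ moving)
    complete stay = from (T-∨ {local}) (inj₁ (from T-∧ (from (T-== {i = l}) refl , from T-∧ (from (T-== {i = w}) refl ,
      from T-∨ (inj₁ (from (T-== {i = c}) refl))))))
    complete (tied t f) = from (T-∨ {local}) (inj₁ (from T-∧ (from (T-== {i = l}) refl , from T-∧ (from (T-== {i = w}) refl ,
      from (T-∨ {c == c′}) (inj₂ (from T-∧ (t , f)))))))
    complete (moves Sign.+ j e) = from (T-∨ {local}) (inj₂ (from T-∧ (from (T-== {i = c}) refl ,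
      from T-∨ (inj₁ (from T-∧ (from (T-joins {Sign.+} {l} {l′} {c}) j , e))))))
    complete (moves Sign.- j e) = from (T-∨ {local}) (inj₂ (from T-∧ (from (T-== {i = c}) refl ,
      from (T-∨ {joins Sign.+ l l′ c ∧ edge Sign.+ w w′}) (inj₂ (from T-∧ (from (T-joins {Sign.-} {l} {l′} {c}) j , e))))))

  edge-swap : ∀ {s w w′} → T (edge s w w′) → T (edge s w′ w)
  edge-swap {s} {w} {w′} = subst T (edge-sym s w w′)

  Linked-sym : ∀ {z z′} → Linked z z′ → Linked z′ z
  Linked-sym stay          = stay
  Linked-sym (tied {l = l} t f) = tied (tie-sym (label (toℕ l)) t) f
  Linked-sym (moves s j e) = moves s ([ inj₂ , inj₁ ] j) (edge-swap e)

  open Reachability {D = nodes} {linked} nodes-complete (λ z → from (T-linked z z) stay) public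

  reaches : Node → Node → Bool
  reaches = reach nodes linked

  Reach-link : ∀ {a y z} → Reach a y → Linked y z → Reach a z
  Reach-link a⇝y l = Reach-step a⇝y (from (T-linked _ _) l)

  Reach-flip : ∀ {a z} → Reach a z → Reach z a
  Reach-flip = Reach-sym (λ {y} {z} b → from (T-linked z y) (Linked-sym (to (T-linked y z) b)))

  tupleAt : V → Fin (suc m) → ∀ i → (Fin (arity τ i) → Node)
  tupleAt w l i j = w , l , slot (inject≤ j (arity≤r i))

  -- The saturation: `t` may be any tuple whose entries are reached from the slots of `w`, so the
  -- relation is imposed on all representatives at once. Reaching `(w , l , ★)` restricts the
  -- instance to placements connected with `z`.
  imposed : Node → ∀ i → Vec Node (arity τ i) → V → Fin (suc m) → Bool
  imposed z i t w l = isRelation (label (toℕ l)) i ∧ full (toℕ l) w ∧ reaches z (w , l , ★) ∧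
    allF (λ j → reaches (tupleAt w l i j) (Vec.lookup t j))

  constraintsOf : Node → ∀ i → Vec Node (arity τ i) → Bool
  constraintsOf z i t = any (λ w → anyF (imposed z i t w)) (List.allFin ∣V∣)

  instanceAt : Node → Structure τ
  instanceAt z = structureOn nodes (constraintsOf z)

  -- Can fail only on the two end levels, when an edge at `w` has the sign that would lead off the
  -- path.
  alive : Fin (suc m) → V → Bool
  alive l w = all (λ w′ → aliveTo Sign.+ w′ ∧ aliveTo Sign.- w′) (List.allFin ∣V∣)
    where
    aliveTo : Sign → V → Bool
    aliveTo s w′ = not (edge s w w′) ∨ anyF (λ l′ → joins s l l′ ★)

  goodAt : Node → Fin (suc m) → V → Bool
  goodAt z l w = not (reaches z (w , l , ★)) ∨ (alive l w ∧ allF (λ l′ → not (reaches z (w , l′ , ★)) ∨ (l == l′)))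

  good : Node → Bool
  good z = all (λ w → allF (λ l → goodAt z l w)) (List.allFin ∣V∣)

  Alive : Fin (suc m) → V → Set
  Alive l w = ∀ s w′ → T (edge s w w′) → ∃ λ l′ → Joins s l l′ ★

  T-alive : ∀ {l w} → T (alive l w) ⇔ Alive l w
  T-alive {l} {w} = mk⇔
    (λ { h Sign.+ w′ e → convert (to T-anyF (to T-implies (proj₁ (to T-∧ (to T-allFin h w′))) e))
       ; h Sign.- w′ e → convert (to T-anyF (to T-implies (proj₂ (to (T-∧ {aliveTo Sign.+ w′}) (to T-allFin h w′))) e)) })
    (λ h → from T-allFin (λ w′ → from T-∧ (
      from T-implies (λ e → from T-anyF (convert⁻¹ (h Sign.+ w′ e))) ,
      from T-implies (λ e → from T-anyF (convert⁻¹ (h Sign.- w′ e))))))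
    where
    aliveTo : Sign → V → Bool
    aliveTo s w′ = not (edge s w w′) ∨ anyF (λ l′ → joins s l l′ ★)
    convert : ∀ {s} → ∃ (λ l′ → T (joins s l l′ ★)) → ∃ λ l′ → Joins s l l′ ★
    convert {s} (l′ , j) = l′ , to (T-joins {s} {l} {l′} {★}) j
    convert⁻¹ : ∀ {s} → ∃ (λ l′ → Joins s l l′ ★) → ∃ λ l′ → T (joins s l l′ ★)
    convert⁻¹ {s} (l′ , j) = l′ , from (T-joins {s} {l} {l′} {★}) j

  -- Placing the vertex of z on the level of z determines consistent levels
  -- for its whole component, all of them within the path.
  Good : Node → Set
  Good z = ∀ w l → Reach z (w , l , ★) → Alive l w × (∀ l′ → Reach z (w , l′ , ★) → l ≡ l′)

  T-good : ∀ {z} → T (good z) ⇔ Good z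
  T-good {z} = mk⇔ sound complete
    where
    unique : V → Fin (suc m) → Fin (suc m) → Bool
    unique w l l′ = not (reaches z (w , l′ , ★)) ∨ (l == l′)
    sound : T (good z) → Good z
    sound h w l r = to T-alive (proj₁ both) , λ l′ r′ →
      to T-== (to (T-implies {reaches z (w , l′ , ★)}) (to (T-allF {p = unique w l}) (proj₂ both) l′) r′)
      where
      both : T (alive l w) × T (allF (unique w l))
      both = to (T-∧ {alive l w}) (to T-implies (to (T-allF {p = λ l → goodAt z l w}) (to (T-allFin {p = λ w → allF (λ l → goodAt z l w)}) h w) l) r)
    complete : Good z → T (good z)
    complete h = from (T-allFin {p = λ w → allF (λ l → goodAt z l w)}) λ w →
      from (T-allF {p = λ l → goodAt z l w}) λ l → from T-implies λ r →
        from (T-∧ {alive l w}) (from T-alive (proj₁ (h w l r)) ,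
          from (T-allF {p = unique w l}) λ l′ → from (T-implies {reaches z (w , l′ , ★)}) λ r′ → from (T-== {i = l}) (proj₂ (h w l r) l′ r′))

  -- From a map of signed graphs to levels and solutions

  module Decompose {A : Structure τ} (Φ : V → Vertex (Structure.∣V∣ A))
    (Φ-adj : ∀ {s w w′} → T (edge s w w′) → Adjacent A s (Φ w) (Φ w′)) where

    open Link

    -- At the level of `Φ w` the sign `s` is that of the upward edge of the path; the downward edge
    -- has the opposite sign.
    upLink : ∀ {w w′ s} → s ≡ signAt Sign.+ (level (Φ w)) → T (edge s w w′) → Link A s (Φ w) (Φ w′)
    upLink {w} {w′} s≡ e with Φ-adj e
    ... | inj₁ l = l
    ... | inj₂ l = ⊥-elim (signAt-suc (level (Φ w′)) (trans (cong (signAt Sign.+) (sym (climbs l))) (trans (sym s≡) (signed l))))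

    downLink : ∀ {w w′ s} → s ≡ opposite (signAt Sign.+ (level (Φ w))) → T (edge s w w′) → Link A s (Φ w′) (Φ w)
    downLink {w} s≡ e with Φ-adj e
    ... | inj₁ l = ⊥-elim (signAt-suc (level (Φ w)) (trans (sym s≡) (signed l)))
    ... | inj₂ l = l

    up-true : ∀ {w} → T (hasUp (level (Φ w)) w) → T (up (Φ w))
    up-true {w} h = let _ , e = to (T-anyFin {p = λ w′ → edge (signAt Sign.+ (level (Φ w))) w w′}) h in upper (upLink refl e)

    down-true : ∀ {w} → T (hasDown (level (Φ w)) w) → T (down (Φ w))
    down-true {w} h = let _ , e = to (T-anyFin {p = λ w′ → edge (opposite (signAt Sign.+ (level (Φ w)))) w w′}) h in lower (downLink refl e)

    full-holds : ∀ {w} → T (full (level (Φ w)) w) → T (constraint A (label (level (Φ w))) (tuple (Φ w)))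
    full-holds {w} h =
      let dn , h₁ = to (T-∧ {hasDown (level (Φ w)) w}) h
          w′ , h₂ = to T-anyFin h₁
          e , u   = to (T-∧ {edge (signAt Sign.+ (level (Φ w))) w w′}) h₂
          l       = upLink refl e
      in holds l (down-true dn) (up-true (subst (λ n → T (hasUp n w′)) (sym (climbs l)) u))

    -- Preserved along links. Its first half makes the levels consistent; its second half shows that
    -- `assign` is constant on equivalent nodes, hence satisfies the saturated constraints.
    Invariant : Structure.V A → Node → Set
    Invariant a (w , l , c) = l ≡ height (Φ w) × Vec.lookup (tuple (Φ w)) c ≡ a

    invariant-step : ∀ {a y z} → Invariant a y → Linked y z → Invariant a z
    invariant-step inv stay = inv
    invariant-step {y = w , l , c} (refl , a≡) (tied t f) =
      refl , trans (sym (tie-sound A (label (toℕ l)) (tuple (Φ w)) t (full-holds f))) a≡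
    invariant-step (refl , a≡) (moves s (inj₁ ((climb , s≡) , kp)) e) =
      let l = upLink s≡ e in
      Fin.toℕ-injective (trans climb (sym (climbs l))) , trans (sym (agrees l _ kp)) a≡
    invariant-step {y = w , _ , c} (refl , a≡) (moves {w′ = w′} {l′ = l′} s (inj₂ ((climb , s≡) , kp)) e) =
      let l  = downLink (trans s≡ (trans (sym (Sign.opposite-involutive _)) (cong (opposite ∘ signAt Sign.+) (sym climb)))) e
          l≡ = Fin.toℕ-injective (suc-injective (trans (sym climb) (climbs l)))
      in l≡ , trans (agrees l _ (subst (λ n → T (keeps (label (toℕ n)) c)) l≡ kp)) a≡

    invariant : ∀ {a y z} → Invariant a y → Reach y z → Invariant a z
    invariant {a} inv = Reach-elim (Invariant a) inv (λ {y} {z} i b → invariant-step i (to (T-linked y z) b))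

    start : V → Node
    start v = v , height (Φ v) , ★

    placed : ∀ v {w l} → Reach (start v) (w , l , ★) → l ≡ height (Φ w)
    placed v r = proj₁ (invariant (refl , refl) r)

    start-good : ∀ v → Good (start v)
    start-good v w l r = all-alive , λ l′ r′ → trans l≡ (sym (placed v r′))
      where
      l≡ : l ≡ height (Φ w)
      l≡ = placed v r
      all-alive : Alive l w
      all-alive s w′ e = height (Φ w′) , subst (λ l → Joins s l (height (Φ w′)) ★) (sym l≡)
        ([ (λ k → inj₁ ((climbs k , signed k) , keeps-★ (label (level (Φ w)))))
         , (λ k → inj₂ ((climbs k , signed k) , keeps-★ (label (level (Φ w′))))) ] (Φ-adj e))

    assign : Node → Structure.V A
    assign (w , l , c) = Vec.lookup (tuple (Φ w)) c

    solution : ∀ v → Homomorphism (instanceAt (start v)) A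
    solution v = assign ∘ List.lookup nodes , λ i t h →
      let t′          = Vec.map (List.lookup nodes) t
          w , h₁      = to (T-anyFin {p = λ w → anyF (imposed (start v) i t′ w)}) h
          l , h₂      = to (T-anyF {p = imposed (start v) i t′ w}) h₁
          lbl , h₃    = to (T-∧ {isRelation (label (toℕ l)) i}) h₂
          f , h₄      = to (T-∧ {full (toℕ l) w}) h₃
          r , h₅      = to (T-∧ {reaches (start v) (w , l , ★)}) h₄
          l≡          = placed v r
          value j     = proj₂ (invariant (l≡ , refl) (to (T-allF {p = λ j → reaches (tupleAt w l i j) (Vec.lookup t′ j)}) h₅ j))
          ℓ≡          = trans (cong (label ∘ toℕ) (sym l≡)) (to T-isRelation lbl)
      in subst (T ∘ Structure.rel A i)
           (lookup-ext (λ j → trans (lookup∘tabulate _ j) (trans (sym (value j))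
             (trans (cong assign (lookup-map j (List.lookup nodes) t)) (sym (lookup-map j (assign ∘ List.lookup nodes) t))))))
           (subst (λ ℓ → T (constraint A ℓ (tuple (Φ w)))) ℓ≡ (full-holds (subst (λ n → T (full (toℕ n) w)) l≡ f)))

  -- From levels and solutions to a map of signed graphs

  module Assemble {A : Structure τ} (l₀ : V → Fin (suc m)) (good₀ : ∀ v → Good (v , l₀ v , ★))
    (sol : ∀ v → Homomorphism (instanceAt (v , l₀ v , ★)) A) where

    origin : V → Node
    origin v = v , l₀ v , ★

    connected : V → V → Bool
    connected v w = anyF λ l → reaches (origin v) (w , l , ★)

    connected-refl : ∀ w → T (connected w w)
    connected-refl w = from (T-anyF {p = λ l → reaches (origin w) (w , l , ★)}) (l₀ w , Reach-refl _)

    connected-edge : ∀ {s w w′} → T (edge s w w′) → ∀ v → T (connected v w) → T (connected v w′)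
    connected-edge {s} {w} {w′} e v h =
      let l , r  = to (T-anyF {p = λ l → reaches (origin v) (w , l , ★)}) h
          l′ , j = proj₁ (good₀ v w l r) s w′ e
      in from (T-anyF {p = λ l → reaches (origin v) (w′ , l , ★)}) (l′ , Reach-link r (moves s j e))

    -- The levels and solutions given for different vertices of one component need not be
    -- compatible, so those of a single vertex are used for the whole component.
    root : V → V
    root w = first w (λ v → connected v w)

    root-connected : ∀ w → T (connected (root w) w)
    root-connected w = first-satisfies w (λ v → connected v w) (connected-refl w)

    root-edge : ∀ {s w w′} → T (edge s w w′) → root w ≡ root w′
    root-edge {s} {w} {w′} e = first-cong w w′ _ _
      (λ v → mk⇔ (connected-edge e v) (connected-edge (edge-swap e) v)) (connected-refl w) (connected-refl w′)

    opaque
      heightOf : V → Fin (suc m)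
      heightOf w = proj₁ (to (T-anyF {p = λ l → reaches (origin (root w)) (w , l , ★)}) (root-connected w))

      root-reaches : ∀ w → Reach (origin (root w)) (w , heightOf w , ★)
      root-reaches w = proj₂ (to (T-anyF {p = λ l → reaches (origin (root w)) (w , l , ★)}) (root-connected w))

    index : Node → Fin (length nodes)
    index z = Any.index (nodes-complete z)

    -- The least node equivalent to z: solutions need not agree on
    -- equivalent nodes, so they are read off representatives.
    class : Node → Fin (length nodes)
    class z = first (index z) (λ u → reaches z (List.lookup nodes u))

    class-self : ∀ z → Reach z (List.lookup nodes (index z))
    class-self z = subst (Reach z) (sym (lookup-index (nodes-complete z))) (Reach-refl z)

    class-reached : ∀ z → Reach z (List.lookup nodes (class z))
    class-reached z = first-satisfies (index z) (λ u → reaches z (List.lookup nodes u)) (class-self z)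

    class-linked : ∀ {y z} → Linked y z → class y ≡ class z
    class-linked {y} {z} l = first-cong (index y) (index z) _ _
      (λ u → mk⇔ (Reach-trans (Reach-flip y⇝z)) (Reach-trans y⇝z)) (class-self y) (class-self z)
      where
      y⇝z : Reach y z
      y⇝z = Reach-link (Reach-refl y) l

    valueOf : V → Fin d → Structure.V A
    valueOf w c = proj₁ (sol (root w)) (class (w , heightOf w , c))

    -- The Booleans are true only where an edge may force them. An edge is then subject to its
    -- constraint only if `full` announces it, in which case the instance contains it.
    Φ : V → Vertex (Structure.∣V∣ A)
    Φ w = heightOf w , hasDown (toℕ (heightOf w)) w , hasUp (toℕ (heightOf w)) w , Vec.tabulate (valueOf w)

    full-constraint : ∀ w ℓ → label (toℕ (heightOf w)) ≡ ℓ → T (full (toℕ (heightOf w)) w) →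
      T (constraint A ℓ (Vec.tabulate (valueOf w)))
    full-constraint w bottom       eq f = tt
    full-constraint w top          eq f = tt
    full-constraint w idle         eq f = tt
    full-constraint w (diagonal j) eq f = from T-== (trans (lookup∘tabulate (valueOf w) base)
      (trans (cong (proj₁ (sol (root w))) (class-linked (tied (subst (λ ℓ → T (tie ℓ base (slot j))) (sym eq) (from (T-== {i = j}) refl)) f)))
        (sym (lookup∘tabulate (valueOf w) (slot j)))))
    -- The representatives of the slots of `w` are reached from these slots, so saturation puts
    -- their tuple into the instance.
    full-constraint w (relation i) eq f = subst (T ∘ Structure.rel A i)
      (trans (sym (tabulate-∘ (proj₁ (sol (root w))) classes))
        (tabulate-cong (λ j → sym (lookup∘tabulate (valueOf w) (slot (inject≤ j (arity≤r i)))))))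
      (proj₂ (sol (root w)) i (Vec.tabulate classes)
        (from (T-anyFin {p = λ w′ → anyF (imposed (origin (root w)) i t w′)}) (w , from (T-anyF {p = imposed (origin (root w)) i t w}) (heightOf w ,
          from (T-∧ {isRelation (label (toℕ (heightOf w))) i}) (from T-isRelation eq ,
          from (T-∧ {full (toℕ (heightOf w)) w}) (f ,
          from (T-∧ {reaches (origin (root w)) (w , heightOf w , ★)}) (root-reaches w ,
          from (T-allF {p = λ j → reaches (tupleAt w (heightOf w) i j) (Vec.lookup t j)}) (λ j →
            subst (Reach (tupleAt w (heightOf w) i j))
              (sym (trans (lookup-map j (List.lookup nodes) (Vec.tabulate classes)) (cong (List.lookup nodes) (lookup∘tabulate classes j))))
              (class-reached (tupleAt w (heightOf w) i j))))))))))
      where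
      classes : Fin (arity τ i) → Fin (length nodes)
      classes j = class (tupleAt w (heightOf w) i j)
      t : Vec Node (arity τ i)
      t = Vec.map (List.lookup nodes) (Vec.tabulate classes)

    -- Being alive gives some level for `w′`. It is reached from the root shared by `w` and `w′`, so
    -- uniqueness identifies it with `heightOf w′`.
    heights-join : ∀ {s w w′} → T (edge s w w′) → Joins s (heightOf w) (heightOf w′) ★
    heights-join {s} {w} {w′} e =
      let r      = root-reaches w
          l′ , j = proj₁ (good₀ (root w) w (heightOf w) r) s w′ e
          r′     = Reach-link r (moves s j e)
          l′≡    = proj₂ (good₀ (root w) w′ l′ r′) (heightOf w′) (subst (λ v → Reach (origin v) (w′ , heightOf w′ , ★)) (sym (root-edge e)) (root-reaches w′))
      in subst (λ l → Joins s (heightOf w) l ★) l′≡ j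

    rising : ∀ {s w w′} → toℕ (heightOf w′) ≡ suc (toℕ (heightOf w)) → s ≡ signAt Sign.+ (toℕ (heightOf w)) →
      T (edge s w w′) → Link A s (Φ w) (Φ w′)
    rising {s} {w} {w′} climb s≡ e = mkLink climb s≡
      (from T-anyFin (w′ , upward))
      (from T-anyFin (w , subst (λ t → T (edge t w′ w))
        (trans s≡ (trans (sym (Sign.opposite-involutive _)) (cong (opposite ∘ signAt Sign.+) (sym climb)))) (edge-swap e)))
      (λ c kp → trans (lookup∘tabulate (valueOf w) c) (trans
        (cong₂ (λ v → proj₁ (sol v)) (root-edge e) (class-linked (moves s (inj₁ ((climb , s≡) , kp)) e)))
        (sym (lookup∘tabulate (valueOf w′) c))))
      (λ dn u → full-constraint w _ refl (from (T-∧ {hasDown (toℕ (heightOf w)) w}) (dn , from T-anyFin (w′ ,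
        from (T-∧ {edge (signAt Sign.+ (toℕ (heightOf w))) w w′}) (upward , subst (λ n → T (hasUp n w′)) climb u)))))
      where
      upward : T (edge (signAt Sign.+ (toℕ (heightOf w))) w w′)
      upward = subst (λ t → T (edge t w w′)) s≡ e

    Φ-adjacent : ∀ {s w w′} → T (edge s w w′) → Adjacent A s (Φ w) (Φ w′)
    Φ-adjacent {s} {w} {w′} e =
      [ (λ (j , _) → inj₁ (rising (proj₁ j) (proj₂ j) e))
      , (λ (j , _) → inj₂ (rising (proj₁ j) (proj₂ j) (edge-swap e))) ] (heights-join e)

  Placeable : Structure τ → Set
  Placeable A = ∀ v → ∃ λ l → Good (v , l , ★) × Homomorphism (instanceAt (v , l , ★)) A

  decompose : ∀ {A} (Φ : V → Vertex (Structure.∣V∣ A)) → (∀ {s w w′} → T (edge s w w′) → Adjacent A s (Φ w) (Φ w′)) → Placeable A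
  decompose {A} Φ adj v = height (Φ v) , start-good v , solution v
    where open Decompose {A} Φ adj

  assemble : ∀ {A} → Placeable A → Σ (V → Vertex (Structure.∣V∣ A)) λ Φ → ∀ {s w w′} → T (edge s w w′) → Adjacent A s (Φ w) (Φ w′)
  assemble {A} p = Φ , Φ-adjacent
    where
    good₀ : ∀ v → Good (v , proj₁ (p v) , ★)
    good₀ v = proj₁ (proj₂ (p v))
    sol : ∀ v → Homomorphism (instanceAt (v , proj₁ (p v) , ★)) A
    sol v = proj₂ (proj₂ (p v))
    open Assemble {A} (λ v → proj₁ (p v)) good₀ sol

  ecHomomorphism⇔ : ∀ A → EcHomomorphism G (signedGraph A) ⇔ Placeable A
  ecHomomorphism⇔ A = mk⇔
    (λ φ → let Φ , adj = to equiv φ in decompose Φ (λ {s} {w} {w′} e → to (T-adjacent A s (Φ w) (Φ w′)) (adj s w w′ e)))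
    (λ p → let Φ , adj = assemble p in from equiv (Φ , λ s w w′ e → from (T-adjacent A s (Φ w) (Φ w′)) (adj e)))
    where
    equiv : EcHomomorphism G (signedGraph A) ⇔
      Σ (V → Vertex (Structure.∣V∣ A)) λ Φ → ∀ s w w′ → T (edge s w w′) → T (adjacent A s (Φ w) (Φ w′))
    equiv = EcHom-toGraphOn {G = G} {E = adjacent A} {adjacent-sym A} (vertices-complete (Structure.∣V∣ A))

-- Programs

module Programs (L : Tree → Set) where

  open Semantics L {2}

  -- Variable 0 holds the argument and then the value, variable 1 a stack
  -- on which subprograms save data.  The bound covers the size of the
  -- value as well as the time, which is what composition needs.
  record Computes {A : Set} (e f : A → Tree) : Set where
    field
      program : Command 2
      bound   : Poly
      run     : ∀ a s → ∃ λ t →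
        (program ⊢ e a ∷ s ∷ [] ⇓[ t ] f a ∷ s ∷ []) ×
        t + size (f a) ≤ eval bound (size (e a) + size s)

  open Computes

  private
    pattern X = zero
    pattern S = suc zero

    x s : Expr 2
    x = var X
    s = var S

  output-bound : ∀ {A} {e f : A → Tree} (p : Computes e f) a →
    size (f a) ≤ eval (bound p) (size (e a) + 1)
  output-bound p a = m+n≤o⇒n≤o _ (proj₂ (proj₂ (run p a nil)))

  convert : ∀ {A} {e f g : A → Tree} → (∀ a → f a ≡ g a) → Computes e f → Computes e g
  convert {e = e} eq p = record
    { program = program p
    ; bound   = bound p
    ; run     = λ a σ → subst
        (λ d → ∃ λ t → (program p ⊢ e a ∷ σ ∷ [] ⇓[ t ] d ∷ σ ∷ []) × t + size d ≤ _)
        (eq a) (run p a σ)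
    }

  reindex : ∀ {A B} {e f : A → Tree} (h : B → A) → Computes e f → Computes (e ∘ h) (f ∘ h)
  reindex h p = record { program = program p ; bound = bound p ; run = run p ∘ h }

  identity : ∀ {A} {e : A → Tree} → Computes e e
  identity {e = e} = record
    { program = skip
    ; bound   = con 1 ⊕ var
    ; run     = λ a σ → 1 , skip , s≤s (m≤m+n _ _)
    }

  compose : ∀ {A} {e f g : A → Tree} → Computes e f → Computes f g → Computes e g
  compose {e = e} {f} {g} p q = record
    { program = program p ⨾ program q
    ; bound   = bound p ⊕ bound q ⊚ (bound p ⊕ var)
    ; run     = λ a σ →
        let t , p⇓ , t≤ = run p a σ
            u , q⇓ , u≤ = run q a σ
            open ≤-Reasoning
        in t + u , seq p⇓ q⇓ , (begin
          t + u + size (g a)   ≡⟨ +-assoc t u _ ⟩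
          t + (u + size (g a)) ≤⟨ +-mono-≤ (m+n≤o⇒m≤o t t≤) (≤-trans u≤
            (eval-mono (bound q) (+-mono-≤ (m+n≤o⇒n≤o t t≤) (m≤n+m _ (size (e a)))))) ⟩
          _ ∎)
    }

  evaluate : ∀ {A} {e : A → Tree} (f : A → Tree) (ex : Expr 2) →
    (∀ a σ → ⟦ ex ⟧ (e a ∷ σ ∷ []) ≡ f a) → (∀ a → size (f a) ≤ size (e a)) → Computes e f
  evaluate {e = e} f ex eq f≤e = record
    { program = X := ex
    ; bound   = var ⊕ var
    ; run     = λ a σ → size (f a) ,
        subst (λ d → X := ex ⊢ e a ∷ σ ∷ [] ⇓[ size d ] d ∷ σ ∷ []) (eq a σ) assign ,
        +-mono-≤ (≤-trans (f≤e a) (m≤m+n _ _)) (≤-trans (f≤e a) (m≤m+n _ _))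
    }

  leftOf : ∀ {A} {e f : A → Tree} → Computes e f → Computes e (left ∘ f)
  leftOf p = compose p (evaluate _ (hd x) (λ _ _ → refl) (λ a → size-left _))

  rightOf : ∀ {A} {e f : A → Tree} → Computes e f → Computes e (right ∘ f)
  rightOf p = compose p (evaluate _ (tl x) (λ _ _ → refl) (λ a → size-right _))

  leaf : ∀ {A} {e : A → Tree} → Computes e (const nil)
  leaf {e = e} = evaluate _ nil (λ _ _ → refl) (λ a → size>0 (e a))

  pair : ∀ {A} {e f g : A → Tree} → Computes e f → Computes e g → Computes e (λ a → f a ∙ g a)
  pair {e = e} {f} {g} p q = record
    -- The input waits on the stack while the first program runs, then changes places with its
    -- value; the second program finds the input in `X` and that value on the stack.
    { program = S := cons x s ⨾ program p ⨾
                S := cons (cons x (hd s)) (tl s) ⨾ X := tl (hd s) ⨾ S := cons (hd (hd s)) (tl s) ⨾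
                program q ⨾ X := cons (hd s) x ⨾ S := tl s
    ; bound   = B ⊕ B
    ; run     = λ a σ →
        let E = size (e a)
            N = E + size σ
            F = size (f a)
            G = size (g a)
            t , p⇓ , t≤ = run p a (e a ∙ σ)
            u , q⇓ , u≤ = run q a (f a ∙ σ)
            e≤N : E ≤ N
            e≤N = m≤m+n _ _
            s≤N : size σ ≤ N
            s≤N = m≤n+m _ E
            tF≤ : t + F ≤ eval P N
            tF≤ = ≤-trans t≤ (eval-mono (bound p) (+-monoˡ-≤ _ e≤N))
            f≤P : F ≤ eval P N
            f≤P = m+n≤o⇒n≤o t tF≤
            uG≤ : u + G ≤ eval Q N
            uG≤ = ≤-trans u≤ (eval-mono (bound q) (+-mono-≤ e≤N (s≤s (+-mono-≤ f≤P s≤N))))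
            g≤Q : G ≤ eval Q N
            g≤Q = m+n≤o⇒n≤o u uG≤
            total≤ = +-mono-≤ (≤-refl {suc N})
              (+-mono-≤ (m+n≤o⇒m≤o t tF≤)
              (+-mono-≤ (s≤s (+-mono-≤ (s≤s (+-mono-≤ f≤P e≤N)) s≤N))
              (+-mono-≤ e≤N
              (+-mono-≤ (s≤s (+-mono-≤ f≤P s≤N))
              (+-mono-≤ (m+n≤o⇒m≤o u uG≤)
              (+-mono-≤ (s≤s (+-mono-≤ f≤P g≤Q)) s≤N))))))
        in _ ,
           seq assign (seq p⇓ (seq assign (seq assign (seq assign (seq q⇓ (seq assign assign)))))) ,
           +-mono-≤ total≤ (≤-trans (s≤s (+-mono-≤ f≤P g≤Q)) (final (eval P N) (eval Q N) N))
    }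
    where
    P Q B : Poly
    P = bound p ⊚ (var ⊕ (con 1 ⊕ var))
    Q = bound q ⊚ (var ⊕ (con 1 ⊕ (P ⊕ var)))
    B = (con 1 ⊕ var) ⊕ (P ⊕ ((con 1 ⊕ ((con 1 ⊕ (P ⊕ var)) ⊕ var)) ⊕ (var ⊕ ((con 1 ⊕ (P ⊕ var)) ⊕
          (Q ⊕ ((con 1 ⊕ (P ⊕ Q)) ⊕ var))))))
    final : ∀ p q n → suc (p + q) ≤ suc n + (p + (suc (suc (p + n) + n) +
              (n + (suc (p + n) + (q + (suc (p + q) + n))))))
    final p q n = ≤-trans (m≤m+n (suc (p + q)) n) (≤-trans (m≤n+m _ q) (≤-trans (m≤n+m _ (suc (p + n)))
      (≤-trans (m≤n+m _ n) (≤-trans (m≤n+m _ (suc (suc (p + n) + n))) (≤-trans (m≤n+m _ p) (m≤n+m _ (suc n)))))))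

  choose : {A : Set} → Tree → A → A → A
  choose nil     y z = z
  choose (_ ∙ _) y z = y

  cond : ∀ {A} {e c f g : A → Tree} → Computes e c → Computes e f → Computes e g →
         Computes e (λ a → choose (c a) (f a) (g a))
  cond {A} {e} {c} {f} {g} r p q = compose (pair r identity) (record
    { program = if hd x then X := tl x ⨾ program p else (X := tl x ⨾ program q)
    ; bound   = con 1 ⊕ (var ⊕ (bound p ⊕ bound q))
    ; run     = λ a → go a (c a)
    })
    where
    step≤ : ∀ {v} w h E Σ t F → t + F ≤ eval w (E + Σ) →
            eval w (suc (h + E) + Σ) ≤ v → suc (E + t) + F ≤ suc ((suc (h + E) + Σ) + v)
    step≤ {v} w h E Σ t F t≤ w≤v = s≤s (begin
      E + t + F              ≡⟨ +-assoc E t F ⟩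
      E + (t + F)            ≤⟨ +-mono-≤ E≤ (≤-trans t≤ (≤-trans (eval-mono w (+-monoˡ-≤ Σ (m≤n⇒m≤1+n (m≤n+m E h)))) w≤v)) ⟩
      (suc (h + E) + Σ) + v  ∎)
      where
      open ≤-Reasoning
      E≤ : E ≤ suc (h + E) + Σ
      E≤ = ≤-trans (m≤n⇒m≤1+n (m≤n+m E h)) (m≤m+n _ Σ)

    go : ∀ a h σ → ∃ λ t →
      (if hd x then X := tl x ⨾ program p else (X := tl x ⨾ program q) ⊢ (h ∙ e a) ∷ σ ∷ []
         ⇓[ t ] choose h (f a) (g a) ∷ σ ∷ []) ×
      t + size (choose h (f a) (g a)) ≤
        eval (con 1 ⊕ (var ⊕ (bound p ⊕ bound q))) (size (h ∙ e a) + size σ)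
    go a nil σ = let u , q⇓ , u≤ = run q a σ in
      _ , if-false refl (seq assign q⇓) ,
      step≤ (bound q) 1 (size (e a)) (size σ) u (size (g a)) u≤ (m≤n+m _ (eval (bound p) _))
    go a (l ∙ r) σ = let t , p⇓ , t≤ = run p a σ in
      _ , if-true (λ ()) (seq assign p⇓) ,
      step≤ (bound p) (size (l ∙ r)) (size (e a)) (size σ) t (size (f a)) t≤ (m≤m+n (eval (bound p) _) _)

  -- A query has a run only through its yes-rule or its no-rule, so exhibiting one constructively
  -- takes a decision of the language at the submitted trees.
  oracle : ∀ {A} {e d : A → Tree} (L? : ∀ a → Dec (L (d a))) → Computes e d →
           Computes e (λ a → encodeBool (Dec.does (L? a)))
  oracle {e = e} {d} L? p = compose p (record
    { program = X :=ask x
    ; bound   = con 1 ⊕ var ⊕ con 3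
    ; run     = λ a → go a (L? a)
    })
    where
    go : ∀ a (a? : Dec (L (d a))) σ → ∃ λ t →
      (X :=ask x ⊢ d a ∷ σ ∷ [] ⇓[ t ] encodeBool (Dec.does a?) ∷ σ ∷ []) ×
      t + size (encodeBool (Dec.does a?)) ≤ eval (con 1 ⊕ var ⊕ con 3) (size (d a) + size σ)
    go a (yes q) σ = _ , ask-yes q , +-monoˡ-≤ 3 (s≤s (m≤m+n (size (d a)) (size σ)))
    go a (no ¬q) σ = _ , ask-no ¬q , +-mono-≤ (s≤s (m≤m+n (size (d a)) (size σ))) (s≤s z≤n)

  module _ {A : Set} {Z : A → Set} {z : ∀ a → Z a → Tree} {acc : ∀ a → List (Z a) → Tree}
    (W : Poly)
    (acc≤ : ∀ a ys → size (acc a ys) ≤ eval W (size (codeList (z a) ys) + size (acc a [])))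
    (body : Computes {Σ A λ a → List (Z a) × Z a}
                     (λ (a , ys , y) → z a y ∙ acc a ys) (λ (a , ys , y) → acc a (y ∷ ys)))
    where

    private
      iteration : Command 2
      iteration = S := cons (tl (hd x)) s ⨾ X := cons (hd (hd x)) (tl x) ⨾ program body ⨾
                  X := cons (hd s) x ⨾ S := tl s

      P D : Poly
      P = bound body ⊚ ((con 1 ⊕ (var ⊕ W)) ⊕ (con 1 ⊕ (var ⊕ var)))
      D = con 1 ⊕ ((con 1 ⊕ (var ⊕ var)) ⊕ ((con 1 ⊕ (var ⊕ W)) ⊕ (P ⊕ ((con 1 ⊕ (var ⊕ W)) ⊕ var))))

      -- `N` bounds the joint size of the remaining list, the consumed list, the initial accumulator
      -- and the stack. Moving an entry from one list to the other preserves the sum, so each round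
      -- costs at most `eval D N`.
      loop-run : ∀ a σ N xs ys →
        size (codeList (z a) xs) + size (codeList (z a) ys) + (size (acc a []) + size σ) ≤ N →
        ∃ λ t →
          (while hd x loop iteration ⊢ (codeList (z a) xs ∙ acc a ys) ∷ σ ∷ []
             ⇓[ t ] (nil ∙ acc a (xs ʳ++ ys)) ∷ σ ∷ []) ×
          t ≤ suc (length xs * eval D N)
      loop-run a σ N []       ys N≥ = 1 , while-false refl , s≤s z≤n
      loop-run a σ N (y ∷ xs) ys N≥ =
        let X′ = size (codeList (z a) xs)
            Y  = size (codeList (z a) ys)
            v  = size (z a y)
            q  = size (acc a [])
            t , b⇓ , t≤ = run body (a , ys , y) (codeList (z a) xs ∙ σ)
            u , l⇓ , u≤ = loop-run a σ N xs (y ∷ ys) (≤-trans (≤-reflexive (move v X′ Y _)) N≥)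
            v≤N : v ≤ N
            v≤N = ≤-trans (≤-trans (m≤n⇒m≤1+n (m≤m+n v X′)) (≤-trans (m≤m+n _ Y) (m≤m+n _ _))) N≥
            X≤N : X′ ≤ N
            X≤N = ≤-trans (≤-trans (m≤n⇒m≤1+n (m≤n+m X′ v)) (≤-trans (m≤m+n _ Y) (m≤m+n _ _))) N≥
            s≤N : size σ ≤ N
            s≤N = ≤-trans (≤-trans (m≤n+m _ q) (m≤n+m _ (suc (v + X′) + Y))) N≥
            acc≤N : size (acc a ys) ≤ eval W N
            acc≤N = ≤-trans (acc≤ a ys) (eval-mono W (≤-trans (shrink Y (v + X′) q (size σ)) N≥))
            acc′≤N : size (acc a (y ∷ ys)) ≤ eval W N
            acc′≤N = ≤-trans (acc≤ a (y ∷ ys)) (eval-mono W (≤-trans (shrink′ v X′ Y q (size σ)) N≥))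
            b≤ : t ≤ eval P N
            b≤ = ≤-trans (m+n≤o⇒m≤o t t≤)
                   (eval-mono (bound body) (+-mono-≤ (s≤s (+-mono-≤ v≤N acc≤N)) (s≤s (+-mono-≤ X≤N s≤N))))
            once≤ = s≤s (+-mono-≤ (s≤s (+-mono-≤ X≤N s≤N)) (+-mono-≤ (s≤s (+-mono-≤ v≤N acc≤N))
                      (+-mono-≤ b≤ (+-mono-≤ (s≤s (+-mono-≤ X≤N acc′≤N)) s≤N))))
        in _ , while-true (λ ()) (seq assign (seq assign (seq b⇓ (seq assign assign)))) l⇓ ,
           ≤-trans (+-mono-≤ once≤ u≤) (≤-reflexive (+-suc (eval D N) _))
        where
        move : ∀ v x y w → x + suc (v + y) + w ≡ suc (v + x) + y + w
        move = solve-∀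
        shrink : ∀ y x q s → y + q ≤ suc x + y + (q + s)
        shrink y x q s = +-mono-≤ (m≤n+m y (suc x)) (m≤m+n q s)
        shrink′ : ∀ v x y q s → suc (v + y) + q ≤ suc (v + x) + y + (q + s)
        shrink′ v x y q s = +-mono-≤ (s≤s (+-monoˡ-≤ y (m≤m+n v x))) (m≤m+n q s)

    -- Composing the bound of `body` with itself once per entry would not be polynomial. Hence `W`
    -- bounds each accumulator directly in terms of the consumed list, which occurs only in the
    -- specification and is not stored.
    fold : Computes {Σ A (List ∘ Z)} (λ (a , xs) → codeList (z a) xs ∙ acc a []) (λ (a , xs) → acc a (xs ʳ++ []))
    fold = record
      { program = while hd x loop iteration ⨾ X := tl x
      ; bound   = (con 1 ⊕ var ⊗ D) ⊕ W ⊕ W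
      ; run     = λ (a , xs) σ →
          let N = suc (size (codeList (z a) xs) + size (acc a [])) + size σ
              N≡ : size (codeList (z a) xs) + 1 + (size (acc a []) + size σ) ≡ N
              N≡ = lemma (size (codeList (z a) xs)) (size (acc a [])) (size σ)
              t , l⇓ , t≤ = loop-run a σ N xs [] (≤-reflexive N≡)
              X≤N : size (codeList (z a) xs) ≤ N
              X≤N = ≤-trans (m≤n⇒m≤1+n (m≤m+n _ _)) (m≤m+n _ (size σ))
              out≤ : size (acc a (xs ʳ++ [])) ≤ eval W N
              out≤ = ≤-trans (acc≤ a (xs ʳ++ [])) (eval-mono W (≤-trans
                       (+-monoˡ-≤ (size (acc a [])) (m+n≤o⇒m≤o _ (≤-reflexive (size-reverse a xs []))))
                       (≤-trans (+-monoʳ-≤ (size (codeList (z a) xs) + 1) (m≤m+n (size (acc a [])) (size σ))) (≤-reflexive N≡))))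
          in t + size (acc a (xs ʳ++ [])) , seq l⇓ assign ,
             +-mono-≤ (+-mono-≤ (≤-trans t≤ (s≤s (*-monoˡ-≤ (eval D N) (≤-trans (length≤size (z a) xs) X≤N)))) out≤) out≤
      }
      where
      lemma : ∀ x q s → x + 1 + (q + s) ≡ suc (x + q) + s
      lemma = solve-∀
      size-reverse : ∀ a xs ys → size (codeList (z a) (xs ʳ++ ys)) + 1 ≡ size (codeList (z a) xs) + size (codeList (z a) ys)
      size-reverse a []       ys = +-comm _ 1
      size-reverse a (x′ ∷ xs) ys = trans (size-reverse a xs (x′ ∷ ys))
        (lemma′ (size (z a x′)) (size (codeList (z a) xs)) (size (codeList (z a) ys)))
        where
        lemma′ : ∀ v x y → x + suc (v + y) ≡ suc (v + x) + y
        lemma′ = solve-∀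

-- Typed terms with polynomial-time programs

module Terms (L : Tree → Set) where

  open Programs L
  open Semantics L using (_⊢_⇓[_]_)

  -- Indexed by the function computed, so that writing a term for a function also proves its program
  -- correct.
  record Tm (Γ : Ctx) (A : Ty Γ) (t : ∀ γ → El A γ) : Set where
    constructor ⟨_⟩
    field computes : Computes (enc Γ) (λ γ → code A γ (t γ))

  open Tm public

  cast : ∀ {Γ A B t} {u : ∀ γ → El B γ} → (∀ γ → code A γ (t γ) ≡ code B γ (u γ)) → Tm Γ A t → Tm Γ B u
  cast eq ⟨ p ⟩ = ⟨ convert eq p ⟩

  v0 : ∀ {Γ A} → Tm (Γ ▷ A) (A ⇑ A) proj₂
  v0 = ⟨ leftOf identity ⟩

  wk : ∀ {Γ A B t} → Tm Γ A t → Tm (Γ ▷ B) (A ⇑ B) (t ∘ proj₁)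
  wk ⟨ p ⟩ = ⟨ compose (rightOf identity) (reindex proj₁ p) ⟩

  subᵗ : ∀ {Γ Δ} {A : Ty Δ} {t} (h : Carrier Γ → Carrier Δ) →
         Computes (enc Γ) (enc Δ ∘ h) → Tm Δ A t →
         Computes (enc Γ) (λ γ → code A (h γ) (t (h γ)))
  subᵗ h q ⟨ p ⟩ = compose q (reindex h p)

  nilᵗ : ∀ {Γ A} → Tm Γ (list A) (λ _ → [])
  nilᵗ = ⟨ leaf ⟩

  consᵗ : ∀ {Γ A x xs} → Tm Γ A x → Tm Γ (list A) xs → Tm Γ (list A) (λ γ → x γ ∷ xs γ)
  consᵗ ⟨ p ⟩ ⟨ q ⟩ = ⟨ pair p q ⟩

  pairᵗ : ∀ {Γ A B x y} → Tm Γ A x → Tm Γ B y → Tm Γ (A ⊠ B) (λ γ → x γ , y γ)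
  pairᵗ ⟨ p ⟩ ⟨ q ⟩ = ⟨ pair p q ⟩

  fstᵗ : ∀ {Γ A B p} → Tm Γ (A ⊠ B) p → Tm Γ A (proj₁ ∘ p)
  fstᵗ ⟨ p ⟩ = ⟨ leftOf p ⟩

  sndᵗ : ∀ {Γ A B p} → Tm Γ (A ⊠ B) p → Tm Γ B (proj₂ ∘ p)
  sndᵗ ⟨ p ⟩ = ⟨ rightOf p ⟩

  treeᵗ : ∀ {Γ} d → Tm Γ tree (const d)
  treeᵗ nil     = ⟨ leaf ⟩
  treeᵗ (l ∙ r) = ⟨ pair (computes (treeᵗ l)) (computes (treeᵗ r)) ⟩

  constᵗ : ∀ {Γ} {A : Ty Γ} (x : ∀ γ → El A γ) d → (∀ γ → d ≡ code A γ (x γ)) → Tm Γ A x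
  constᵗ x d eq = cast eq (treeᵗ d)

  boolᵗ : ∀ {Γ} b → Tm Γ bool (const b)
  boolᵗ b = constᵗ _ (encodeBool b) (λ _ → refl)

  ifᵗ : ∀ {Γ A b x y} → Tm Γ bool b → Tm Γ A x → Tm Γ A y →
        Tm Γ A (λ γ → Bool.if b γ then x γ else y γ)
  ifᵗ {A = A} {b} {x} {y} ⟨ p ⟩ ⟨ q ⟩ ⟨ r ⟩ = ⟨ convert (λ γ → lemma γ (b γ)) (cond p q r) ⟩
    where
    lemma : ∀ γ c → choose (encodeBool c) (code A γ (x γ)) (code A γ (y γ)) ≡
                    code A γ (Bool.if c then x γ else y γ)
    lemma γ true  = refl
    lemma γ false = refl

  notᵗ : ∀ {Γ b} → Tm Γ bool b → Tm Γ bool (not ∘ b)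
  notᵗ {b = b} p = cast (λ γ → lemma (b γ)) (ifᵗ {A = bool} p (boolᵗ false) (boolᵗ true))
    where
    lemma : ∀ c → encodeBool (Bool.if c then false else true) ≡ encodeBool (not c)
    lemma true  = refl
    lemma false = refl

  infixr 6 _∧ᵗ_
  infixr 5 _∨ᵗ_

  _∧ᵗ_ : ∀ {Γ b c} → Tm Γ bool b → Tm Γ bool c → Tm Γ bool (λ γ → b γ ∧ c γ)
  _∧ᵗ_ {b = b} {c} p q = cast (λ γ → lemma (b γ) (c γ)) (ifᵗ {A = bool} p q (boolᵗ false))
    where
    lemma : ∀ x y → encodeBool (Bool.if x then y else false) ≡ encodeBool (x ∧ y)
    lemma true  y = refl
    lemma false y = refl

  _∨ᵗ_ : ∀ {Γ b c} → Tm Γ bool b → Tm Γ bool c → Tm Γ bool (λ γ → b γ ∨ c γ)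
  _∨ᵗ_ {b = b} {c} p q = cast (λ γ → lemma (b γ) (c γ)) (ifᵗ {A = bool} p (boolᵗ true) q)
    where
    lemma : ∀ x y → encodeBool (Bool.if x then true else y) ≡ encodeBool (x ∨ y)
    lemma true  y = refl
    lemma false y = refl

  isNilᵗ : ∀ {Γ d} → Tm Γ tree d → Tm Γ bool (isNil ∘ d)
  isNilᵗ {d = d} ⟨ p ⟩ = ⟨ convert (λ γ → lemma (d γ)) (cond p leaf (computes (treeᵗ (nil ∙ nil)))) ⟩
    where
    lemma : ∀ c → choose c nil (nil ∙ nil) ≡ encodeBool (isNil c)
    lemma nil     = refl
    lemma (_ ∙ _) = refl

  allFᵗ : ∀ {Γ k} {p : Fin k → Carrier Γ → Bool} → (∀ i → Tm Γ bool (p i)) →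
          Tm Γ bool (λ γ → allF (λ i → p i γ))
  allFᵗ {k = zero}  p = boolᵗ true
  allFᵗ {k = suc k} p = p zero ∧ᵗ allFᵗ (p ∘ suc)

  anyFᵗ : ∀ {Γ k} {p : Fin k → Carrier Γ → Bool} → (∀ i → Tm Γ bool (p i)) →
          Tm Γ bool (λ γ → anyF (λ i → p i γ))
  anyFᵗ {k = zero}  p = boolᵗ false
  anyFᵗ {k = suc k} p = p zero ∨ᵗ anyFᵗ (p ∘ suc)

  module _ {Γ : Ctx} {A : Ty Γ} {xs : ∀ γ → List (El A γ)} (B : Ty Γ) (acc : ∀ γ → List (El A γ) → El B γ)
    (W : Poly) (acc≤ : ∀ γ ys → size (code B γ (acc γ ys)) ≤ eval W (size (codeList (code A γ) ys) + size (enc Γ γ)))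
    (body : Tm (Γ ▷ via B acc ▷ A ⇑ via B acc) (B ⇑ via B acc ⇑ (A ⇑ via B acc)) (λ γ → acc (proj₁ (proj₁ γ)) (proj₂ γ ∷ proj₂ (proj₁ γ))))
    where

    -- The entry `via B acc` stands for the consumed list, of which only the accumulator is stored.
    -- The code of the context travels with the accumulator, so that `body` has access to the
    -- variables of `Γ`.
    foldˡᵗ : Tm Γ (list A) xs → Tm Γ B (λ γ → acc γ []) → Tm Γ B (λ γ → acc γ (List.reverse (xs γ)))
    foldˡᵗ ⟨ p ⟩ ⟨ q ⟩ = ⟨ leftOf (compose (pair p (pair q identity)) (reindex (λ γ → γ , xs γ)
      (fold {acc = λ γ ys → code B γ (acc γ ys) ∙ enc Γ γ} (con 1 ⊕ (W ⊕ var)) bound≤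
        (pair (reindex (λ (γ , ys , y) → (γ , ys) , y) (computes body)) (rightOf (rightOf identity)))))) ⟩
      where
      bound≤ : ∀ γ ys → _
      bound≤ γ ys = s≤s (+-mono-≤ (≤-trans (acc≤ γ ys) (eval-mono W (+-monoʳ-≤ _ γ≤)))
                                  (≤-trans γ≤ (m≤n+m _ (size (codeList (code A γ) ys)))))
        where
        γ≤ : size (enc Γ γ) ≤ size (code B γ (acc γ []) ∙ enc Γ γ)
        γ≤ = m≤n⇒m≤1+n (m≤n+m _ (size (code B γ (acc γ []))))

  reverseᵗ : ∀ {Γ A xs} → Tm Γ (list A) xs → Tm Γ (list A) (List.reverse ∘ xs)
  reverseᵗ {A = A} p = foldˡᵗ (list A) (λ _ ys → ys) var (λ γ ys → m≤m+n _ _)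
    ⟨ pair (leftOf identity) (leftOf (rightOf identity)) ⟩ p nilᵗ

  foldᵗ : ∀ {Γ A xs} (B : Ty Γ) (acc : ∀ γ → List (El A γ) → El B γ) W →
    (∀ γ ys → size (code B γ (acc γ ys)) ≤ eval W (size (codeList (code A γ) ys) + size (enc Γ γ))) →
    Tm (Γ ▷ via B acc ▷ A ⇑ via B acc) (B ⇑ via B acc ⇑ (A ⇑ via B acc)) (λ γ → acc (proj₁ (proj₁ γ)) (proj₂ γ ∷ proj₂ (proj₁ γ))) →
    Tm Γ (list A) xs → Tm Γ B (λ γ → acc γ []) → Tm Γ B (λ γ → acc γ (xs γ))
  foldᵗ {xs = xs} B acc W acc≤ body p q =
    cast (λ γ → cong (code B γ ∘ acc γ) (reverse-involutive (xs γ))) (foldˡᵗ B acc W acc≤ body (reverseᵗ p) q)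

  skipAcc : ∀ {Γ A C} {B : Ty Γ} {t : ∀ γ → El B (proj₁ γ)} → Tm (Γ ▷ A) (B ⇑ A) t →
    Tm (Γ ▷ C ▷ A ⇑ C) (B ⇑ C ⇑ (A ⇑ C)) (λ γ → t (proj₁ (proj₁ γ) , proj₂ γ))
  skipAcc p = ⟨ subᵗ (λ γ → proj₁ (proj₁ γ) , proj₂ γ) (pair (leftOf identity) (rightOf (rightOf identity))) p ⟩

  accᵗ : ∀ {Γ A} {F : Carrier Γ → Set} {B : Ty Γ} {acc : ∀ γ → F γ → El B γ} →
    Tm (Γ ▷ via B acc ▷ A ⇑ via B acc) (B ⇑ via B acc ⇑ (A ⇑ via B acc)) (λ γ → acc (proj₁ (proj₁ γ)) (proj₂ (proj₁ γ)))
  accᵗ = ⟨ leftOf (rightOf identity) ⟩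

  private
    element≤ : ∀ {Γ} {A : Ty Γ} γ (x : El A γ) ys → size (code A γ x) ≤ size (codeList (code A γ) ys) →
      suc (size (code A γ x) + size (enc Γ γ)) + 1 ≤ 2 + (size (codeList (code A γ) ys) + size (enc Γ γ))
    element≤ γ x ys x≤ = ≤-trans (≤-reflexive (+-comm _ 1)) (s≤s (s≤s (+-monoˡ-≤ _ x≤)))

  mapᵗ : ∀ {Γ A xs} {B : Ty Γ} {f : ∀ γ → El B (proj₁ γ)} → Tm (Γ ▷ A) (B ⇑ A) f → Tm Γ (list A) xs →
         Tm Γ (list B) (λ γ → List.map (λ x → f (γ , x)) (xs γ))
  mapᵗ {Γ} {A} {B = B} {f} b p = foldᵗ (list B) (λ γ → List.map (λ x → f (γ , x)))
    (var ⊗ (con 1 ⊕ Computes.bound (computes b) ⊚ (con 2 ⊕ var)))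
    (λ γ ys → ≤-trans
      (size-map (code A γ) (code B γ) _ (size (codeList (code A γ) ys)) _
        (λ x x≤ → ≤-trans (output-bound (computes b) (γ , x)) (eval-mono (Computes.bound (computes b)) (element≤ {A = A} γ x ys x≤)))
        ys ≤-refl)
      (*-monoˡ-≤ _ (m≤m+n (size (codeList (code A γ) ys)) (size (enc Γ γ)))))
    (consᵗ (skipAcc b) accᵗ) p nilᵗ

  appendᵗ : ∀ {Γ A xs ys} → Tm Γ (list A) xs → Tm Γ (list A) ys → Tm Γ (list A) (λ γ → xs γ ++ ys γ)
  appendᵗ {Γ} {A} {ys = ys} p q = foldᵗ (list A) (λ γ zs → zs ++ ys γ)
    (var ⊕ Computes.bound (computes q) ⊚ (con 1 ⊕ var))
    (λ γ zs → ≤-trans (size-++ (code A γ) zs (ys γ)) (+-mono-≤ (m≤m+n _ _)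
      (≤-trans (output-bound (computes q) γ) (eval-mono (Computes.bound (computes q))
        (≤-trans (≤-reflexive (+-comm _ 1)) (s≤s (m≤n+m _ (size (codeList (code A γ) zs)))))))))
    (consᵗ v0 accᵗ) p q

  concatMapᵗ : ∀ {Γ A xs} {B : Ty Γ} {f : ∀ γ → List (El B (proj₁ γ))} →
         Tm (Γ ▷ A) (list B ⇑ A) f → Tm Γ (list A) xs →
         Tm Γ (list B) (λ γ → List.concatMap (λ x → f (γ , x)) (xs γ))
  concatMapᵗ {Γ} {A} {B = B} {f} b p = foldᵗ (list B) (λ γ → List.concatMap (λ x → f (γ , x)))
    (var ⊗ (con 1 ⊕ Computes.bound (computes b) ⊚ (con 2 ⊕ var)))
    (λ γ ys → ≤-trans
      (size-concatMap (code A γ) (code B γ) _ (size (codeList (code A γ) ys)) _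
        (λ x x≤ → ≤-trans (output-bound (computes b) (γ , x)) (eval-mono (Computes.bound (computes b)) (element≤ {A = A} γ x ys x≤)))
        ys ≤-refl)
      (*-monoˡ-≤ _ (m≤m+n (size (codeList (code A γ) ys)) (size (enc Γ γ)))))
    (appendᵗ (skipAcc b) accᵗ) p nilᵗ

  anyᵗ : ∀ {Γ A xs f} → Tm (Γ ▷ A) bool f → Tm Γ (list A) xs →
         Tm Γ bool (λ γ → any (λ x → f (γ , x)) (xs γ))
  anyᵗ {f = f} b p = foldᵗ bool (λ γ → any (λ x → f (γ , x))) (con 3) (λ γ ys → size-encodeBool _)
    (skipAcc b ∨ᵗ accᵗ) p (boolᵗ false)

  allᵗ : ∀ {Γ A xs f} → Tm (Γ ▷ A) bool f → Tm Γ (list A) xs →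
         Tm Γ bool (λ γ → all (λ x → f (γ , x)) (xs γ))
  allᵗ {f = f} b p = foldᵗ bool (λ γ → all (λ x → f (γ , x))) (con 3) (λ γ ys → size-encodeBool _)
    (skipAcc b ∧ᵗ accᵗ) p (boolᵗ true)

  filterᵗ : ∀ {Γ A xs f} → Tm (Γ ▷ A) bool f → Tm Γ (list A) xs →
         Tm Γ (list A) (λ γ → filterB (λ x → f (γ , x)) (xs γ))
  filterᵗ {A = A} {f = f} b p = foldᵗ (list A) (λ γ → filterB (λ x → f (γ , x))) var
    (λ γ ys → ≤-trans (size-filterB (code A γ) _ ys) (m≤m+n _ _))
    (ifᵗ (skipAcc b) (consᵗ v0 accᵗ) accᵗ) p nilᵗ

  -- A unary number is a list of `nil`, so a fold over it is a counting loop.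
  unitsᵗ : ∀ {Γ k} → Tm Γ nat k → Tm Γ (list (via {B = λ _ → ⊤} tree (λ _ _ → nil))) (λ γ → List.replicate (k γ) tt)
  unitsᵗ {k = k} = cast (λ γ → lemma (k γ))
    where
    lemma : ∀ n → unary n ≡ codeList (λ _ → nil) (List.replicate n tt)
    lemma zero    = refl
    lemma (suc n) = cong (nil ∙_) (lemma n)

  dropᵗ : ∀ {Γ k d} → Tm Γ nat k → Tm Γ tree d → Tm Γ tree (λ γ → dropTree (k γ) (d γ))
  dropᵗ {Γ} {k} {d} p q = cast (λ γ → cong (λ n → dropTree n (d γ)) (length-replicate (k γ)))
    (foldᵗ tree (λ γ ys → dropTree (length ys) (d γ)) (Computes.bound (computes q) ⊚ (con 1 ⊕ var))
      (λ γ ys → ≤-trans (size-dropTree (length ys) (d γ))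
        (≤-trans (output-bound (computes q) γ) (eval-mono (Computes.bound (computes q))
          (≤-trans (≤-reflexive (+-comm _ 1)) (s≤s (m≤n+m _ (size (codeList _ ys))))))))
      ⟨ convert (λ γ → right-dropTree (length (proj₂ (proj₁ γ))) (d (proj₁ (proj₁ γ))))
          (rightOf (leftOf (rightOf identity))) ⟩
      (unitsᵗ p) q)

  eqᵗ : ∀ {Γ m n} {i : ∀ γ → Fin (m γ)} {j : ∀ γ → Fin (n γ)} → Tm Γ (fin m) i → Tm Γ (fin n) j →
        Tm Γ bool (λ γ → i γ == j γ)
  eqᵗ {i = i} {j} ⟨ p ⟩ ⟨ q ⟩ = cast (λ γ → cong encodeBool (isNil-dropTree (toℕ (i γ)) (toℕ (j γ))))
    (isNilᵗ (dropᵗ ⟨ p ⟩ ⟨ q ⟩) ∧ᵗ isNilᵗ (dropᵗ ⟨ q ⟩ ⟨ p ⟩))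

  finᵗ : ∀ {Γ n} (i : Fin n) → Tm Γ (fin (const n)) (const i)
  finᵗ i = constᵗ _ (unary (toℕ i)) (λ _ → refl)

  -- Each round of a counting loop increments all entries of the range so far and puts zero in
  -- front.
  allFinᵗ : ∀ {Γ n} → Tm Γ nat n → Tm Γ (list (fin n)) (λ γ → List.allFin (n γ))
  allFinᵗ {Γ} {n} p = 
    cast {u = λ γ → List.allFin (n γ)} (λ γ → cong range (length-replicate (n γ)))
      (foldᵗ tree (λ γ ys → range (length ys)) (con 1 ⊕ var ⊗ (con 2 ⊕ (var ⊕ var)))
        (λ γ ys → size-range _ (length ys) (≤-trans (length≤size _ ys) (m≤m+n _ _)))
        (cast (λ γ → range-suc (length (proj₂ (proj₁ γ))))
          (consᵗ {A = nat} (cast {A = tree} {t = λ _ → nil} {u = λ _ → zero} (λ _ → refl) (treeᵗ nil))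
            (mapᵗ {f = λ γ → suc (toℕ (proj₂ γ))} ⟨ pair leaf (computes v0) ⟩
              (cast {B = list (fin (λ γ → length (proj₂ (proj₁ γ))))} {u = λ γ → List.allFin _} (λ _ → refl)
                (accᵗ {B = tree} {acc = λ γ ys → range (length ys)})))))
        (unitsᵗ p) (treeᵗ nil))
    where
    range : ℕ → Tree
    range k = codeList (unary ∘ toℕ) (List.allFin k)
    range-suc : ∀ k → nil ∙ codeList unary (List.map (suc ∘ toℕ) (List.allFin k)) ≡ range (suc k)
    range-suc k = cong (nil ∙_) (trans (codeList-map unary (suc ∘ toℕ) (List.allFin k))
      (trans (sym (codeList-map (unary ∘ toℕ) suc (List.allFin k)))
        (cong (codeList (unary ∘ toℕ)) (map-tabulate id suc))))
    size-range : ∀ Q k → k ≤ Q → size (range k) ≤ 1 + Q * (2 + (Q + Q))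
    size-range Q k k≤Q = ≤-trans
      (size-codeList (unary ∘ toℕ) (1 + (k + k)) (λ i → ≤-trans (≤-reflexive (size-unary (toℕ i)))
        (s≤s (+-mono-≤ (toℕ≤n i) (toℕ≤n i)))) (List.allFin k))
      (s≤s (*-mono-≤ (≤-trans (≤-reflexive (length-tabulate id)) k≤Q) (s≤s (s≤s (+-mono-≤ k≤Q k≤Q)))))
      where open import Data.Fin.Properties using (toℕ≤n)

  consVecᵗ : ∀ {Γ A k x v} → Tm Γ A x → Tm Γ (vec A k) v → Tm Γ (vec A (suc k)) (λ γ → x γ ∷ v γ)
  consVecᵗ ⟨ p ⟩ ⟨ q ⟩ = ⟨ pair p q ⟩

  nilVecᵗ : ∀ {Γ A} → Tm Γ (vec A 0) (λ _ → [])
  nilVecᵗ = ⟨ leaf ⟩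

  lookupVecᵗ : ∀ {Γ A k v} → Tm Γ (vec A k) v → ∀ i → Tm Γ A (λ γ → Vec.lookup (v γ) i)
  lookupVecᵗ {A = A} {v = v} p zero    = ⟨ convert (λ γ → lemma γ (v γ)) (leftOf (computes p)) ⟩
    where
    lemma : ∀ γ {k} (w : Vec (El A γ) (suc k)) → left (code (vec A (suc k)) γ w) ≡ code A γ (Vec.lookup w zero)
    lemma γ (_ ∷ _) = refl
  lookupVecᵗ {A = A} {suc k} {v} p (suc i) = cast (λ γ → cong (code A γ) (lemma (v γ)))
    (lookupVecᵗ {A = A} {v = Vec.tail ∘ v} ⟨ convert (λ γ → lemma′ γ (v γ)) (rightOf (computes p)) ⟩ i)
    where
    lemma : ∀ {X : Set} {k} (w : Vec X (suc k)) {i} → Vec.lookup (Vec.tail w) i ≡ Vec.lookup w (suc i)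
    lemma (_ ∷ _) = refl
    lemma′ : ∀ γ {k} (w : Vec (El A γ) (suc k)) → right (code (vec A (suc k)) γ w) ≡ code (vec A k) γ (Vec.tail w)
    lemma′ γ (_ ∷ _) = refl

  allVecᵗ : ∀ {Γ n} d → Tm Γ (list (fin n)) (λ γ → List.allFin (n γ)) → Tm Γ (list (vec (fin n) d)) (λ γ → allVec (n γ) d)
  allVecᵗ zero    p = consᵗ nilVecᵗ nilᵗ
  allVecᵗ (suc d) p = concatMapᵗ (mapᵗ (consVecᵗ (wk v0) v0) (wk (allVecᵗ d p))) p

  applyᵗ : ∀ {Γ n} a {R : ∀ γ → Vec (Fin (n γ)) a → Bool} {x : Fin a → ∀ γ → Fin (n γ)} → Tm Γ (table n a) R →
           (∀ j → Tm Γ (fin n) (x j)) → Tm Γ bool (λ γ → R γ (Vec.tabulate (λ j → x j γ)))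
  applyᵗ zero    p q = cast (λ _ → refl) p
  applyᵗ {n = n} (suc a) {R} {x} p q = applyᵗ a {λ γ → R γ ∘ (x zero γ ∷_)}
    ⟨ convert (λ γ → left-dropTree (λ i → encodeTable a (R γ ∘ (i ∷_))) (x zero γ))
        (leftOf (computes (dropᵗ {k = toℕ ∘ x zero} ⟨ computes (q zero) ⟩ ⟨ computes p ⟩))) ⟩ (q ∘ suc)

  -- The arity is fixed with the vocabulary, so the recursion unrolls into that many nested loops
  -- over `D`, each passing its choice on to the predicate.
  encodeTableᵗ : ∀ a {Γ A D} {P : ∀ γ → Vec (El A γ) a → Bool} →
    Tm (Γ ▷ vec A a) bool (λ γ → P (proj₁ γ) (proj₂ γ)) → Tm Γ (list A) D →
    Tm Γ (table (length ∘ D) a) (λ γ u → P γ (Vec.map (List.lookup (D γ)) u))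
  encodeTableᵗ zero    b d = ⟨ subᵗ (λ γ → γ , []) (pair leaf identity) b ⟩
  encodeTableᵗ (suc a) {Γ} {A} {D} {P} b d = cast {A = list tree} (λ γ → trans
      (codeList-map id _ (D γ))
      (sym (encodeList-lookup (λ z → encodeTable a (λ u → P γ (z ∷ Vec.map (List.lookup (D γ)) u))) (D γ))))
    (mapᵗ {A = A} {B = tree} {f = λ γ → encodeTable a (λ u → P (proj₁ γ) (proj₂ γ ∷ Vec.map (List.lookup (D (proj₁ γ))) u))}
      ⟨ computes (encodeTableᵗ a {A = A ⇑ A} {D ∘ proj₁} {λ γ v → P (proj₁ γ) (proj₂ γ ∷ v)}
        ⟨ subᵗ (λ γ → proj₁ (proj₁ γ) , proj₂ (proj₁ γ) ∷ proj₂ γ)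
            (pair (pair (computes (wk (v0 {A = A}))) (computes (v0 {A = vec (A ⇑ A) a}))) (rightOf (rightOf identity))) b ⟩
        (wk d)) ⟩
      d)

  reachᵗ : ∀ {Γ A D a z} {B : ∀ γ → El A γ → El A γ → Bool} →
    Tm (Γ ▷ A ▷ A ⇑ A) bool (λ γ → B (proj₁ (proj₁ γ)) (proj₂ (proj₁ γ)) (proj₂ γ)) →
    Tm Γ (list A) D → Tm Γ A a → Tm Γ A z → Tm Γ bool (λ γ → reach (D γ) (B γ) (a γ) (z γ))
  reachᵗ {Γ} {A} {D} {a} {z} {B} b d p q =
    anyᵗ ⟨ subᵗ (λ γ → (proj₁ γ , proj₂ γ) , z (proj₁ γ)) (pair (computes (wk q)) identity) b ⟩
      (foldᵗ (list A) (λ γ ys → iter (D γ) (B γ) (a γ) (length ys))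
        W
        (λ γ ys → size-iter γ (size (codeList (code A γ) ys)) (length ys))
        (filterᵗ (anyᵗ ⟨ subᵗ (λ γ → (proj₁ (proj₁ (proj₁ (proj₁ γ))) , proj₂ γ) , proj₂ (proj₁ γ))
                       (pair (computes (wk v0)) (pair (computes v0) (computes dropped))) b ⟩
                   (wk (accᵗ {B = list A} {acc = λ γ ys → iter (D γ) (B γ) (a γ) (length ys)})))
                 (wk (wk d)))
        -- `D` is the loop counter here: the accumulator depends on the consumed entries through
        -- their number.
        d (consᵗ p nilᵗ))
    where
    dropped : ∀ {Γ A B C E} → Tm (Γ ▷ A ▷ B ▷ C ▷ E) (via {B = λ γ → ⊤} tree (λ γ _ → enc Γ (proj₁ (proj₁ (proj₁ (proj₁ γ)))))) (λ _ → tt)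
    dropped = ⟨ rightOf (rightOf (rightOf (rightOf identity))) ⟩
    -- One summand for the singleton of round 0 and one for the sublists of `D` in later rounds; the
    -- bound does not grow from round to round.
    W : Poly
    W = (con 2 ⊕ Computes.bound (computes p) ⊚ (con 1 ⊕ var)) ⊕ Computes.bound (computes d) ⊚ (con 1 ⊕ var)
    grow : ∀ γ s → size (enc Γ γ) + 1 ≤ 1 + (s + size (enc Γ γ))
    grow γ s = ≤-trans (≤-reflexive (+-comm _ 1)) (s≤s (m≤n+m _ s))
    size-iter : ∀ γ s k → size (codeList (code A γ) (iter (D γ) (B γ) (a γ) k)) ≤ eval W (s + size (enc Γ γ))
    size-iter γ s zero    = m≤n⇒m≤n+o _ (s≤s (≤-trans (≤-reflexive (+-comm _ 1)) (s≤s
      (≤-trans (output-bound (computes p) γ) (eval-mono (Computes.bound (computes p)) (grow γ s))))))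
    size-iter γ s (suc k) = m≤n⇒m≤o+n _ (≤-trans (size-filterB (code A γ) _ (D γ))
      (≤-trans (output-bound (computes d) γ) (eval-mono (Computes.bound (computes d)) (grow γ s))))

  verticesᵗ : ∀ {Γ G} → Tm Γ graph G → Tm Γ (list (fin (SignedGraph.∣V∣ ∘ G))) (λ γ → List.allFin (SignedGraph.∣V∣ (G γ)))
  verticesᵗ {G = G} ⟨ p ⟩ = allFinᵗ ⟨ convert (λ γ → encodeUnary≡unary (SignedGraph.∣V∣ (G γ))) (leftOf p) ⟩

  edgeᵗ : ∀ {Γ G x y} → Tm Γ graph G → ∀ s →
    Tm Γ (fin (SignedGraph.∣V∣ ∘ G)) x → Tm Γ (fin (SignedGraph.∣V∣ ∘ G)) y →
    Tm Γ bool (λ γ → SignedGraph.edge (G γ) s (x γ) (y γ))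
  edgeᵗ {Γ} {G} {x} {y} ⟨ g ⟩ s p q = applyᵗ 2 {x = coordinate} (matrix s) terms
    where
    coordinate : Fin 2 → ∀ γ → Fin (SignedGraph.∣V∣ (G γ))
    coordinate zero       = x
    coordinate (suc zero) = y
    terms : ∀ j → Tm Γ (fin (SignedGraph.∣V∣ ∘ G)) (coordinate j)
    terms zero       = p
    terms (suc zero) = q
    matrix : ∀ s → Tm Γ (table (SignedGraph.∣V∣ ∘ G) 2) (λ γ v → SignedGraph.edge (G γ) s (Vec.lookup v zero) (Vec.lookup v (suc zero)))
    matrix Sign.+ = ⟨ leftOf (rightOf g) ⟩
    matrix Sign.- = ⟨ rightOf (rightOf g) ⟩

  domainᵗ : ∀ {Γ τ S} → Tm Γ (structure τ) S → Tm Γ (list (fin (Structure.∣V∣ ∘ S))) (λ γ → List.allFin (Structure.∣V∣ (S γ)))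
  domainᵗ {S = S} ⟨ p ⟩ = allFinᵗ ⟨ convert (λ γ → encodeUnary≡unary (Structure.∣V∣ (S γ))) (leftOf p) ⟩

  entryᵗ : ∀ {Γ k} {f : ∀ γ → Fin k → Tree} → Computes (enc Γ) (λ γ → encodeList (f γ)) → ∀ i → Computes (enc Γ) (λ γ → f γ i)
  entryᵗ p zero    = leftOf p
  entryᵗ {f = f} p (suc i) = entryᵗ {f = λ γ → f γ ∘ suc} (rightOf p) i

  relTableᵗ : ∀ {Γ τ S} → Tm Γ (structure τ) S → ∀ i → Tm Γ (table (Structure.∣V∣ ∘ S) (arity τ i)) (λ γ → Structure.rel (S γ) i)
  relTableᵗ {τ = τ} {S} ⟨ p ⟩ i = ⟨ entryᵗ {f = λ γ i → encodeTable (arity τ i) (Structure.rel (S γ) i)} (rightOf p) i ⟩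

  relᵗ : ∀ {Γ τ S} → Tm Γ (structure τ) S → ∀ i {x : Fin (arity τ i) → ∀ γ → Fin (Structure.∣V∣ (S γ))} →
    (∀ j → Tm Γ (fin (Structure.∣V∣ ∘ S)) (x j)) →
    Tm Γ bool (λ γ → Structure.rel (S γ) i (Vec.tabulate (λ j → x j γ)))
  relᵗ {τ = τ} p i = applyᵗ (arity τ i) (relTableᵗ p i)

  nullaryᵗ : ∀ {Γ n} a {R : ∀ γ → Vec (Fin (n γ)) a → Bool} → Tm Γ (table n a) R → Tm Γ bool (λ γ → nullary a (R γ))
  nullaryᵗ zero    p = cast (λ _ → refl) p
  nullaryᵗ (suc a) p = boolᵗ false

  graphOnᵗ : ∀ {Γ A D} {E : ∀ γ → Sign → El A γ → El A γ → Bool} (E-sym : ∀ γ s x y → E γ s x y ≡ E γ s y x) →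
    (∀ s → Tm (Γ ▷ A ▷ A ⇑ A) bool (λ γ → E (proj₁ (proj₁ γ)) s (proj₂ (proj₁ γ)) (proj₂ γ))) →
    Tm Γ (list A) D → Tm Γ graph (λ γ → graphOn (D γ) (E γ) (E-sym γ))
  graphOnᵗ {Γ} {A} {D} {E} _ e d = ⟨ pair (convert (λ γ → trans (codeList-map id _ (D γ)) (sym (encodeUnary-length (D γ))))
      (computes (mapᵗ {B = tree} {f = λ _ → nil} (treeᵗ nil) d))) (pair (matrix Sign.+) (matrix Sign.-)) ⟩
    where
    matrix : ∀ s → Computes (enc Γ) (λ γ → encodeList λ x → encodeList λ y → encodeBool (E γ s (List.lookup (D γ) x) (List.lookup (D γ) y)))
    matrix s = convert
      (λ γ → trans (trans (codeList-map (codeList encodeBool) _ (D γ)) (codeList-cong (λ x →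
          trans (codeList-map encodeBool _ (D γ)) (sym (encodeList-lookup (λ y → encodeBool (E γ s x y)) (D γ)))) (D γ)))
        (sym (encodeList-lookup _ (D γ))))
      (computes (mapᵗ {B = list bool} (mapᵗ {B = bool} (e s) (wk d)) d))

  encodeListᵗ : ∀ {Γ k} {f : ∀ γ → Fin k → Tree} → (∀ i → Computes (enc Γ) (λ γ → f γ i)) → Computes (enc Γ) (λ γ → encodeList (f γ))
  encodeListᵗ {k = zero}  p = leaf
  encodeListᵗ {k = suc k} p = pair (p zero) (encodeListᵗ (p ∘ suc))

  structureOnᵗ : ∀ {Γ τ A D} {P : ∀ γ i → Vec (El A γ) (arity τ i) → Bool} →
    (∀ i → Tm (Γ ▷ vec A (arity τ i)) bool (λ γ → P (proj₁ γ) i (proj₂ γ))) →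
    Tm Γ (list A) D → Tm Γ (structure τ) (λ γ → structureOn (D γ) (P γ))
  structureOnᵗ {τ = τ} {A} {D} {P} r d = ⟨ pair (convert (λ γ → trans (codeList-map id _ (D γ)) (sym (encodeUnary-length (D γ))))
      (computes (mapᵗ {B = tree} {f = λ _ → nil} (treeᵗ nil) d)))
      (encodeListᵗ (λ i → computes (encodeTableᵗ (arity τ i) {A = A} {D} {λ γ → P γ i} (r i) d))) ⟩

  pairsᵗ : ∀ {Γ A B xs ys} → Tm Γ (list A) xs → Tm Γ (list B) ys → Tm Γ (list (A ⊠ B)) (λ γ → pairs (xs γ) (ys γ))
  pairsᵗ p q = concatMapᵗ (mapᵗ (pairᵗ (wk v0) v0) (wk q)) p

  -- The program tests `c` against every value of its fixed range. Inside each branch the value is a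
  -- constant, so functions of levels and coordinates such as `label`, `keeps` and `joins` are
  -- evaluated when the program is built.
  dispatchᵗ : ∀ {Γ k} {c : Carrier Γ → Fin k} {p : Fin k → Carrier Γ → Bool} →
    Tm Γ (fin (const k)) c → (∀ i → Tm Γ bool (p i)) → Tm Γ bool (λ γ → p (c γ) γ)
  dispatchᵗ {c = c} {p} q h = cast (λ γ → cong encodeBool (anyF-== (c γ) (λ i → p i γ)))
    (anyFᵗ (λ i → eqᵗ q (finᵗ i) ∧ᵗ h i))

  finsᵗ : ∀ {Γ} k → Tm Γ (list (fin (const k))) (λ _ → List.allFin k)
  finsᵗ k = constᵗ _ (codeList (unary ∘ toℕ) (List.allFin k)) (λ _ → refl)

  booleansᵗ : ∀ {Γ} → Tm Γ (list bool) (λ _ → booleans)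
  booleansᵗ = constᵗ _ (codeList encodeBool booleans) (λ _ → refl)

  -- Programs for the signed graph of a structure and for the instances of a signed graph

  module Gadgets (τ : Vocabulary) where
    open Construction τ
    open Interpretation {τ}

    vertex : ∀ {Γ} → (Carrier Γ → ℕ) → Ty Γ
    vertex n = fin (const (suc m)) ⊠ bool ⊠ bool ⊠ vec (fin n) d

    opaque
      unfolding vertices

      vertexListᵗ : ∀ {Γ S} → Tm Γ (structure τ) S → Tm Γ (list (vertex (Structure.∣V∣ ∘ S))) (λ γ → vertices (Structure.∣V∣ (S γ)))
      vertexListᵗ s = pairsᵗ (finsᵗ (suc m)) (pairsᵗ booleansᵗ (pairsᵗ booleansᵗ (allVecᵗ d (domainᵗ s))))

    constraintᵗ : ∀ {Γ S x} → Tm Γ (structure τ) S → ∀ ℓ → Tm Γ (vec (fin (Structure.∣V∣ ∘ S)) d) x →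
      Tm Γ bool (λ γ → constraint (S γ) ℓ (x γ))
    constraintᵗ s bottom       x = boolᵗ true
    constraintᵗ s top          x = boolᵗ true
    constraintᵗ s idle         x = boolᵗ true
    constraintᵗ s (diagonal j) x = eqᵗ (lookupVecᵗ x base) (lookupVecᵗ x (slot j))
    constraintᵗ s (relation i) x = relᵗ s i (λ j → lookupVecᵗ x (slot (inject≤ j (arity≤r i))))

    agreeᵗ : ∀ {Γ} {n : Carrier Γ → ℕ} {x y} ℓ → Tm Γ (vec (fin n) d) x → Tm Γ (vec (fin n) d) y →
      Tm Γ bool (λ γ → agree ℓ (x γ) (y γ))
    agreeᵗ ℓ x y = allFᵗ (λ c → notᵗ (boolᵗ (keeps ℓ c)) ∨ᵗ eqᵗ (lookupVecᵗ x c) (lookupVecᵗ y c))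

    module _ {Γ S z z′} (σ : Tm Γ (structure τ) S)
      (p : Tm Γ (vertex (Structure.∣V∣ ∘ S)) z) (q : Tm Γ (vertex (Structure.∣V∣ ∘ S)) z′) where

      linkᵗ : ∀ s → Tm Γ bool (λ γ → link (S γ) s (z γ) (z′ γ))
      linkᵗ s =
        dispatchᵗ {p = λ l γ → linkAt (S γ) s l (height (z′ γ)) (z γ) (z′ γ)} (fstᵗ p) λ l →
        dispatchᵗ {p = λ l′ γ → linkAt (S γ) s l l′ (z γ) (z′ γ)} (fstᵗ q) λ l′ →
        boolᵗ (step s (toℕ l) (toℕ l′)) ∧ᵗ (upᵗ p ∧ᵗ downᵗ q) ∧ᵗ
        agreeᵗ (label (toℕ l)) (tupleᵗ p) (tupleᵗ q) ∧ᵗ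
        (notᵗ (downᵗ p ∧ᵗ upᵗ q) ∨ᵗ constraintᵗ σ (label (toℕ l)) (tupleᵗ p))
        where
        downᵗ : ∀ {z} → Tm Γ (vertex (Structure.∣V∣ ∘ S)) z → Tm Γ bool (down ∘ z)
        downᵗ v = fstᵗ (sndᵗ v)
        upᵗ : ∀ {z} → Tm Γ (vertex (Structure.∣V∣ ∘ S)) z → Tm Γ bool (up ∘ z)
        upᵗ v = fstᵗ (sndᵗ (sndᵗ v))
        tupleᵗ : ∀ {z} → Tm Γ (vertex (Structure.∣V∣ ∘ S)) z → Tm Γ (vec (fin (Structure.∣V∣ ∘ S)) d) (tuple ∘ z)
        tupleᵗ v = sndᵗ (sndᵗ (sndᵗ v))

    signedGraphᵗ : ∀ {Γ S} → Tm Γ (structure τ) S → Tm Γ graph (signedGraph ∘ S)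
    signedGraphᵗ {S = S} σ = graphOnᵗ {E = adjacent ∘ S} (adjacent-sym ∘ S) (λ s → linkᵗ (wk (wk σ)) (wk v0) v0 s ∨ᵗ linkᵗ (wk (wk σ)) v0 (wk v0) s) (vertexListᵗ σ)

    module _ {Γ : Ctx} where

      node : (Carrier Γ → ℕ) → Ty Γ
      node n = fin n ⊠ fin (const (suc m)) ⊠ fin (const d)

    opaque
      unfolding nodes

      nodesᵗ : ∀ {Γ G} → Tm Γ graph G → Tm Γ (list (node (SignedGraph.∣V∣ ∘ G))) (λ γ → nodes (G γ))
      nodesᵗ g = pairsᵗ (verticesᵗ g) (pairsᵗ (finsᵗ (suc m)) (finsᵗ d))

    hasUpᵗ : ∀ {Γ G w} → Tm Γ graph G → ∀ l → Tm Γ (fin (SignedGraph.∣V∣ ∘ G)) w → Tm Γ bool (λ γ → hasUp (G γ) l (w γ))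
    hasUpᵗ g l w = anyᵗ (edgeᵗ (wk g) (signAt Sign.+ l) (wk w) v0) (verticesᵗ g)

    fullᵗ : ∀ {Γ G w} → Tm Γ graph G → ∀ l → Tm Γ (fin (SignedGraph.∣V∣ ∘ G)) w → Tm Γ bool (λ γ → full (G γ) l (w γ))
    fullᵗ g l w = anyᵗ (edgeᵗ (wk g) (opposite (signAt Sign.+ l)) (wk w) v0) (verticesᵗ g) ∧ᵗ
      anyᵗ (edgeᵗ (wk g) (signAt Sign.+ l) (wk w) v0 ∧ᵗ hasUpᵗ (wk g) (suc l) v0) (verticesᵗ g)

    linkedᵗ : ∀ {Γ G z z′} → Tm Γ graph G → Tm Γ (node (SignedGraph.∣V∣ ∘ G)) z → Tm Γ (node (SignedGraph.∣V∣ ∘ G)) z′ →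
      Tm Γ bool (λ γ → linked (G γ) (z γ) (z′ γ))
    linkedᵗ {Γ} {G} {z} {z′} g p q =
      dispatchᵗ {p = λ l γ → linkedAt (G γ) l (lvl (z′ γ)) (crd (z γ)) (crd (z′ γ)) (vtx (z γ)) (vtx (z′ γ))} (fstᵗ (sndᵗ p)) λ l →
      dispatchᵗ {p = λ l′ γ → linkedAt (G γ) l l′ (crd (z γ)) (crd (z′ γ)) (vtx (z γ)) (vtx (z′ γ))} (fstᵗ (sndᵗ q)) λ l′ →
      dispatchᵗ {p = λ c γ → linkedAt (G γ) l l′ c (crd (z′ γ)) (vtx (z γ)) (vtx (z′ γ))} (sndᵗ (sndᵗ p)) λ c →
      dispatchᵗ {p = λ c′ γ → linkedAt (G γ) l l′ c c′ (vtx (z γ)) (vtx (z′ γ))} (sndᵗ (sndᵗ q)) λ c′ →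
      (boolᵗ (l == l′) ∧ᵗ eqᵗ (fstᵗ p) (fstᵗ q) ∧ᵗ (boolᵗ (c == c′) ∨ᵗ (boolᵗ (tie (label (toℕ l)) c c′) ∧ᵗ fullᵗ g (toℕ l) (fstᵗ p)))) ∨ᵗ
      (boolᵗ (c == c′) ∧ᵗ ((boolᵗ (joins Sign.+ l l′ c) ∧ᵗ edgeᵗ g Sign.+ (fstᵗ p) (fstᵗ q)) ∨ᵗ
                           (boolᵗ (joins Sign.- l l′ c) ∧ᵗ edgeᵗ g Sign.- (fstᵗ p) (fstᵗ q))))
      where
      vtx : ∀ {γ} → Node (G γ) → SignedGraph.V (G γ)
      vtx = proj₁
      lvl : ∀ {γ} → Node (G γ) → Fin (suc m)
      lvl = proj₁ ∘ proj₂
      crd : ∀ {γ} → Node (G γ) → Fin d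
      crd = proj₂ ∘ proj₂

    reachesᵗ : ∀ {Γ G z z′} → Tm Γ graph G → Tm Γ (node (SignedGraph.∣V∣ ∘ G)) z → Tm Γ (node (SignedGraph.∣V∣ ∘ G)) z′ →
      Tm Γ bool (λ γ → reaches (G γ) (z γ) (z′ γ))
    reachesᵗ {G = G} g p q = reachᵗ {B = λ γ → linked (G γ)} (linkedᵗ (wk (wk g)) (wk v0) v0) (nodesᵗ g) p q

    nodeᵗ : ∀ {Γ} {n : Carrier Γ → ℕ} {w} → Tm Γ (fin n) w → ∀ l c → Tm Γ (node n) (λ γ → w γ , l , c)
    nodeᵗ w l c = pairᵗ w (pairᵗ (finᵗ l) (finᵗ c))

    instanceᵗ : ∀ {Γ G z} → Tm Γ graph G → Tm Γ (node (SignedGraph.∣V∣ ∘ G)) z → Tm Γ (structure τ) (λ γ → instanceAt (G γ) (z γ))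
    instanceᵗ {G = G} {z} g p = structureOnᵗ {P = λ γ → constraintsOf (G γ) (z γ)}
      (λ i → anyᵗ (anyFᵗ λ l →
        boolᵗ (isRelation (label (toℕ l)) i) ∧ᵗ fullᵗ (wk (wk g)) (toℕ l) v0 ∧ᵗ
        reachesᵗ (wk (wk g)) (wk (wk p)) (nodeᵗ v0 l ★) ∧ᵗ
        allFᵗ λ j → reachesᵗ (wk (wk g)) (nodeᵗ v0 l (slot (inject≤ j (arity≤r i)))) (lookupVecᵗ (wk v0) j))
        (verticesᵗ (wk g)))
      (nodesᵗ g)

    aliveᵗ : ∀ {Γ G w} → Tm Γ graph G → ∀ l → Tm Γ (fin (SignedGraph.∣V∣ ∘ G)) w → Tm Γ bool (λ γ → alive (G γ) l (w γ))
    aliveᵗ g l w = allᵗ (aliveToᵗ Sign.+ ∧ᵗ aliveToᵗ Sign.-) (verticesᵗ g)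
      where
      aliveToᵗ : ∀ s → Tm _ bool _
      aliveToᵗ s = notᵗ (edgeᵗ (wk g) s (wk w) v0) ∨ᵗ boolᵗ (anyF (λ l′ → joins s l l′ ★))

    goodᵗ : ∀ {Γ G z} → Tm Γ graph G → Tm Γ (node (SignedGraph.∣V∣ ∘ G)) z → Tm Γ bool (λ γ → good (G γ) (z γ))
    goodᵗ g p = allᵗ (allFᵗ λ l → notᵗ (reached l) ∨ᵗ
        (aliveᵗ (wk g) l v0 ∧ᵗ allFᵗ λ l′ → notᵗ (reached l′) ∨ᵗ boolᵗ (l == l′)))
      (verticesᵗ g)
      where
      reached : ∀ l → Tm _ bool _
      reached l = reachesᵗ (wk g) (wk p) (nodeᵗ v0 l ★)

-- Reductions

instances : DecisionProblem → Ctx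
Carrier (instances P) = DecisionProblem.Instance P
enc     (instances P) = DecisionProblem.encode P

reduction : ∀ {P Q} (b : DecisionProblem.Instance P → Bool) →
  Terms.Tm (DecisionProblem.Language Q) (instances P) bool b →
  (∀ I → DecisionProblem.Yes P I ⇔ T (b I)) → P ≤ᵖ Q
reduction {P} {Q} b p b⇔ = 1 , program , a , c , λ I →
  let d         = DecisionProblem.encode P I
      t , ⇓ , t≤ = run I nil
      open ≤-Reasoning
  in t , _ , ⇓ ,
     (begin
       t                              ≤⟨ m+n≤o⇒m≤o t t≤ ⟩
       -- The summand 1 is the size of the empty stack.
       eval bound (size d + 1)        ≡⟨⟩
       eval (bound ⊚ (var ⊕ con 1)) (size d) ≤⟨ mono (size d) {{>-nonZero (size>0 d)}} ⟩
       a * size d ^ c                 ∎) ,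
     mk⇔ (λ y → accepting (b I) (Equivalence.to (b⇔ I) y))
         (λ acc → Equivalence.from (b⇔ I) (accepting⁻¹ (b I) acc))
  where
  open Programs (DecisionProblem.Language Q)
  open Terms (DecisionProblem.Language Q)
  open Computes (computes p)
  a c : ℕ
  a = proj₁ (eval-≤-monomial (bound ⊚ (var ⊕ con 1)))
  c = proj₁ (proj₂ (eval-≤-monomial (bound ⊚ (var ⊕ con 1))))
  mono = proj₂ (proj₂ (eval-≤-monomial (bound ⊚ (var ⊕ con 1))))
  accepting : ∀ x → T x → encodeBool x ≢ nil
  accepting true  _ ()
  accepting⁻¹ : ∀ x → encodeBool x ≢ nil → T x
  accepting⁻¹ true  _ = tt
  accepting⁻¹ false n = n refl

module _ {τ : Vocabulary} (A : Structure τ) where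
  open Construction τ
  open Interpretation {τ}

  -- A single query on the signed graph of the instance, combined with a test of the 0-ary
  -- relations, whose values in `A` are constants of the program.
  CSP≤EcHom : CSP A ≤ᵖ EcHom (signedGraph A)
  CSP≤EcHom = reduction {CSP A} {EcHom (signedGraph A)} decide
    (allFᵗ (λ i → notᵗ (nullaryᵗ (arity τ i) (relTableᵗ σ i)) ∨ᵗ boolᵗ (nullary (arity τ i) (Structure.rel A i))) ∧ᵗ
     ⟨ oracle (language? (EcHom (signedGraph A)) (λ G → ecHomomorphism? G (signedGraph A)) (EcHom-injective (signedGraph A)) ∘ signedGraph)
         (computes (signedGraphᵗ σ)) ⟩)
    (λ S → mk⇔
      (λ h → let nc , φ = to (homomorphism⇔ S A) h in
        from (T-∧ {x = compatible S}) (from T-allF (from T-implies ∘ nc) , from (T-does (ecHomomorphism? (signedGraph S) (signedGraph A))) φ))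
      (λ h → let c , φ = to (T-∧ {x = compatible S}) h in
        from (homomorphism⇔ S A) ((λ i → to T-implies (to (T-allF {p = clause S}) c i)) , to (T-does (ecHomomorphism? (signedGraph S) (signedGraph A))) φ)))
    where
    Q : DecisionProblem
    Q = EcHom (signedGraph A)
    open Programs (DecisionProblem.Language Q)
    open Terms (DecisionProblem.Language Q)
    open Gadgets τ
    clause : Structure τ → Fin k → Bool
    clause S i = not (nullary (arity τ i) (Structure.rel S i)) ∨ nullary (arity τ i) (Structure.rel A i)
    compatible decide : Structure τ → Bool
    compatible S = allF (clause S)
    decide S = compatible S ∧ Dec.does (ecHomomorphism? (signedGraph S) (signedGraph A))
    σ : Tm (instances (CSP A)) (structure τ) id
    σ = ⟨ identity ⟩

  -- One query per vertex and level, with a number of levels fixed by the vocabulary. The answers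
  -- are combined by a disjunction over levels inside a conjunction over vertices, which uses the
  -- freedom of a Turing reduction.
  EcHom≤CSP : EcHom (signedGraph A) ≤ᵖ CSP A
  EcHom≤CSP = reduction {EcHom (signedGraph A)} {CSP A} decide
    (allᵗ (anyFᵗ λ l → goodᵗ (wk g) (nodeᵗ v0 l ★) ∧ᵗ
        ⟨ oracle (λ γ → language? (CSP A) (λ S → homomorphism? S A) (CSP-injective A) (instanceAt (proj₁ γ) (proj₂ γ , l , ★)))
            (computes (instanceᵗ (wk g) (nodeᵗ v0 l ★))) ⟩)
      (verticesᵗ g))
    (λ G → mk⇔
      (λ φ → from T-allFin λ v → let l , gd , h = to (ecHomomorphism⇔ G A) φ v in
        from (T-anyF {p = placeable G v}) (l , from (T-∧ {good G (v , l , ★)}) (from (T-good G) gd , from (T-does (homomorphism? _ A)) h)))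
      (λ h → from (ecHomomorphism⇔ G A) λ v →
        let l , h′ = to (T-anyF {p = placeable G v}) (to (T-allFin {p = λ v → anyF (placeable G v)}) h v)
            gd , y = to (T-∧ {good G (v , l , ★)}) h′
        in l , to (T-good G) gd , to (T-does (homomorphism? _ A)) y))
    where
    Q : DecisionProblem
    Q = CSP A
    open Programs (DecisionProblem.Language Q)
    open Terms (DecisionProblem.Language Q)
    open Gadgets τ
    placeable : (G : SignedGraph) → SignedGraph.V G → Fin (suc m) → Bool
    placeable G v l = good G (v , l , ★) ∧ Dec.does (homomorphism? (instanceAt G (v , l , ★)) A)
    decide : SignedGraph → Bool
    decide G = all (λ v → anyF (placeable G v)) (List.allFin (SignedGraph.∣V∣ G))
    g : Tm (instances (EcHom (signedGraph A))) graph id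
    g = ⟨ identity ⟩

theorem3p1 : (τ : Vocabulary) (A : Structure τ) →
    Σ SignedGraph λ H →
    (EcHom H ≡ᵖ CSP A) ×
    Bipartite H ×
    (∃₂ λ s m → EcHomomorphism H (alternatingPath s m))
theorem3p1 τ A =
  signedGraph A , (EcHom≤CSP A , CSP≤EcHom A) , signedGraph-bipartite A , Sign.+ , m , signedGraph→path A
  where open Construction τ
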